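{- Let $k\in\{2,3\}$. Every hypertree is $k$-cordial.
   Context: A hypergraph $H=(V,E)$ consists of a finite vertex set $V$ and a set $E$ of subsets of $V$ (edges), each of cardinality at least $2$. The incidence graph $G_H$ is the bipartite graph on $V\cup E$ with $v$ adjacent to $e$ iff $v\in e$. A hypertree is a hypergraph whose incidence graph $G_H$ is a tree. For a vertex labeling $f:V\to\mathbb{Z}_k$, the induced edge labeling is $f(e)=\sum_{v\in e}f(v)$ (mod $k$). Let $n_a(f)$ and $m_a(f)$ denote the number of vertices, respectively edges, with label $a$. The labeling $f$ is $k$-cordial if $|n_a(f)-n_b(f)|\le 1$ and $|m_a(f)-m_b(f)|\le 1$ for all $a,b\in\mathbb{Z}_k$; $H$ is $k$-cordial if it admits a $k$-cordial labeling. -}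

module Defs where

open import Data.Nat using (ℕ; _+_; _≤_; ∣_-_∣; NonZero)
open import Data.Nat.DivMod using (_mod_)
open import Data.Fin using (Fin; toℕ)
open import Data.Fin.Properties using (_≟_)
open import Data.Fin.Subset using (Subset; _∈_; ∣_∣)
open import Data.Fin.Subset.Properties using (_∈?_)
open import Data.List using (List; []; _∷_; length; filter; allFin; map; head; last)
open import Data.Nat.ListAction using (sum)
open import Data.List.Relation.Unary.Unique.Propositional using (Unique)
open import Data.Sum using (_⊎_; inj₁; inj₂)
open import Data.Product using (Σ; ∃; _×_; _,_)
open import Data.Empty using (⊥)
open import Data.Maybe using (Maybe; just; nothing)
open import Relation.Nullary using (¬_; yes; no)
open import Relation.Binary.PropositionalEquality using (_≡_)
open import Function.Definitions using (Injective)

record Hypergraph : Set where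
  field
    n        : ℕ
    m        : ℕ
    edge     : Fin m → Subset n
    distinct : Injective _≡_ _≡_ edge -- E is a *set* of subsets
    size≥2   : ∀ e → 2 ≤ ∣ edge e ∣
open Hypergraph public

-- Incidence graph G_H: bipartite graph on V ⊎ E, v ~ e iff v ∈ e.

Node : Hypergraph → Set
Node H = Fin (n H) ⊎ Fin (m H)

Adj : (H : Hypergraph) → Node H → Node H → Set
Adj H (inj₁ v) (inj₂ e) = v ∈ edge H e
Adj H (inj₂ e) (inj₁ v) = v ∈ edge H e
Adj H (inj₁ _) (inj₁ _) = ⊥
Adj H (inj₂ _) (inj₂ _) = ⊥

Chain : (H : Hypergraph) → List (Node H) → Set
Chain H []           = Data.Unit.⊤ where import Data.Unit
Chain H (x ∷ [])     = Data.Unit.⊤ where import Data.Unit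
Chain H (x ∷ y ∷ xs) = Adj H x y × Chain H (y ∷ xs)

Walk : (H : Hypergraph) → Node H → Node H → Set
Walk H x y = Σ (List (Node H)) λ w →
  Chain H w × head w ≡ just x × last w ≡ just y

Connected : Hypergraph → Set
Connected H = ∀ (x y : Node H) → Walk H x y

IsCycle : (H : Hypergraph) → List (Node H) → Set
IsCycle H c = 3 ≤ length c × Unique c × Chain H c ×
  Σ (Node H) λ x → Σ (Node H) λ y →
    head c ≡ just x × last c ≡ just y × Adj H y x

Acyclic : Hypergraph → Set
Acyclic H = ∀ (c : List (Node H)) → ¬ IsCycle H c

IsHypertree : Hypergraph → Set
IsHypertree H = Connected H × Acyclic H

-- Labelings f : V → ℤ_k (ℤ_k represented by Fin k)

edgeSum : ∀ {n k} → (Fin n → Fin k) → Subset n → ℕ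
edgeSum {n} f e = sum (map (λ v → val v) (allFin n))
  where
  val : Fin _ → ℕ
  val v with v ∈? e
  ... | yes _ = toℕ (f v)
  ... | no  _ = 0

edgeLabel : ∀ {n k} .{{_ : NonZero k}} → (Fin n → Fin k) → Subset n → Fin k
edgeLabel f e = edgeSum f e mod _

vCount : (H : Hypergraph) {k : ℕ} → (Fin (n H) → Fin k) → Fin k → ℕ
vCount H f a = length (filter (λ v → f v ≟ a) (allFin (n H)))

eCount : (H : Hypergraph) {k : ℕ} .{{_ : NonZero k}} →
         (Fin (n H) → Fin k) → Fin k → ℕ
eCount H f a = length (filter (λ e → edgeLabel f (edge H e) ≟ a) (allFin (m H)))

IsCordialLabeling : (H : Hypergraph) (k : ℕ) .{{_ : NonZero k}} →
                    (Fin (n H) → Fin k) → Set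
IsCordialLabeling H k f =
  (∀ a b → ∣ vCount H f a - vCount H f b ∣ ≤ 1) ×
  (∀ a b → ∣ eCount H f a - eCount H f b ∣ ≤ 1)

IsCordial : (H : Hypergraph) (k : ℕ) .{{_ : NonZero k}} → Set
IsCordial H k = ∃ λ (f : Fin (n H) → Fin k) → IsCordialLabeling H k f

{-# OPTIONS --safe #-}

-- Root a hypertree at a vertex and record, for each root label, the deviations
-- (differences of the label counts of vertices and of edges) that its
-- labellings realise. The deviations of a hypertree are determined by those of
-- the smaller rooted hypertrees it is composed of. If only small deviations are
-- kept, then finitely many sets of deviations suffice: for k = 2 and k = 3 there
-- is a finite family of such sets that contains (a subset of) the set of every
-- rooted hypertree, and each member of which contains a balanced deviation. That
-- the family is closed under the composition of hypertrees is a finite check.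

module Submission where

open import Defs
open import Algebra.Bundles using (CommutativeMonoid)
open import Algebra.Construct.DirectProduct using (commutativeMonoid)
open import Data.Bool using (Bool; true; false; T; _∧_; if_then_else_)
open import Data.Bool.ListAction using (any; all)
open import Data.Bool.Properties using (T-∧)
open import Data.Empty using (⊥-elim)
open import Data.Fin using (Fin; zero; suc; toℕ)
open import Data.Fin.Properties as Fin using (_≟_; all?; any?; injective⇒≤; toℕ-injective; toℕ-fromℕ<; toℕ<n)
open import Data.Fin.Subset using (Subset; ⁅_⁆) renaming (_∈_ to _∈ₛ_; _∉_ to _∉ₛ_)
open import Data.Fin.Subset.Properties using (x∈⁅x⁆; ∣⁅x⁆∣≡1; p⊆q⇒∣p∣≤∣q∣; ∣p∣≤n) renaming (_∈?_ to _∈ₛ?_)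
open import Data.Integer as ℤ using (ℤ; +_; -[1+_]; _⊖_; 0ℤ; 1ℤ)
import Data.Integer.Properties as ℤ
open import Data.Integer.Tactic.RingSolver using (solve-∀)
open import Data.List using (List; []; _∷_; _++_; length; lookup; map; filter; allFin; cartesianProduct; head; last)
open import Data.List.Membership.DecPropositional using (_∈?_)
open import Data.List.Membership.Propositional using (_∈_; _∉_; find)
open import Data.List.Membership.Propositional.Properties using (∈-++⁻; ∈-++⁺ˡ; ∈-++⁺ʳ; ∈-filter⁺; ∈-filter⁻; ∈-allFin; ∈-lookup)
open import Data.List.Membership.Propositional.Properties.WithK using (unique∧set⇒bag)
open import Data.List.Properties using (map-cong-local)
open import Data.List.Relation.Binary.BagAndSetEquality using (∼bag⇒↭)
open import Data.List.Relation.Binary.Disjoint.Propositional using (Disjoint)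
open import Data.List.Relation.Binary.Permutation.Propositional as ↭ using (_↭_)
open import Data.List.Relation.Binary.Permutation.Propositional.Properties using (map⁺)
open import Data.List.Relation.Unary.All as All using (All; []; _∷_)
open import Data.List.Relation.Unary.All.Properties using (++⁺; ¬Any⇒All¬; all⁺)
open import Data.List.Relation.Unary.AllPairs using ([]; _∷_)
open import Data.List.Relation.Unary.Any as Any using (here; there)
open import Data.List.Relation.Unary.Any.Properties using (any⁻)
open import Data.List.Relation.Unary.Unique.Propositional using (Unique)
import Data.List.Relation.Unary.Unique.Propositional.Properties as Unique
open import Data.Maybe using (just)
open import Data.Nat using (ℕ; zero; suc; _+_; _∸_; _/_; _%_; _≤_; _<_; _≤?_; _≡ᵇ_; z≤n; s≤s; NonZero; ∣_-_∣)
open import Data.Nat.DivMod using (_mod_; %-distribˡ-+; m<n⇒m%n≡m; m%n%n≡m%n)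
open import Data.Nat.ListAction using (sum)
open import Data.Nat.ListAction.Properties using (sum-↭)
open import Data.Nat.Properties using (≤-trans; ≤-reflexive; <⇒≱; +-suc; +-identityʳ; ≡ᵇ⇒≡)
open import Data.Product using (∃; ∃₂; _×_; _,_; proj₁; proj₂)
open import Data.Sum using (_⊎_; inj₁; inj₂)
open import Data.Unit using (tt)
open import Data.Vec as Vec using (Vec; []; _∷_)
open import Function using (_∘_; case_of_; _⇔_; mk⇔; Equivalence)
open import Function.Definitions using (Injective)
open import Level using (0ℓ)
open import Relation.Binary.PropositionalEquality as ≡ using (_≡_; _≢_; refl; sym; trans; cong; cong₂; subst)
open import Relation.Nullary using (¬_; Dec; does; yes; no; ¬?; ⌊_⌋)
open import Relation.Nullary.Decidable using (_×-dec_; decidable-stable; toWitness)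

-- Growing a hypertree edge by edge

-- That the parts have balanced labellings is too little to know, since their surpluses can add up;
-- so the induction carries several deviations for every root label. Degrees and edge sizes are
-- unbounded, hence composition is split into operations on at most two pieces: collecting the trees
-- that hang from an edge one at a time (`only`, `also`), closing them off by the edge (`join`), and
-- attaching the result at a vertex (`hang`). Subsets suffice because the laws of a family run
-- backwards: every deviation listed for a composite has to arise from deviations listed for its
-- parts, so discarding deviations of a composite keeps its law. Completeness is never claimed. No
-- rooted tree is built. An order of the edges in which each edge meets the union of the earlier
-- part in exactly one vertex carries the recursion. Types accumulate from the last edge back to the
-- root; labels are then chosen in the opposite direction, starting from a balanced deviation at the
-- root.

lookup-injective : ∀ {A : Set} {xs : List A} → Unique xs → Injective _≡_ _≡_ (lookup xs)
lookup-injective {xs = _ ∷ _} _ {zero} {zero} _ = refl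
lookup-injective {xs = _ ∷ xs} (x∉ ∷ _) {zero} {suc j} eq = ⊥-elim (All.lookup x∉ (∈-lookup {xs = xs} j) eq)
lookup-injective {xs = _ ∷ xs} (x∉ ∷ _) {suc i} {zero} eq = ⊥-elim (All.lookup x∉ (∈-lookup {xs = xs} i) (sym eq))
lookup-injective {xs = _ ∷ _} (_ ∷ u) {suc i} {suc j} eq = cong suc (lookup-injective u eq)

Unique⇒length≤ : ∀ {m} {xs : List (Fin m)} → Unique xs → length xs ≤ m
Unique⇒length≤ u = injective⇒≤ (lookup-injective u)

last-++ : ∀ {A : Set} (l : List A) {y r} → last (l ++ y ∷ r) ≡ last (y ∷ r)
last-++ [] = refl
last-++ (x ∷ []) = refl
last-++ (x ∷ l@(_ ∷ _)) = last-++ l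

head-++ : ∀ {A : Set} (l : List A) {x r} → head l ≡ just x → head (l ++ r) ≡ just x
head-++ (x ∷ l) eq = eq

module _ (H : Hypergraph) where

  private
    V = Fin (n H)
    E = Fin (m H)

    _∈ᵥ?_ : (v : V) (vs : List V) → Dec (v ∈ vs)
    _∈ᵥ?_ = _∈?_ _≟_

    _∈ₑ?_ : (e : E) (es : List E) → Dec (e ∈ es)
    _∈ₑ?_ = _∈?_ _≟_

  -- The new vertices of an edge form a list `x ∷ xs`, nonempty because edges have at least two
  -- vertices; `p` is the one vertex through which the edge is attached. Recording the members of
  -- `e` as `p ∷ x ∷ xs` is what later splits its label into the label of `p` and a sum over the new
  -- vertices.
  data Growth : List V → List E → Set where
    root : ∀ r → Growth (r ∷ []) []
    grow : ∀ {vs es e p x xs} → Growth vs es → p ∈ vs →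
           Unique (x ∷ xs) → Disjoint (x ∷ xs) vs → e ∉ es →
           (∀ {v} → v ∈ₛ edge H e ⇔ v ∈ p ∷ x ∷ xs) →
           Growth ((x ∷ xs) ++ vs) (e ∷ es)

  Growth⇒Unique-vs : ∀ {vs es} → Growth vs es → Unique vs
  Growth⇒Unique-vs (root r) = [] ∷ []
  Growth⇒Unique-vs (grow g _ u d _ _) = Unique.++⁺ u (Growth⇒Unique-vs g) d

  Growth⇒Unique-es : ∀ {vs es} → Growth vs es → Unique es
  Growth⇒Unique-es (root r) = []
  Growth⇒Unique-es (grow g _ _ _ e∉es _) = ¬Any⇒All¬ _ e∉es ∷ Growth⇒Unique-es g

  Growth⇒inhabited : ∀ {vs es} → Growth vs es → ∃ (_∈ vs)
  Growth⇒inhabited (root r) = r , here refl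
  Growth⇒inhabited (grow _ _ _ _ _ _) = _ , here refl

  -- Used twice: a walk cannot leave the visited part through a visited edge, and the label of a
  -- visited edge depends only on labels of visited vertices.
  Growth⇒closed : ∀ {vs es e v} → Growth vs es → e ∈ es → v ∈ₛ edge H e → v ∈ vs
  Growth⇒closed (grow {xs = xs} g p∈vs _ _ _ e≗) (here refl) v∈e with Equivalence.to e≗ v∈e
  ... | here refl = ∈-++⁺ʳ (_ ∷ xs) p∈vs
  ... | there v∈xs = ∈-++⁺ˡ v∈xs
  Growth⇒closed (grow {x = x} {xs} g _ _ _ _ _) (there e∈es) v∈e =
    ∈-++⁺ʳ (x ∷ xs) (Growth⇒closed g e∈es v∈e)

  -- Paths inside the visited part

  Visited : List V → List E → Node H → Set
  Visited vs es (inj₁ v) = v ∈ vs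
  Visited vs es (inj₂ e) = e ∈ es

  Visited-++ : ∀ xs {vs es e a} → Visited vs es a → Visited (xs ++ vs) (e ∷ es) a
  Visited-++ xs {a = inj₁ _} = ∈-++⁺ʳ xs
  Visited-++ xs {a = inj₂ _} = there

  -- The field `visited` keeps the path disjoint from any unvisited node, so that such a node can be
  -- added without repetition.
  record Path (vs : List V) (es : List E) (u v : V) : Set where
    constructor path
    field
      nodes   : List (Node H)
      visited : All (Visited vs es) nodes
      unique  : Unique nodes
      chain   : Chain H nodes
      head≡   : head nodes ≡ just (inj₁ u)
      last≡   : last nodes ≡ just (inj₁ v)

  Chain-++ : ∀ l {x y r} → Chain H l → last l ≡ just x → Adj H x y → Chain H (y ∷ r) → Chain H (l ++ y ∷ r)
  Chain-++ (x ∷ []) _ refl xy c = xy , c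
  Chain-++ (x ∷ l@(_ ∷ _)) (xx , c) eq xy c′ = xx , Chain-++ l c eq xy c′

  -- A new vertex reaches an old one through `e` and `p`, and two new vertices are joined through
  -- `e` alone; old paths persist.
  Growth⇒Path : ∀ {vs es u v} → Growth vs es → u ∈ vs → v ∈ vs → Path vs es u v
  Growth⇒Path (root r) (here refl) (here refl) =
    path (inj₁ r ∷ []) (here refl ∷ []) ([] ∷ []) tt refl refl
  Growth⇒Path {u = u} {v} (grow {e = e} {x = x} {xs} g p∈vs un dj e∉es e≗) u∈ v∈
    with ∈-++⁻ (x ∷ xs) u∈ | ∈-++⁻ (x ∷ xs) v∈
  ... | inj₁ u∈xs | inj₁ v∈xs with u ≟ v
  ...   | yes refl = path (inj₁ u ∷ []) (u∈ ∷ []) ([] ∷ []) tt refl refl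
  ...   | no u≢v = path (inj₁ u ∷ inj₂ e ∷ inj₁ v ∷ []) (u∈ ∷ here refl ∷ v∈ ∷ [])
                     (((λ ()) ∷ (λ { refl → u≢v refl }) ∷ []) ∷ ((λ ()) ∷ []) ∷ [] ∷ [])
                     (Equivalence.from e≗ (there u∈xs) , Equivalence.from e≗ (there v∈xs) , tt) refl refl
  Growth⇒Path {u = u} (grow {e = e} {p} {x} {xs} g p∈vs un dj e∉es e≗) u∈ v∈
      | inj₁ u∈xs | inj₂ v∈vs with Growth⇒Path g p∈vs v∈vs
  ... | path (_ ∷ l) vis uni ch refl la =
    path (inj₁ u ∷ inj₂ e ∷ inj₁ p ∷ l) (u∈ ∷ here refl ∷ All.map (λ {a} → Visited-++ (x ∷ xs) {a = a}) vis)
      (((λ ()) ∷ All.map (λ { vi refl → dj (u∈xs , vi) }) vis) ∷ All.map (λ { vi refl → e∉es vi }) vis ∷ uni)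
      (Equivalence.from e≗ (there u∈xs) , Equivalence.from e≗ (here refl) , ch) refl la
  Growth⇒Path {v = v} (grow {e = e} {x = x} {xs} g p∈vs un dj e∉es e≗) u∈ v∈
      | inj₂ u∈vs | inj₁ v∈xs with Growth⇒Path g u∈vs p∈vs
  ... | path l vis uni ch he la =
    path (l ++ inj₂ e ∷ inj₁ v ∷ []) (++⁺ (All.map (λ {a} → Visited-++ (x ∷ xs) {a = a}) vis) (here refl ∷ v∈ ∷ []))
      (Unique.++⁺ uni (((λ ()) ∷ []) ∷ [] ∷ []) fresh)
      (Chain-++ l ch la (Equivalence.from e≗ (here refl)) (Equivalence.from e≗ (there v∈xs) , tt))
      (head-++ l he) (last-++ l)
    where
    fresh : Disjoint l (inj₂ e ∷ inj₁ v ∷ [])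
    fresh (a∈ , here refl) = e∉es (All.lookup vis a∈)
    fresh (a∈ , there (here refl)) = dj (v∈xs , All.lookup vis a∈)
  Growth⇒Path (grow {x = x} {xs} g p∈vs un dj e∉es e≗) u∈ v∈
      | inj₂ u∈vs | inj₂ v∈vs with Growth⇒Path g u∈vs v∈vs
  ... | path l vis uni ch he la = path l (All.map (λ {a} → Visited-++ (x ∷ xs) {a = a}) vis) uni ch he la

  -- Two distinct common vertices would be joined by a path in the visited part, and the unvisited
  -- edge `e` would close it to a cycle. This is where acyclicity enters.
  meets-once : ∀ {vs es e u v} → Acyclic H → Growth vs es → e ∉ es →
               u ∈ vs → v ∈ vs → u ∈ₛ edge H e → v ∈ₛ edge H e → u ≡ v
  meets-once {e = e} {u} {v} acyclic g e∉es u∈vs v∈vs u∈e v∈e with u ≟ v | Growth⇒Path g u∈vs v∈vs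
  ... | yes u≡v | _ = u≡v
  ... | no u≢v | path (_ ∷ []) _ _ _ refl refl = ⊥-elim (u≢v refl)
  ... | no u≢v | path l@(_ ∷ _ ∷ _) vis uni ch refl la =
    ⊥-elim (acyclic (inj₂ e ∷ l)
      ( s≤s (s≤s (s≤s z≤n)) , All.map (λ { vi refl → e∉es vi }) vis ∷ uni , (u∈e , ch)
      , inj₂ e , inj₁ v , refl , la , v∈e))

  -- Otherwise the edge is contained in a singleton, against `size≥2`.
  another-vertex : ∀ e p → ∃ λ u → u ∈ₛ edge H e × u ≢ p
  another-vertex e p with any? (λ u → (u ∈ₛ? edge H e) ×-dec ¬? (u ≟ p))
  ... | yes found = found
  ... | no none = ⊥-elim (<⇒≱ (size≥2 H e) (≤-trans (p⊆q⇒∣p∣≤∣q∣ e⊆⁅p⁆) (≤-reflexive (∣⁅x⁆∣≡1 p))))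
    where
    e⊆⁅p⁆ : ∀ {u} → u ∈ₛ edge H e → u ∈ₛ ⁅ p ⁆
    e⊆⁅p⁆ {u} u∈e with u ≟ p
    ... | yes refl = x∈⁅x⁆ p
    ... | no u≢p = ⊥-elim (none (u , u∈e , u≢p))

  -- Extending the visited part to the whole hypertree

  Exit : List V → List E → Set
  Exit vs es = ∃₂ λ e p → e ∉ es × p ∈ vs × p ∈ₛ edge H e

  -- By `Growth⇒closed` the step from a visited edge leads to a visited vertex, so the first
  -- unvisited node on a walk is an edge entered from a visited vertex.
  exit : ∀ {vs es} → Growth vs es → ∀ a w {b} → Chain H (a ∷ w) → Visited vs es a →
         last (a ∷ w) ≡ just b → Visited vs es b ⊎ Exit vs es
  exit g a [] _ a∈ refl = inj₁ a∈
  exit {es = es} g (inj₁ v) (inj₂ e ∷ w) (v∈e , c) v∈vs la with e ∈ₑ? es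
  ... | yes e∈es = exit g (inj₂ e) w c e∈es la
  ... | no e∉es = inj₂ (e , v , e∉es , v∈vs , v∈e)
  exit g (inj₂ e) (inj₁ v ∷ w) (v∈e , c) e∈es la = exit g (inj₁ v) w c (Growth⇒closed g e∈es v∈e) la

  reach : ∀ {vs es} → Connected H → Growth vs es → ∀ b → Visited vs es b ⊎ Exit vs es
  reach connected g b with Growth⇒inhabited g
  ... | r , r∈vs with connected (inj₁ r) b
  ...   | _ ∷ w , c , refl , la = exit g (inj₁ r) w c r∈vs la

  -- The new vertices are those of `e` not visited so far; by `meets-once` these are all its
  -- vertices except `p`.
  extend : ∀ {vs es} → Acyclic H → Growth vs es → Exit vs es →
           ∃₂ λ vs′ e → Growth vs′ (e ∷ es)
  extend {vs} {es} acyclic g (e , p , e∉es , p∈vs , p∈e) = build fresh refl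
    where
    new? : ∀ v → Dec (v ∈ₛ edge H e × v ∉ vs)
    new? v = (v ∈ₛ? edge H e) ×-dec ¬? (v ∈ᵥ? vs)
    fresh : List V
    fresh = filter new? (allFin (n H))
    -- Abstracting `fresh` with an equation allows a case split on it while membership can still be
    -- read through the filter.
    build : ∀ xs → xs ≡ fresh → ∃₂ λ vs′ e → Growth vs′ (e ∷ es)
    -- Without a new vertex, the second vertex of `e` would be visited, contradicting `meets-once`.
    build [] eq with another-vertex e p
    ... | u , u∈e , u≢p with subst (u ∈_) (sym eq)
            (∈-filter⁺ new? (∈-allFin u) (u∈e , λ u∈vs → u≢p (meets-once acyclic g e∉es u∈vs p∈vs u∈e p∈e)))
    ...   | ()
    build (x ∷ xs) eq = _ , e , grow g p∈vs (subst Unique (sym eq) (Unique.filter⁺ new? (Unique.allFin⁺ _)))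
        (λ { (v∈xs , v∈vs) → proj₂ (isNew v∈xs) v∈vs }) e∉es (mk⇔ to from)
      where
      isNew : ∀ {v} → v ∈ x ∷ xs → v ∈ₛ edge H e × v ∉ vs
      isNew v∈xs = proj₂ (∈-filter⁻ new? {xs = allFin (n H)} (subst (_ ∈_) eq v∈xs))
      to : ∀ {v} → v ∈ₛ edge H e → v ∈ p ∷ x ∷ xs
      to {v} v∈e with v ∈ᵥ? vs
      ... | yes v∈vs = here (meets-once acyclic g e∉es v∈vs p∈vs v∈e p∈e)
      ... | no v∉vs = there (subst (v ∈_) (sym eq) (∈-filter⁺ new? (∈-allFin v) (v∈e , v∉vs)))
      from : ∀ {v} → v ∈ p ∷ x ∷ xs → v ∈ₛ edge H e
      from (here refl) = p∈e
      from (there v∈xs) = proj₁ (isNew v∈xs)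

  Spanning : Set
  Spanning = ∃₂ λ vs es → Growth vs es × (∀ v → v ∈ vs) × (∀ e → e ∈ es)

  span : IsHypertree H → ∀ fuel {vs es} → Growth vs es → m H < fuel + length es → Spanning
  -- Each extension adds an edge and spends one unit of fuel, which preserves the bound. With the
  -- fuel exhausted, more than `m H` distinct edges would be listed.
  span _ zero g lt = ⊥-elim (<⇒≱ lt (Unique⇒length≤ (Growth⇒Unique-es g)))
  span tree@(connected , acyclic) (suc fuel) {vs} {es} g lt with any? (λ e → ¬? (e ∈ₑ? es))
  ... | no none = vs , es , g , all-vs , all-es
    where
    all-es : ∀ e → e ∈ es
    all-es e = decidable-stable (e ∈ₑ? es) λ e∉es → none (e , e∉es)
    -- An unvisited vertex would yield an exit, hence an unvisited edge.
    all-vs : ∀ v → v ∈ vs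
    all-vs v with reach connected g (inj₁ v)
    ... | inj₁ v∈vs = v∈vs
    ... | inj₂ (e , _ , e∉es , _) = ⊥-elim (e∉es (all-es e))
  ... | yes (e , e∉es) with reach connected g (inj₂ e)
  ...   | inj₁ e∈es = ⊥-elim (e∉es e∈es)
  ...   | inj₂ ex with extend acyclic g ex
  ...     | _ , _ , g′ = span tree fuel g′ (subst (m H <_) (sym (+-suc fuel (length es))) lt)

  spanning : IsHypertree H → V → Spanning
  spanning tree r = span tree (suc (m H)) (root r) (s≤s (≤-reflexive (sym (+-identityʳ _))))

-- Edge labels and sums

Unique-↭ : ∀ {A : Set} {xs ys : List A} → Unique xs → Unique ys →
           (∀ {x} → x ∈ xs ⇔ x ∈ ys) → xs ↭ ys
Unique-↭ u u′ xs∼ys = ∼bag⇒↭ (unique∧set⇒bag u u′ xs∼ys)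

module _ {n : ℕ} (e : Subset n) where

  sum-supported : (h f : Fin n → ℕ) → (∀ v → v ∈ₛ e → h v ≡ f v) → (∀ v → v ∉ₛ e → h v ≡ 0) →
                  ∀ vs → sum (map h vs) ≡ sum (map f (filter (_∈ₛ? e) vs))
  sum-supported h f on off [] = refl
  sum-supported h f on off (v ∷ vs) with v ∈ₛ? e
  ... | yes v∈e = cong₂ _+_ (on v v∈e) (sum-supported h f on off vs)
  ... | no v∉e = cong₂ _+_ (off v v∉e) (sum-supported h f on off vs)

  edgeSum-filter : ∀ {k} (f : Fin n → Fin k) →
                   edgeSum f e ≡ sum (map (toℕ ∘ f) (filter (_∈ₛ? e) (allFin n)))
  edgeSum-filter f = trans (proj₂ summand) (sum-supported (proj₁ summand) (toℕ ∘ f) on off (allFin n))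
    where
    -- The summand in edgeSum is a local function, which only unification can name.
    summand : ∃ λ h → edgeSum f e ≡ sum (map h (allFin n))
    summand = _ , refl
    on : ∀ v → v ∈ₛ e → proj₁ summand v ≡ toℕ (f v)
    on v v∈e with v ∈ₛ? e
    ... | yes _ = refl
    ... | no v∉e = ⊥-elim (v∉e v∈e)
    off : ∀ v → v ∉ₛ e → proj₁ summand v ≡ 0
    off v v∉e with v ∈ₛ? e
    ... | yes v∈e = ⊥-elim (v∉e v∈e)
    ... | no _ = refl

  -- `edgeSum` follows the order of `allFin`, a growth lists the edge as `p` followed by the new
  -- vertices. Two duplicate-free lists with the same members are permutations of each other, and
  -- sums do not see the difference.
  edgeSum-list : ∀ {k} (f : Fin n → Fin k) {vs} → Unique vs → (∀ {v} → v ∈ₛ e ⇔ v ∈ vs) →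
                 edgeSum f e ≡ sum (map (toℕ ∘ f) vs)
  edgeSum-list f {vs} u e∼vs = trans (edgeSum-filter f) (sum-↭ (map⁺ (toℕ ∘ f)
    (Unique-↭ (Unique.filter⁺ (_∈ₛ? e) (Unique.allFin⁺ n)) u (mk⇔
      (λ v∈ → Equivalence.to e∼vs (proj₂ (∈-filter⁻ (_∈ₛ? e) {xs = allFin n} v∈)))
      (λ v∈ → ∈-filter⁺ (_∈ₛ? e) (∈-allFin _) (Equivalence.from e∼vs v∈))))))

  edgeLabel-cong : ∀ {k} .{{_ : NonZero k}} {f f′ : Fin n → Fin k} →
                   (∀ {v} → v ∈ₛ e → f v ≡ f′ v) → edgeLabel f e ≡ edgeLabel f′ e
  edgeLabel-cong {k} {f} {f′} f≗f′ = cong (_mod k) (trans (edgeSum-filter f) (trans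
    (cong sum (map-cong-local (All.tabulate λ v∈ → cong toℕ (f≗f′ (proj₂ (∈-filter⁻ (_∈ₛ? e) {xs = allFin n} v∈))))))
    (sym (edgeSum-filter f′))))

module _ {k : ℕ} .{{_ : NonZero k}} where

  infixl 6 _⊕_
  _⊕_ : Fin k → Fin k → Fin k
  a ⊕ b = (toℕ a + toℕ b) mod k

  toℕ-mod : ∀ i → toℕ (i mod k) ≡ i % k
  toℕ-mod i = toℕ-fromℕ< _

  mod-toℕ : ∀ (a : Fin k) → toℕ a mod k ≡ a
  mod-toℕ a = toℕ-injective (trans (toℕ-mod (toℕ a)) (m<n⇒m%n≡m (toℕ<n a)))

  -- Allows a label sum to be reduced after every summand, since a type of children remembers only
  -- the residue of its sum of root labels.
  ⊕-mod : ∀ (a : Fin k) i → (toℕ a + i) mod k ≡ a ⊕ (i mod k)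
  ⊕-mod a i = toℕ-injective (begin
    toℕ ((toℕ a + i) mod k)           ≡⟨ toℕ-mod (toℕ a + i) ⟩
    (toℕ a + i) % k                   ≡⟨ %-distribˡ-+ (toℕ a) i k ⟩
    (toℕ a % k + i % k) % k           ≡⟨ cong (λ j → (toℕ a % k + j) % k) (m%n%n≡m%n i k) ⟨
    (toℕ a % k + i % k % k) % k       ≡⟨ %-distribˡ-+ (toℕ a) (i % k) k ⟨
    (toℕ a + i % k) % k               ≡⟨ cong (λ j → (toℕ a + j) % k) (toℕ-mod i) ⟨
    (toℕ a + toℕ (i mod k)) % k       ≡⟨ toℕ-mod (toℕ a + toℕ (i mod k)) ⟨
    toℕ (a ⊕ (i mod k))               ∎)
    where open ≡.≡-Reasoning

module _ {A B : Set} {P : A → Set} (P? : ∀ x → Dec (P x)) (f g : A → B) where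

  patch : A → B
  patch x = if does (P? x) then f x else g x

  patch-yes : ∀ {x} → P x → patch x ≡ f x
  patch-yes {x} px with P? x
  ... | yes _ = refl
  ... | no ¬px = ⊥-elim (¬px px)

  patch-no : ∀ {x} → ¬ P x → patch x ≡ g x
  patch-no {x} ¬px with P? x
  ... | yes px = ⊥-elim (¬px px)
  ... | no _ = refl

module Sums (M : CommutativeMonoid 0ℓ 0ℓ) where
  open CommutativeMonoid M renaming (refl to ≈-refl; sym to ≈-sym; trans to ≈-trans)
  open import Algebra.Properties.CommutativeSemigroup commutativeSemigroup using (x∙yz≈y∙xz; xy∙z≈xz∙y)

  private variable A : Set

  ∑ : (A → Carrier) → List A → Carrier
  ∑ f [] = ε
  ∑ f (x ∷ xs) = f x ∙ ∑ f xs

  ∑-cong : ∀ {f g : A → Carrier} xs → (∀ {x} → x ∈ xs → f x ≈ g x) → ∑ f xs ≈ ∑ g xs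
  ∑-cong [] f≈g = ≈-refl
  ∑-cong (x ∷ xs) f≈g = ∙-cong (f≈g (here refl)) (∑-cong xs (f≈g ∘ there))

  ∑-++ : ∀ (f : A → Carrier) xs ys → ∑ f (xs ++ ys) ≈ ∑ f xs ∙ ∑ f ys
  ∑-++ f [] ys = ≈-sym (identityˡ _)
  ∑-++ f (x ∷ xs) ys = ≈-trans (∙-congˡ (∑-++ f xs ys)) (≈-sym (assoc _ _ _))

  ∑-↭ : ∀ (f : A → Carrier) {xs ys} → xs ↭ ys → ∑ f xs ≈ ∑ f ys
  ∑-↭ f ↭.refl = ≈-refl
  ∑-↭ f (↭.prep x p) = ∙-congˡ (∑-↭ f p)
  ∑-↭ f (↭.swap x y p) = ≈-trans (x∙yz≈y∙xz _ _ _) (∙-congˡ (∙-congˡ (∑-↭ f p)))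
  ∑-↭ f (↭.trans p q) = ≈-trans (∑-↭ f p) (∑-↭ f q)

  -- Serves to detach a branch from the vertex `p`: its weight `z` leaves the summand of `p` and
  -- becomes a separate term. Uniqueness makes `p` occur only once.
  ∑-adjust : ∀ {f g : A → Carrier} {p z} {xs} → Unique xs → p ∈ xs →
             f p ≈ g p ∙ z → (∀ {x} → x ≢ p → f x ≈ g x) → ∑ f xs ≈ ∑ g xs ∙ z
  ∑-adjust {xs = x ∷ xs} (x∉ ∷ u) (here refl) fp f≈g = ≈-trans
    (∙-cong fp (∑-cong xs λ y∈ → f≈g (λ y≡p → All.lookup x∉ y∈ (sym y≡p))))
    (xy∙z≈xz∙y _ _ _)
  ∑-adjust {xs = x ∷ xs} (x∉ ∷ u) (there p∈) fp f≈g = ≈-trans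
    (∙-cong (f≈g (All.lookup x∉ p∈)) (∑-adjust u p∈ fp f≈g)) (≈-sym (assoc _ _ _))

-- Labelling a hypertree from a closed family

module Labelling (k : ℕ) .{{_ : NonZero k}} (M : CommutativeMonoid 0ℓ 0ℓ)
                 (vertexWeight edgeWeight : Fin k → CommutativeMonoid.Carrier M)
                 (Good : CommutativeMonoid.Carrier M → Set) where

  open CommutativeMonoid M renaming (refl to ≈-refl; sym to ≈-sym; trans to ≈-trans)
  open Sums M

  -- T[ t ] a x asserts that a rooted hypertree of type t has a labelling of
  -- total weight x with root label a. A branch is an edge together with the
  -- trees hanging from it, labelled relative to the label a of the vertex
  -- carrying it; for the trees hanging from an edge, a is the sum of the root labels.
  record ClosedFamily : Set₁ where
    field
      Tree Children Branch : Set
      T[_] : Tree → Fin k → Carrier → Set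
      C[_] : Children → Fin k → Carrier → Set
      B[_] : Branch → Fin k → Carrier → Set
      vertex : Tree
      vertex⁻ : ∀ {a x} → T[ vertex ] a x → x ≈ vertexWeight a
      only : Tree → Children
      only⁻ : ∀ t {a x} → C[ only t ] a x → T[ t ] a x
      also : Children → Tree → Children
      also⁻ : ∀ s t {c x} → C[ also s t ] c x →
        ∃₂ λ a b → ∃₂ λ y z → C[ s ] a y × T[ t ] b z × b ⊕ a ≡ c × x ≈ z ∙ y
      join : Children → Branch
      join⁻ : ∀ s {a x} → B[ join s ] a x → ∃₂ λ c y → C[ s ] c y × x ≈ edgeWeight (a ⊕ c) ∙ y
      hang : Tree → Branch → Tree
      hang⁻ : ∀ t b {a x} → T[ hang t b ] a x → ∃₂ λ y z → T[ t ] a y × B[ b ] a z × x ≈ y ∙ z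
      good : ∀ t → ∃₂ λ a x → T[ t ] a x × Good x

  module _ (𝓕 : ClosedFamily) (Good-resp : ∀ {x y} → x ≈ y → Good x → Good y) (H : Hypergraph) where
    open ClosedFamily 𝓕
    private V = Fin (n H)

    -- `h v` holds the label of `v` and the weight of the whole tree already absorbed at `v`,
    -- including `v` itself. Only the edges in `es`, not yet absorbed, contribute separately.
    weight : (V → Fin k × Carrier) → List V → List (Fin (m H)) → Carrier
    weight h vs es = ∑ (proj₂ ∘ h) vs ∙ ∑ (λ e → edgeWeight (edgeLabel (proj₁ ∘ h) (edge H e))) es

    Fits : (V → Tree) → (V → Fin k × Carrier) → List V → Set
    Fits w h vs = ∀ {v} → v ∈ vs → T[ w v ] (proj₁ (h v)) (proj₂ (h v))

    -- The order of quantifiers is essential: the type `s` depends on the types of the children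
    -- alone, and their labels are found only after a deviation of `s` has been prescribed.
    labelChildren : ∀ (w : V → Tree) x xs → Unique (x ∷ xs) →
      ∃ λ s → ∀ {c y} → C[ s ] c y → ∃ λ h → Fits w h (x ∷ xs) ×
        sum (map (toℕ ∘ proj₁ ∘ h) (x ∷ xs)) mod k ≡ c × y ≈ ∑ (proj₂ ∘ h) (x ∷ xs)
    labelChildren w x [] _ = only (w x) , λ {c} {y} y∈ → (λ _ → c , y) ,
      (λ { (here refl) → only⁻ (w x) y∈ }) ,
      trans (cong (_mod k) (+-identityʳ (toℕ c))) (mod-toℕ c) , ≈-sym (identityʳ y)
    labelChildren w x (x′ ∷ xs) (x∉ ∷ u) with labelChildren w x′ xs u
    ... | s , label = also s (w x) , λ y∈ → step (also⁻ s (w x) y∈)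
      where
      step : ∀ {c y} → _ → ∃ λ h → Fits w h (x ∷ x′ ∷ xs) ×
        sum (map (toℕ ∘ proj₁ ∘ h) (x ∷ x′ ∷ xs)) mod k ≡ c × y ≈ ∑ (proj₂ ∘ h) (x ∷ x′ ∷ xs)
      step {c} {y} (a , b , y₁ , z , y₁∈ , z∈ , b⊕a≡c , y≈) with label y₁∈
      ... | h₁ , fits , sum≡ , y₁≈ = h , fits′ , sum≡′ , y≈′
        where
        h : V → Fin k × Carrier
        h = patch (_≟ x) (λ _ → b , z) h₁
        h-x : h x ≡ (b , z)
        h-x = patch-yes (_≟ x) _ h₁ refl
        h-xs : ∀ {v} → v ∈ x′ ∷ xs → h v ≡ h₁ v
        h-xs v∈ = patch-no (_≟ x) _ h₁ λ v≡x → All.lookup x∉ v∈ (sym v≡x)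
        fits′ : Fits w h (x ∷ x′ ∷ xs)
        fits′ (here refl) rewrite h-x = z∈
        fits′ (there v∈) rewrite h-xs v∈ = fits v∈
        open ≡.≡-Reasoning
        sum≡′ : sum (map (toℕ ∘ proj₁ ∘ h) (x ∷ x′ ∷ xs)) mod k ≡ c
        sum≡′ = begin
          (toℕ (proj₁ (h x)) + sum (map (toℕ ∘ proj₁ ∘ h) (x′ ∷ xs))) mod k
            ≡⟨ cong₂ (λ i l → (toℕ (proj₁ i) + sum l) mod k) h-x
                 (map-cong-local (All.tabulate (cong (toℕ ∘ proj₁) ∘ h-xs))) ⟩
          (toℕ b + sum (map (toℕ ∘ proj₁ ∘ h₁) (x′ ∷ xs))) mod k  ≡⟨ ⊕-mod b _ ⟩
          b ⊕ (sum (map (toℕ ∘ proj₁ ∘ h₁) (x′ ∷ xs)) mod k)      ≡⟨ cong (b ⊕_) sum≡ ⟩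
          b ⊕ a                                                    ≡⟨ b⊕a≡c ⟩
          c                                                        ∎
        y≈′ : y ≈ ∑ (proj₂ ∘ h) (x ∷ x′ ∷ xs)
        y≈′ = ≈-trans y≈ (∙-cong (reflexive (sym (cong proj₂ h-x)))
          (≈-trans y₁≈ (∑-cong (x′ ∷ xs) λ v∈ → reflexive (sym (cong proj₂ (h-xs v∈))))))

    -- Peel off the edge added last: replace the type of the vertex carrying it.
    labelling : ∀ {vs es} → Growth H vs es → ∀ w → ∃ λ h → Fits w h vs × Good (weight h vs es)
    labelling (root r) w with good (w r)
    -- All edges are absorbed in the root here, so `good` fixes the label and the total deviation at
    -- once.
    ... | a , x , x∈ , gx = (λ _ → a , x) , (λ { (here refl) → x∈ }) ,
      Good-resp (≈-sym (≈-trans (identityʳ _) (identityʳ x))) gx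
    labelling (grow {vs} {es} {e} {p} {x} {xs} G p∈vs u dj e∉es e≗) w
      with labelChildren w x xs u
    ... | s , label = step (labelling G w′)
      where
      -- The tree at `p` enlarged by `e` and the trees at its new vertices. The recursion at `w′` is
      -- the reason for quantifying over all `w`.
      w′ : V → Tree
      w′ = patch (_≟ p) (λ _ → hang (w p) (join s)) w
      w′-p : w′ p ≡ hang (w p) (join s)
      w′-p = patch-yes (_≟ p) (λ _ → hang (w p) (join s)) w refl
      w′-≢ : ∀ {v} → v ≢ p → w′ v ≡ w v
      w′-≢ = patch-no (_≟ p) _ w
      step : (∃ λ h → Fits w′ h vs × Good (weight h vs es)) →
             ∃ λ h → Fits w h ((x ∷ xs) ++ vs) × Good (weight h ((x ∷ xs) ++ vs) (e ∷ es))
      step (h₀ , fits₀ , good₀)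
        -- The weight found for the enlarged tree at `p` is taken apart: `y` for the former tree,
        -- `z` for the branch, and `z` again into the weight of `e` and the weight `q` of the
        -- children, who are then labelled with label sum `c` and total weight `q`.
        with y , z , y∈ , z∈ , hp≈ ← hang⁻ (w p) (join s) (subst (λ t → T[ t ] _ _) w′-p (fits₀ p∈vs))
        with c , q , q∈ , z≈ ← join⁻ s z∈
        with h₁ , fits₁ , sum≡ , q≈ ← label q∈
        = h , fits , Good-resp total good₀
        where
        new? : ∀ v → Dec (v ∈ x ∷ xs)
        new? v = _∈?_ _≟_ v (x ∷ xs)
        -- `h₂` reduces the weight at `p` to `y` but keeps its label, and `h` overlays the new
        -- vertices. No old label changes, so neither do the labels of the old edges.
        h₂ h : V → Fin k × Carrier
        h₂ = patch (_≟ p) (λ _ → proj₁ (h₀ p) , y) h₀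
        h = patch new? h₁ h₂
        h-new : ∀ {v} → v ∈ x ∷ xs → h v ≡ h₁ v
        h-new = patch-yes new? h₁ h₂
        h≡h₂ : ∀ {v} → v ∈ vs → h v ≡ h₂ v
        h≡h₂ v∈ = patch-no new? h₁ h₂ λ v∈xs → dj (v∈xs , v∈)
        h₂-p : h₂ p ≡ (proj₁ (h₀ p) , y)
        h₂-p = patch-yes (_≟ p) (λ _ → proj₁ (h₀ p) , y) h₀ refl
        h₂-≢ : ∀ {v} → v ≢ p → h₂ v ≡ h₀ v
        h₂-≢ = patch-no (_≟ p) _ h₀
        h-p : h p ≡ (proj₁ (h₀ p) , y)
        h-p = trans (h≡h₂ p∈vs) h₂-p
        label-old : ∀ {v} → v ∈ vs → proj₁ (h₀ v) ≡ proj₁ (h v)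
        label-old {v} v∈ = case v ≟ p of λ
          { (yes refl) → cong proj₁ (sym h-p)
          ; (no v≢p) → cong proj₁ (sym (trans (h≡h₂ v∈) (h₂-≢ v≢p))) }
        Fit : V → Fin k × Carrier → Set
        Fit v (a , x) = T[ w v ] a x
        fits : Fits w h ((x ∷ xs) ++ vs)
        fits {v} v∈ = case ∈-++⁻ (x ∷ xs) v∈ of λ
          { (inj₁ v∈xs) → subst (Fit v) (sym (h-new v∈xs)) (fits₁ v∈xs)
          ; (inj₂ v∈vs) → subst (Fit v) (sym (h≡h₂ v∈vs)) (case v ≟ p of λ
            { (yes refl) → subst (Fit v) (sym h₂-p) y∈
            ; (no v≢p) → subst (Fit v) (sym (h₂-≢ v≢p)) (subst (λ t → T[ t ] _ _) (w′-≢ v≢p) (fits₀ v∈vs)) }) }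
        e-label : edgeLabel (proj₁ ∘ h) (edge H e) ≡ proj₁ (h₀ p) ⊕ c
        e-label = begin
          edgeSum (proj₁ ∘ h) (edge H e) mod k
            ≡⟨ cong (_mod k) (edgeSum-list (edge H e) (proj₁ ∘ h) (All.tabulate p≢ ∷ u) e≗) ⟩
          (toℕ (proj₁ (h p)) + sum (map (toℕ ∘ proj₁ ∘ h) (x ∷ xs))) mod k
            ≡⟨ cong₂ (λ i l → (toℕ (proj₁ i) + sum l) mod k) h-p
                 (map-cong-local (All.tabulate (cong (toℕ ∘ proj₁) ∘ h-new))) ⟩
          (toℕ (proj₁ (h₀ p)) + sum (map (toℕ ∘ proj₁ ∘ h₁) (x ∷ xs))) mod k
            ≡⟨ ⊕-mod _ _ ⟩
          proj₁ (h₀ p) ⊕ (sum (map (toℕ ∘ proj₁ ∘ h₁) (x ∷ xs)) mod k)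
            ≡⟨ cong (proj₁ (h₀ p) ⊕_) sum≡ ⟩
          proj₁ (h₀ p) ⊕ c ∎
          where
          open ≡.≡-Reasoning
          p≢ : ∀ {v} → v ∈ x ∷ xs → p ≢ v
          p≢ v∈ refl = dj (v∈ , p∈vs)
        ew : (V → Fin k × Carrier) → Fin (m H) → Carrier
        ew h e = edgeWeight (edgeLabel (proj₁ ∘ h) (edge H e))
        open import Relation.Binary.Reasoning.Setoid setoid
        vs-sum : ∑ (proj₂ ∘ h₀) vs ≈ ∑ (proj₂ ∘ h) vs ∙ z
        vs-sum = ≈-trans
          (∑-adjust (Growth⇒Unique-vs H G) p∈vs
            (≈-trans hp≈ (∙-congʳ (reflexive (cong proj₂ (sym h₂-p)))))
            (λ v≢p → reflexive (cong proj₂ (sym (h₂-≢ v≢p)))))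
          (∙-congʳ (∑-cong vs λ v∈ → reflexive (cong proj₂ (sym (h≡h₂ v∈)))))
        -- The weight `z` taken from `p` reappears as the weight of `e` and the weights of the new
        -- vertices; the total, and with it goodness, is unchanged.
        total : weight h₀ vs es ≈ weight h ((x ∷ xs) ++ vs) (e ∷ es)
        total = begin
          ∑ (proj₂ ∘ h₀) vs ∙ ∑ (ew h₀) es
            ≈⟨ ∙-cong vs-sum (∑-cong es λ e∈ → reflexive (cong edgeWeight
                 (edgeLabel-cong (edge H _) λ v∈ → label-old (Growth⇒closed H G e∈ v∈)))) ⟩
          (∑ (proj₂ ∘ h) vs ∙ z) ∙ ∑ (ew h) es
            ≈⟨ ∙-congʳ (∙-congˡ (≈-trans z≈ (∙-cong
                 (reflexive (cong edgeWeight (sym e-label)))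
                 (≈-trans q≈ (∑-cong (x ∷ xs) λ v∈ → reflexive (cong proj₂ (sym (h-new v∈)))))))) ⟩
          (∑ (proj₂ ∘ h) vs ∙ (ew h e ∙ ∑ (proj₂ ∘ h) (x ∷ xs))) ∙ ∑ (ew h) es
            ≈⟨ rearrange _ _ _ _ ⟩
          (∑ (proj₂ ∘ h) (x ∷ xs) ∙ ∑ (proj₂ ∘ h) vs) ∙ (ew h e ∙ ∑ (ew h) es)
            ≈⟨ ∙-congʳ (∑-++ (proj₂ ∘ h) (x ∷ xs) vs) ⟨
          ∑ (proj₂ ∘ h) ((x ∷ xs) ++ vs) ∙ ∑ (ew h) (e ∷ es) ∎
          where
          rearrange : ∀ A B C D → (A ∙ (B ∙ C)) ∙ D ≈ (C ∙ A) ∙ (B ∙ D)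
          rearrange A B C D = begin
            (A ∙ (B ∙ C)) ∙ D ≈⟨ ∙-congʳ (x∙yz≈zx∙y A B C) ⟩
            ((C ∙ A) ∙ B) ∙ D ≈⟨ assoc _ _ _ ⟩
            (C ∙ A) ∙ (B ∙ D) ∎
            where open import Algebra.Properties.CommutativeSemigroup commutativeSemigroup using (x∙yz≈zx∙y)

-- Families given by tables

ℤ² ℤ⁴ : CommutativeMonoid 0ℓ 0ℓ
ℤ² = commutativeMonoid ℤ.+-0-commutativeMonoid ℤ.+-0-commutativeMonoid
ℤ⁴ = commutativeMonoid ℤ² ℤ²

open CommutativeMonoid ℤ⁴ using (_≈_; _∙_) renaming (Carrier to Deviation; refl to ≈-refl; trans to ≈-trans)

_≈?_ : (x y : Deviation) → Dec (x ≈ y)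
((p , q) , (r , s)) ≈? ((p′ , q′) , (r′ , s′)) =
  ((p ℤ.≟ p′) ×-dec (q ℤ.≟ q′)) ×-dec ((r ℤ.≟ r′) ×-dec (s ℤ.≟ s′))

-- Decimal digits p q r s encode the deviation ((p - 5 , q - 5) , (r - 5 , s - 5)).
decode : ℕ → Deviation
decode d = (digit (d / 1000) , digit (d / 100)) , (digit (d / 10) , digit d)
  where
  digit : ℕ → ℤ
  digit i = (i % 10) ⊖ 5

-- Boolean checks and their soundness

T-∧⁻ : ∀ {x y} → T (x ∧ y) → T x × T y
T-∧⁻ = Equivalence.to T-∧

all-lookup : ∀ {A : Set} (p : A → Bool) {x xs} → T (all p xs) → x ∈ xs → T (p x)
all-lookup p {xs = xs} ok = All.lookup (all⁺ p xs ok)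

any-find : ∀ {A : Set} (p : A → Bool) xs → T (any p xs) → ∃ λ x → x ∈ xs × T (p x)
any-find p xs ok = find (any⁻ p xs ok)

all-Fin : ∀ {k} (p : Fin k → Bool) → T (all p (allFin k)) → ∀ a → T (p a)
all-Fin p ok a = all-lookup p ok (∈-allFin a)

-- Membership is decided on the numeric codes, where `_≡ᵇ_` is evaluated by built-in arithmetic;
-- comparing decoded integers would be far more work for a check that runs during type checking.
elem : ℕ → List ℕ → Bool
elem d = any (d ≡ᵇ_)

elem⇒∈ : ∀ d xs → T (elem d xs) → d ∈ xs
elem⇒∈ d xs ok = Any.map (≡ᵇ⇒≡ d _) (any⁻ (d ≡ᵇ_) xs ok)

-- The code of the difference of the deviations coded by d and x is d + 5555 - x.
-- A candidate found in this way is verified by decoding it.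
isSum : List ℕ → List ℕ → ℕ → Bool
isSum xs ys d = any (λ x → let y = (d + 5555) ∸ x in elem y ys ∧ ⌊ decode d ≈? (decode x ∙ decode y) ⌋) xs

isSum⇒ : ∀ xs ys d → T (isSum xs ys d) → ∃₂ λ x y → x ∈ xs × y ∈ ys × decode d ≈ decode x ∙ decode y
isSum⇒ xs ys d ok =
  let x , x∈ , ok′ = any-find _ xs ok
      y∈ , d≈ = T-∧⁻ {elem ((d + 5555) ∸ x) ys} ok′
  in x , (d + 5555) ∸ x , x∈ , elem⇒∈ _ ys y∈ , toWitness d≈

module _ {A : Set} where

  -- A position out of range fails the check, so the lists of positions need no separate proof of
  -- validity.
  at : List A → ℕ → (A → Bool) → Bool
  at [] _ _ = false
  at (x ∷ xs) zero p = p x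
  at (x ∷ xs) (suc i) p = at xs i p

  at⇒ : ∀ xs i p → T (at xs i p) → ∃ λ x → x ∈ xs × T (p x)
  at⇒ (x ∷ xs) zero p ok = x , here refl , ok
  at⇒ (x ∷ xs) (suc i) p ok =
    let y , y∈ , ok′ = at⇒ xs i p ok in y , there y∈ , ok′

module _ {A I : Set} where

  -- A list of positions that is too short fails as well; hence every member `x` is guaranteed a
  -- position.
  allWith : (A → I → Bool) → List A → List I → Bool
  allWith p [] _ = true
  allWith p (_ ∷ _) [] = false
  allWith p (x ∷ xs) (i ∷ is) = p x i ∧ allWith p xs is

  allWith⇒ : ∀ p {xs is x} → T (allWith p xs is) → x ∈ xs → ∃ λ i → T (p x i)
  allWith⇒ p {_ ∷ _} {i ∷ _} ok (here refl) = i , proj₁ (T-∧⁻ ok)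
  allWith⇒ p {_ ∷ _} {_ ∷ _} ok (there x∈) = allWith⇒ p (proj₂ (T-∧⁻ ok)) x∈

module Tabulated (k : ℕ) .{{_ : NonZero k}} (diff : Fin k → ℤ × ℤ) (coord : Fin k → ℤ × ℤ → ℤ) where

  -- (vertex deviation , edge deviation), where the deviation of label counts
  -- n₀ , n₁ , … is the sum of nₐ · diff a; the count nₐ exceeds n_b by coord a - coord b of it.
  vertexWeight edgeWeight : Fin k → Deviation
  vertexWeight a = diff a , (0ℤ , 0ℤ)
  edgeWeight a = (0ℤ , 0ℤ) , diff a

  Balanced : ℤ × ℤ → Set
  Balanced x = ∀ a b → ℤ.∣ coord a x ℤ.- coord b x ∣ ≤ 1

  balanced? : ∀ x → Dec (Balanced x)
  balanced? x = all? λ a → all? λ b → ℤ.∣ coord a x ℤ.- coord b x ∣ ≤? 1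

  Good : Deviation → Set
  Good (v , e) = Balanced v × Balanced e

  Table : Set
  Table = Vec (List ℕ) k

  infixl 10 _!_
  _!_ : Table → Fin k → List ℕ
  t ! a = Vec.lookup t a

  -- All the checks except `goodᵇ` quantify over the entries of the resulting table, so they survive
  -- the removal of entries from it. `goodᵇ` is the one that demands an entry.
  vertexᵇ goodᵇ : Table → Bool
  vertexᵇ t = all (λ a → all (λ d → ⌊ decode d ≈? vertexWeight a ⌋) (t ! a)) (allFin k)
  goodᵇ t = any (λ a → any (λ d →
    ⌊ balanced? (proj₁ (decode d)) ×-dec balanced? (proj₂ (decode d)) ⌋) (t ! a)) (allFin k)

  onlyᵇ joinᵇ : Table → Table → Bool
  onlyᵇ t s = all (λ a → all (λ d → elem d (t ! a)) (s ! a)) (allFin k)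
  joinᵇ s b = all (λ a → all (λ d → any (λ c → any (λ y →
    ⌊ decode d ≈? (edgeWeight (a ⊕ c) ∙ decode y) ⌋) (s ! c)) (allFin k)) (b ! a)) (allFin k)

  splittings : Fin k → List (Fin k × Fin k)
  splittings c = filter (λ (a , b) → b ⊕ a Fin.≟ c) (cartesianProduct (allFin k) (allFin k))

  alsoᵇ hangᵇ : Table → Table → Table → Bool
  alsoᵇ s t s′ = all (λ c → isSumAt (splittings c) (s′ ! c)) (allFin k)
    where
    -- A separate function, so that splittings c is evaluated only once.
    isSumAt : List (Fin k × Fin k) → List ℕ → Bool
    isSumAt abs = all (λ d → any (λ (a , b) → isSum (t ! b) (s ! a) d) abs)
  hangᵇ t b t′ = all (λ a → all (isSum (t ! a) (b ! a)) (t′ ! a)) (allFin k)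

  module _ (trees children branches : List Table)
           (only# join# : List ℕ) (also# hang# : List (List ℕ)) where

    -- The tables with # list, for all arguments, the position of the result.
    onlyOK joinOK alsoOK hangOK check : Bool
    onlyOK = allWith (λ t i → at children i (onlyᵇ t)) trees only#
    joinOK = allWith (λ s i → at branches i (joinᵇ s)) children join#
    alsoOK = allWith (λ s → allWith (λ t i → at children i (alsoᵇ s t)) trees) children also#
    hangOK = allWith (λ t → allWith (λ b i → at trees i (hangᵇ t b)) branches) trees hang#
    check = any vertexᵇ trees ∧ onlyOK ∧ joinOK ∧ alsoOK ∧ hangOK ∧ all goodᵇ trees

    open Labelling k ℤ⁴ vertexWeight edgeWeight Good using (ClosedFamily)

    private
      ⟦_⟧ : List ℕ → Deviation → Set
      ⟦ ds ⟧ x = ∃ λ d → d ∈ ds × x ≈ decode d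

    closedFamily : T check → ClosedFamily
    closedFamily ok = record
      -- A type carries its membership proof, which locates its row in the lists of positions and
      -- selects the instance of each check that applies to it.
      { Tree = ∃ (_∈ trees) ; Children = ∃ (_∈ children) ; Branch = ∃ (_∈ branches)
      ; T[_] = λ t a → ⟦ proj₁ t ! a ⟧
      ; C[_] = λ s a → ⟦ proj₁ s ! a ⟧
      ; B[_] = λ b a → ⟦ proj₁ b ! a ⟧
      ; vertex = proj₁ vertex , proj₁ (proj₂ vertex)
      ; vertex⁻ = λ { {a} (d , d∈ , x≈) →
          ≈-trans x≈ (toWitness (all-lookup _ (all-Fin _ (proj₂ (proj₂ vertex)) a) d∈)) }
      ; only = λ t → let s , s∈ , _ = only t in s , s∈
      ; only⁻ = λ { t {a} (d , d∈ , x≈) → d ,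
          elem⇒∈ d _ (all-lookup _ (all-Fin _ (proj₂ (proj₂ (only t))) a) d∈) , x≈ }
      ; also = λ s t → let s′ , s′∈ , _ = also s t in s′ , s′∈
      ; also⁻ = λ { s@(S , _) t@(U , _) {c} (d , d∈ , x≈) →
          let (a , b) , ab∈ , ok₁ = any-find _ (splittings c) (all-lookup _ (all-Fin _ (proj₂ (proj₂ (also s t))) c) d∈)
              _ , b⊕a≡c = ∈-filter⁻ _ {xs = cartesianProduct (allFin k) (allFin k)} ab∈
              z , y , z∈ , y∈ , d≈ = isSum⇒ (U ! b) (S ! a) d ok₁
          in a , b , _ , _ , (y , y∈ , ≈-refl) , (z , z∈ , ≈-refl) , b⊕a≡c , ≈-trans x≈ d≈ }
      ; join = λ s → let b , b∈ , _ = join s in b , b∈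
      ; join⁻ = λ { s@(S , _) {a} (d , d∈ , x≈) →
          let c , _ , ok₁ = any-find _ (allFin k) (all-lookup _ (all-Fin _ (proj₂ (proj₂ (join s))) a) d∈)
              y , y∈ , d≈ = any-find _ (S ! c) ok₁
          in c , _ , (y , y∈ , ≈-refl) , ≈-trans x≈ (toWitness d≈) }
      ; hang = λ t b → let t′ , t′∈ , _ = hang t b in t′ , t′∈
      ; hang⁻ = λ { t@(U , _) b@(W , _) {a} (d , d∈ , x≈) →
          let y , z , y∈ , z∈ , d≈ = isSum⇒ (U ! a) (W ! a) d (all-lookup _ (all-Fin _ (proj₂ (proj₂ (hang t b))) a) d∈)
          in _ , _ , (y , y∈ , ≈-refl) , (z , z∈ , ≈-refl) , ≈-trans x≈ d≈ }
      ; good = λ { (U , t∈) →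
          let a , _ , ok₁ = any-find _ (allFin k) (all-lookup goodᵇ goodOK t∈)
              d , d∈ , gd = any-find _ (U ! a) ok₁
          in a , decode d , (d , d∈ , ≈-refl) , toWitness gd }
      }
      where
      parts = let v , r = T-∧⁻ {any vertexᵇ trees} ok
                  o , r = T-∧⁻ {onlyOK} r
                  j , r = T-∧⁻ {joinOK} r
                  a , r = T-∧⁻ {alsoOK} r
                  h , g = T-∧⁻ {hangOK} r
              in v , o , j , a , h , g
      goodOK : T (all goodᵇ trees)
      goodOK = let _ , _ , _ , _ , _ , g = parts in g
      vertex : ∃ λ t → t ∈ trees × T (vertexᵇ t)
      vertex = any-find vertexᵇ trees (proj₁ parts)
      only : ∀ (t : ∃ (_∈ trees)) → ∃ λ s → s ∈ children × T (onlyᵇ (proj₁ t) s)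
      only (t , t∈) = let _ , o , _ = parts
                          i , ok′ = allWith⇒ _ o t∈ in at⇒ children i _ ok′
      join : ∀ (s : ∃ (_∈ children)) → ∃ λ b → b ∈ branches × T (joinᵇ (proj₁ s) b)
      join (s , s∈) = let _ , _ , j , _ = parts
                          i , ok′ = allWith⇒ _ j s∈ in at⇒ branches i _ ok′
      also : ∀ (s : ∃ (_∈ children)) (t : ∃ (_∈ trees)) → ∃ λ s′ → s′ ∈ children × T (alsoᵇ (proj₁ s) (proj₁ t) s′)
      also (s , s∈) (t , t∈) = let _ , _ , _ , a , _ = parts
                                   is , ok₁ = allWith⇒ _ a s∈
                                   i , ok₂ = allWith⇒ _ {is = is} ok₁ t∈ in at⇒ children i _ ok₂
      hang : ∀ (t : ∃ (_∈ trees)) (b : ∃ (_∈ branches)) → ∃ λ t′ → t′ ∈ trees × T (hangᵇ (proj₁ t) (proj₁ b) t′)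
      hang (t , t∈) (b , b∈) = let _ , _ , _ , _ , h , _ = parts
                                   is , ok₁ = allWith⇒ _ h t∈
                                   i , ok₂ = allWith⇒ _ {is = is} ok₁ b∈ in at⇒ trees i _ ok₂

-- From deviations to counts

open Sums ℤ² using () renaming (∑ to ∑²; ∑-↭ to ∑²-↭)
open Sums ℤ⁴ using () renaming (∑ to ∑⁴; ∑-cong to ∑⁴-cong)
private
  module ² = CommutativeMonoid ℤ²
  module ⁴ = CommutativeMonoid ℤ⁴
open ² using () renaming (_∙_ to _+²_; _≈_ to _≈²_)
open ⁴ using () renaming (_≈_ to _≈⁴_)

indicator : ∀ {k} → Fin k → Fin k → ℤ
indicator a c with c Fin.≟ a
... | yes _ = 1ℤ
... | no _ = 0ℤ

count : ∀ {k} {A : Set} → (A → Fin k) → List A → Fin k → ℕ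
count f xs a = length (filter (λ x → f x Fin.≟ a) xs)

count-∷ : ∀ {k} {A : Set} (f : A → Fin k) x xs a →
          + count f (x ∷ xs) a ≡ indicator a (f x) ℤ.+ + count f xs a
count-∷ f x xs a with f x Fin.≟ a
... | yes _ = refl
... | no _ = refl

↭-allFin : ∀ {n} {xs : List (Fin n)} → Unique xs → (∀ v → v ∈ xs) → xs ↭ allFin n
↭-allFin u all = Unique-↭ u (Unique.allFin⁺ _) (mk⇔ (λ _ → ∈-allFin _) (λ _ → all _))

allFin-empty : ∀ {n} → ¬ Fin n → allFin n ≡ []
allFin-empty {zero} _ = refl
allFin-empty {suc _} ¬v = ⊥-elim (¬v zero)

-- A growth needs a root. The hypergraph without vertices is vacuously a hypertree and is settled
-- separately: its edges would have size at most 0.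
no-vertex⇒cordial : ∀ k .{{_ : NonZero k}} (H : Hypergraph) → ¬ Fin (n H) → IsCordial H k
no-vertex⇒cordial k H ¬v = (λ v → ⊥-elim (¬v v)) , vs , es
  where
  ¬e : ¬ Fin (m H)
  ¬e e = <⇒≱ (size≥2 H e) (≤-trans (∣p∣≤n (edge H e)) (n≤1 (n H) ¬v))
    where
    n≤1 : ∀ n → ¬ Fin n → n ≤ 1
    n≤1 zero _ = z≤n
    n≤1 (suc _) ¬v = ⊥-elim (¬v zero)
  vs : ∀ a b → ∣ vCount H _ a - vCount H _ b ∣ ≤ 1
  vs a b rewrite allFin-empty ¬v = z≤n
  es : ∀ a b → ∣ eCount H _ a - eCount H _ b ∣ ≤ 1
  es a b rewrite allFin-empty ¬e = z≤n

inhabited? : ∀ n → Fin n ⊎ ¬ Fin n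
inhabited? zero = inj₂ λ ()
inhabited? (suc _) = inj₁ zero

-- Cordial labellings from a closed family

module Cordiality (k : ℕ) .{{_ : NonZero k}} (diff : Fin k → ℤ × ℤ) (coord : Fin k → ℤ × ℤ → ℤ)
  (coord-+ : ∀ a x y → coord a (x +² y) ≡ coord a x ℤ.+ coord a y)
  (coord-0 : ∀ a → coord a (0ℤ , 0ℤ) ≡ 0ℤ)
  (coord-diff : ∀ a b c → coord a (diff c) ℤ.- coord b (diff c) ≡ indicator a c ℤ.- indicator b c) where

  open Tabulated k diff coord
  open Labelling k ℤ⁴ vertexWeight edgeWeight Good

  -- Only differences of coordinates can be related to counts: a deviation does not determine the
  -- number of objects, as one object of each label contributes nothing to the differences.
  coord-∑ : ∀ {A : Set} (f : A → Fin k) xs a b →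
            coord a (∑² (diff ∘ f) xs) ℤ.- coord b (∑² (diff ∘ f) xs) ≡ + count f xs a ℤ.- + count f xs b
  coord-∑ f [] a b = cong₂ ℤ._-_ (coord-0 a) (coord-0 b)
  coord-∑ f (x ∷ xs) a b = begin
    coord a (diff (f x) +² S) ℤ.- coord b (diff (f x) +² S)
      ≡⟨ cong₂ ℤ._-_ (coord-+ a _ S) (coord-+ b _ S) ⟩
    (coord a (diff (f x)) ℤ.+ coord a S) ℤ.- (coord b (diff (f x)) ℤ.+ coord b S)
      ≡⟨ regroup (coord a (diff (f x))) (coord a S) (coord b (diff (f x))) (coord b S) ⟩
    (coord a (diff (f x)) ℤ.- coord b (diff (f x))) ℤ.+ (coord a S ℤ.- coord b S)
      ≡⟨ cong₂ ℤ._+_ (coord-diff a b (f x)) (coord-∑ f xs a b) ⟩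
    (indicator a (f x) ℤ.- indicator b (f x)) ℤ.+ (+ count f xs a ℤ.- + count f xs b)
      ≡⟨ regroup (indicator a (f x)) (+ count f xs a) (indicator b (f x)) (+ count f xs b) ⟨
    (indicator a (f x) ℤ.+ + count f xs a) ℤ.- (indicator b (f x) ℤ.+ + count f xs b)
      ≡⟨ cong₂ ℤ._-_ (count-∷ f x xs a) (count-∷ f x xs b) ⟨
    + count f (x ∷ xs) a ℤ.- + count f (x ∷ xs) b ∎
    where
    open ≡.≡-Reasoning
    S = ∑² (diff ∘ f) xs
    regroup : ∀ i j i′ j′ → (i ℤ.+ j) ℤ.- (i′ ℤ.+ j′) ≡ (i ℤ.- i′) ℤ.+ (j ℤ.- j′)
    regroup = solve-∀

  Balanced-resp : ∀ {x y} → x ≈² y → Balanced x → Balanced y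
  Balanced-resp (refl , refl) bx = bx

  Good-resp : ∀ {x y} → x ≈⁴ y → Good x → Good y
  Good-resp (v≈ , e≈) (bv , be) = Balanced-resp v≈ bv , Balanced-resp e≈ be

  ∑-vertexWeight : ∀ {A : Set} (f : A → Fin k) xs → ∑⁴ (vertexWeight ∘ f) xs ≈⁴ (∑² (diff ∘ f) xs , (0ℤ , 0ℤ))
  ∑-vertexWeight f [] = ⁴.refl
  ∑-vertexWeight f (x ∷ xs) = ⁴.∙-congˡ {vertexWeight (f x)} (∑-vertexWeight f xs)

  ∑-edgeWeight : ∀ {A : Set} (f : A → Fin k) xs → ∑⁴ (edgeWeight ∘ f) xs ≈⁴ ((0ℤ , 0ℤ) , ∑² (diff ∘ f) xs)
  ∑-edgeWeight f [] = ⁴.refl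
  ∑-edgeWeight f (x ∷ xs) = ⁴.∙-congˡ {edgeWeight (f x)} (∑-edgeWeight f xs)

  -- The deviation is summed in the order of the growth, the counts run over `allFin`; invariance of
  -- the sum under permutation bridges the two.
  Balanced⇒count : ∀ {N} (f : Fin N → Fin k) {xs} → xs ↭ allFin N → Balanced (∑² (diff ∘ f) xs) →
                   ∀ a b → ∣ count f (allFin N) a - count f (allFin N) b ∣ ≤ 1
  Balanced⇒count {N} f xs↭ bal a b = subst (_≤ 1) (begin
    ℤ.∣ coord a S ℤ.- coord b S ∣                                        ≡⟨ cong ℤ.∣_∣ (coord-∑ f (allFin N) a b) ⟩
    ℤ.∣ + count f (allFin N) a ℤ.- + count f (allFin N) b ∣              ≡⟨ ∣-∣≡ (count f (allFin N) a) (count f (allFin N) b) ⟩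
    ∣ count f (allFin N) a - count f (allFin N) b ∣                      ∎)
    (Balanced-resp (∑²-↭ (diff ∘ f) xs↭) bal a b)
    where
    open ≡.≡-Reasoning
    S = ∑² (diff ∘ f) (allFin N)
    ∣-∣≡ : ∀ i j → ℤ.∣ + i ℤ.- + j ∣ ≡ ∣ i - j ∣
    ∣-∣≡ i j = trans (cong ℤ.∣_∣ (ℤ.[+m]-[+n]≡m⊖n i j)) (∣⊖∣ i j)
      where
      ∣⊖∣ : ∀ i j → ℤ.∣ i ℤ.⊖ j ∣ ≡ ∣ i - j ∣
      ∣⊖∣ zero zero = refl
      ∣⊖∣ zero (suc j) = refl
      ∣⊖∣ (suc i) zero = refl
      ∣⊖∣ (suc i) (suc j) = trans (cong ℤ.∣_∣ (ℤ.[1+m]⊖[1+n]≡m⊖n i j)) (∣⊖∣ i j)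

  hypertree⇒cordial : ClosedFamily → (H : Hypergraph) → IsHypertree H → IsCordial H k
  hypertree⇒cordial 𝓕 H tree with inhabited? (n H)
  ... | inj₂ ¬v = no-vertex⇒cordial k H ¬v
  ... | inj₁ r with spanning H tree r
  ...   | vs , es , G , all-vs , all-es
    -- With the type of a single vertex everywhere, `vertex⁻` forces the weight at each vertex to be
    -- that of its label, so the total weight is the true deviation of the vertex and edge counts.
    with h , fits , good ← labelling 𝓕 Good-resp H G (λ _ → ClosedFamily.vertex 𝓕)
    = f , Balanced⇒count f (↭-allFin (Growth⇒Unique-vs H G) all-vs) (proj₁ balanced)
        , Balanced⇒count g (↭-allFin (Growth⇒Unique-es H G) all-es) (proj₂ balanced)
    where
    f : Fin (n H) → Fin k
    f = proj₁ ∘ h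
    g : Fin (m H) → Fin k
    g e = edgeLabel f (edge H e)
    open import Relation.Binary.Reasoning.Setoid ⁴.setoid
    balanced : Good (∑² (diff ∘ f) vs , ∑² (diff ∘ g) es)
    balanced = Good-resp (begin
      ∑⁴ (proj₂ ∘ h) vs ⁴.∙ ∑⁴ (edgeWeight ∘ g) es
        ≈⟨ ⁴.∙-cong (⁴.trans (∑⁴-cong vs λ v∈ → ClosedFamily.vertex⁻ 𝓕 (fits v∈)) (∑-vertexWeight f vs))
                    (∑-edgeWeight g es) ⟩
      (∑² (diff ∘ f) vs , (0ℤ , 0ℤ)) ⁴.∙ ((0ℤ , 0ℤ) , ∑² (diff ∘ g) es)
        ≈⟨ (².identityʳ _ , ².identityˡ _) ⟩
      (∑² (diff ∘ f) vs , ∑² (diff ∘ g) es) ∎) good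

-- The tables

-- The deviation is the difference of the counts of the labels 0 and 1. The second component stays 0
-- and merely gives both values of `k` the same type of deviations.
diff₂ : Fin 2 → ℤ × ℤ
diff₂ zero = + 1 , + 0
diff₂ (suc zero) = -[1+ 0 ] , + 0

coord₂ : Fin 2 → ℤ × ℤ → ℤ
coord₂ zero (p , _) = p
coord₂ (suc zero) _ = + 0

-- Label 2 is the reference: the deviation consists of the counts of the labels 0 and 1, each minus
-- the count of label 2.
diff₃ : Fin 3 → ℤ × ℤ
diff₃ zero = + 1 , + 0
diff₃ (suc zero) = + 0 , + 1
diff₃ (suc (suc zero)) = -[1+ 0 ] , -[1+ 0 ]

coord₃ : Fin 3 → ℤ × ℤ → ℤ
coord₃ zero (p , _) = p
coord₃ (suc zero) (_ , q) = q
coord₃ (suc (suc zero)) _ = + 0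

coord₂-+ : ∀ a x y → coord₂ a (x +² y) ≡ coord₂ a x ℤ.+ coord₂ a y
coord₂-+ zero _ _ = refl
coord₂-+ (suc zero) _ _ = refl

coord₂-0 : ∀ a → coord₂ a (0ℤ , 0ℤ) ≡ 0ℤ
coord₂-0 zero = refl
coord₂-0 (suc zero) = refl

coord₂-diff : ∀ a b c → coord₂ a (diff₂ c) ℤ.- coord₂ b (diff₂ c) ≡ indicator a c ℤ.- indicator b c
coord₂-diff = toWitness {a? = all? λ a → all? λ b → all? λ c →
  coord₂ a (diff₂ c) ℤ.- coord₂ b (diff₂ c) ℤ.≟ indicator a c ℤ.- indicator b c} tt

coord₃-+ : ∀ a x y → coord₃ a (x +² y) ≡ coord₃ a x ℤ.+ coord₃ a y
coord₃-+ zero _ _ = refl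
coord₃-+ (suc zero) _ _ = refl
coord₃-+ (suc (suc zero)) _ _ = refl

coord₃-0 : ∀ a → coord₃ a (0ℤ , 0ℤ) ≡ 0ℤ
coord₃-0 zero = refl
coord₃-0 (suc zero) = refl
coord₃-0 (suc (suc zero)) = refl

coord₃-diff : ∀ a b c → coord₃ a (diff₃ c) ℤ.- coord₃ b (diff₃ c) ≡ indicator a c ℤ.- indicator b c
coord₃-diff = toWitness {a? = all? λ a → all? λ b → all? λ c →
  coord₃ a (diff₃ c) ℤ.- coord₃ b (diff₃ c) ℤ.≟ indicator a c ℤ.- indicator b c} tt

-- The tables were computed by closing the type of a single vertex under the
-- operations, discarding deviations that exceed a bound (label counts differing
-- by more than 3 for k = 2, by more than 2 for k = 3), keeping minimal sets only,
-- and shrinking the result by trial removal of deviations.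

trees₂ : List (Vec (List ℕ) 2)
trees₂ =
  ((6555 ∷ []) ∷
   (4555 ∷ []) ∷ []) ∷
  ((5545 ∷ 7565 ∷ []) ∷
   (3565 ∷ 5545 ∷ []) ∷ []) ∷
  ((5555 ∷ 7535 ∷ []) ∷
   (3555 ∷ 5535 ∷ 7555 ∷ []) ∷ []) ∷
  ((4565 ∷ 6545 ∷ 8565 ∷ []) ∷
   (2545 ∷ 4565 ∷ 6545 ∷ []) ∷ []) ∷
  ((3545 ∷ 5565 ∷ 7545 ∷ []) ∷
   (3545 ∷ 5565 ∷ 7545 ∷ []) ∷ []) ∷
  ((4545 ∷ 6565 ∷ 8545 ∷ []) ∷
   (2565 ∷ 4545 ∷ 6565 ∷ []) ∷ []) ∷
  ((3555 ∷ 5535 ∷ 7555 ∷ []) ∷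
   (3535 ∷ 5555 ∷ 7535 ∷ []) ∷ []) ∷
  ((4555 ∷ 6535 ∷ 6575 ∷ 8555 ∷ []) ∷
   (2555 ∷ 4535 ∷ 4575 ∷ 6555 ∷ []) ∷ []) ∷
  []

-- Indexed by the sum of the root labels. The second table belongs to two single vertices: sum 0
-- comes from equal labels, with vertex deviation 2 or -2 (`7555`, `3555`), sum 1 from different
-- ones, with deviation 0 (`5555`).
children₂ : List (Vec (List ℕ) 2)
children₂ =
  ((6555 ∷ []) ∷
   (4555 ∷ []) ∷ []) ∷
  ((3555 ∷ 7555 ∷ []) ∷
   (5555 ∷ []) ∷ []) ∷
  ((4555 ∷ 8555 ∷ []) ∷
   (2555 ∷ 6555 ∷ []) ∷ []) ∷
  ((5555 ∷ []) ∷
   (3555 ∷ 7555 ∷ []) ∷ []) ∷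
  ((5545 ∷ 7565 ∷ []) ∷
   (3565 ∷ 5545 ∷ []) ∷ []) ∷
  ((2565 ∷ 4545 ∷ 6545 ∷ 8565 ∷ []) ∷
   (4545 ∷ 4565 ∷ 6545 ∷ 6565 ∷ []) ∷ []) ∷
  ((3555 ∷ 5535 ∷ 7555 ∷ []) ∷
   (3555 ∷ 5535 ∷ 5575 ∷ 7555 ∷ []) ∷ []) ∷
  ((4565 ∷ 6545 ∷ 8565 ∷ []) ∷
   (2545 ∷ 4565 ∷ 6545 ∷ []) ∷ []) ∷
  ((3565 ∷ 5545 ∷ 5565 ∷ 7545 ∷ []) ∷
   (3545 ∷ 3565 ∷ 5545 ∷ 5565 ∷ 7545 ∷ 7565 ∷ []) ∷ []) ∷
  ((2535 ∷ 2575 ∷ 4555 ∷ 6535 ∷ 6575 ∷ 8555 ∷ []) ∷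
   (2535 ∷ 2575 ∷ 4555 ∷ 6535 ∷ 6575 ∷ 8555 ∷ []) ∷ []) ∷
  ((3535 ∷ 3575 ∷ 5555 ∷ 7535 ∷ 7575 ∷ []) ∷
   (3535 ∷ 3575 ∷ 5555 ∷ 7535 ∷ 7575 ∷ []) ∷ []) ∷
  ((2555 ∷ 4535 ∷ 4575 ∷ 6555 ∷ 8535 ∷ 8575 ∷ []) ∷
   (2555 ∷ 4535 ∷ 4575 ∷ 6555 ∷ 8535 ∷ 8575 ∷ []) ∷ []) ∷
  ((3545 ∷ 5565 ∷ 7545 ∷ []) ∷
   (3545 ∷ 5565 ∷ 7545 ∷ []) ∷ []) ∷
  ((2545 ∷ 4545 ∷ 4565 ∷ 6545 ∷ 6565 ∷ 8545 ∷ []) ∷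
   (2545 ∷ 4545 ∷ 4565 ∷ 6545 ∷ 6565 ∷ 8545 ∷ []) ∷ []) ∷
  ((4545 ∷ 6565 ∷ 8545 ∷ []) ∷
   (2565 ∷ 4545 ∷ 6565 ∷ []) ∷ []) ∷
  []

-- The first table is an edge with a single vertex hanging from it. At label 0 of the carrying
-- vertex the edge repeats the label of that vertex (`4545`, `6565`); at label 1 it has the other
-- label.
branches₂ : List (Vec (List ℕ) 2)
branches₂ =
  ((4545 ∷ 6565 ∷ []) ∷
   (4565 ∷ 6545 ∷ []) ∷ []) ∷
  ((3565 ∷ 5545 ∷ 7565 ∷ []) ∷
   (3545 ∷ 5565 ∷ 7545 ∷ []) ∷ []) ∷
  ((2545 ∷ 4565 ∷ 6545 ∷ 8565 ∷ []) ∷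
   (2565 ∷ 4545 ∷ 6565 ∷ 8545 ∷ []) ∷ []) ∷
  ((3545 ∷ 5565 ∷ 7545 ∷ []) ∷
   (3565 ∷ 5545 ∷ 7565 ∷ []) ∷ []) ∷
  ((2555 ∷ 4535 ∷ 4555 ∷ 6555 ∷ 6575 ∷ 8555 ∷ []) ∷
   (2575 ∷ 4535 ∷ 4555 ∷ 6555 ∷ 6575 ∷ 8535 ∷ []) ∷ []) ∷
  ((4555 ∷ 6535 ∷ 6555 ∷ []) ∷
   (2555 ∷ 4555 ∷ 4575 ∷ 6535 ∷ 6555 ∷ 8555 ∷ []) ∷ []) ∷
  ((3555 ∷ 5555 ∷ []) ∷
   (5555 ∷ 7555 ∷ []) ∷ []) ∷
  []

only₂ : List ℕ
only₂ =
  0 ∷ 4 ∷ 3 ∷ 7 ∷ 12 ∷ 14 ∷ 1 ∷ 2 ∷ []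

join₂ : List ℕ
join₂ =
  0 ∷ 1 ∷ 2 ∷ 3 ∷ 6 ∷ 5 ∷ 3 ∷ 5 ∷ 6 ∷ 0 ∷ 1 ∷ 0 ∷ 6 ∷ 5 ∷ 4 ∷ []

also₂ : List (List ℕ)
also₂ =
  (1 ∷ 5 ∷ 0 ∷ 8 ∷ 13 ∷ 4 ∷ 2 ∷ 3 ∷ []) ∷
  (2 ∷ 12 ∷ 1 ∷ 14 ∷ 4 ∷ 7 ∷ 3 ∷ 0 ∷ []) ∷
  (3 ∷ 14 ∷ 2 ∷ 4 ∷ 7 ∷ 4 ∷ 0 ∷ 1 ∷ []) ∷
  (0 ∷ 4 ∷ 3 ∷ 7 ∷ 4 ∷ 7 ∷ 1 ∷ 2 ∷ []) ∷
  (5 ∷ 6 ∷ 4 ∷ 9 ∷ 10 ∷ 11 ∷ 12 ∷ 14 ∷ []) ∷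
  (12 ∷ 0 ∷ 7 ∷ 1 ∷ 0 ∷ 1 ∷ 14 ∷ 4 ∷ []) ∷
  (0 ∷ 12 ∷ 1 ∷ 14 ∷ 4 ∷ 7 ∷ 1 ∷ 0 ∷ []) ∷
  (8 ∷ 9 ∷ 7 ∷ 10 ∷ 11 ∷ 6 ∷ 14 ∷ 4 ∷ []) ∷
  (14 ∷ 1 ∷ 4 ∷ 0 ∷ 1 ∷ 0 ∷ 4 ∷ 7 ∷ []) ∷
  (1 ∷ 14 ∷ 0 ∷ 4 ∷ 7 ∷ 12 ∷ 0 ∷ 1 ∷ []) ∷
  (0 ∷ 4 ∷ 1 ∷ 7 ∷ 12 ∷ 14 ∷ 1 ∷ 0 ∷ []) ∷
  (1 ∷ 7 ∷ 0 ∷ 12 ∷ 14 ∷ 4 ∷ 0 ∷ 1 ∷ []) ∷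
  (13 ∷ 10 ∷ 4 ∷ 11 ∷ 6 ∷ 9 ∷ 4 ∷ 7 ∷ []) ∷
  (4 ∷ 0 ∷ 7 ∷ 1 ∷ 0 ∷ 1 ∷ 7 ∷ 4 ∷ []) ∷
  (4 ∷ 11 ∷ 7 ∷ 6 ∷ 9 ∷ 10 ∷ 7 ∷ 4 ∷ []) ∷
  []

-- The leading 1, for example, says that hanging the first branch at a single vertex gives the
-- second tree table, that of one edge with two vertices.
hang₂ : List (List ℕ)
hang₂ =
  (1 ∷ 3 ∷ 4 ∷ 5 ∷ 6 ∷ 2 ∷ 0 ∷ []) ∷
  (0 ∷ 6 ∷ 7 ∷ 2 ∷ 3 ∷ 5 ∷ 1 ∷ []) ∷
  (5 ∷ 1 ∷ 3 ∷ 4 ∷ 0 ∷ 0 ∷ 2 ∷ []) ∷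
  (6 ∷ 7 ∷ 2 ∷ 0 ∷ 1 ∷ 1 ∷ 3 ∷ []) ∷
  (7 ∷ 2 ∷ 0 ∷ 6 ∷ 3 ∷ 5 ∷ 4 ∷ []) ∷
  (2 ∷ 0 ∷ 6 ∷ 7 ∷ 1 ∷ 1 ∷ 5 ∷ []) ∷
  (3 ∷ 4 ∷ 5 ∷ 1 ∷ 0 ∷ 0 ∷ 6 ∷ []) ∷
  (4 ∷ 5 ∷ 1 ∷ 3 ∷ 2 ∷ 2 ∷ 0 ∷ []) ∷
  []

-- The first table is again the single vertex: `6555`, `5655` and `4455` decode to the three values
-- of `diff₃` in the vertex part.
trees₃ : List (Vec (List ℕ) 3)
trees₃ =
  ((6555 ∷ []) ∷
   (5655 ∷ []) ∷
   (4455 ∷ []) ∷ []) ∷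
  ((5444 ∷ 6656 ∷ 7565 ∷ []) ∷
   (4565 ∷ 5744 ∷ 6656 ∷ []) ∷
   (3356 ∷ 4565 ∷ 5444 ∷ []) ∷ []) ∷
  ((4356 ∷ 5565 ∷ 6444 ∷ 6744 ∷ 7656 ∷ []) ∷
   (3444 ∷ 4656 ∷ 5565 ∷ 6744 ∷ 7656 ∷ []) ∷
   (3444 ∷ 4356 ∷ 4656 ∷ 5565 ∷ 6444 ∷ []) ∷ []) ∷
  ((4333 ∷ 5545 ∷ 6454 ∷ 6757 ∷ 7666 ∷ []) ∷
   (3475 ∷ 4654 ∷ 5566 ∷ 6745 ∷ 7657 ∷ []) ∷
   (3466 ∷ 4345 ∷ 4675 ∷ 5554 ∷ 6433 ∷ []) ∷ []) ∷
  ((4444 ∷ 5356 ∷ 5656 ∷ 6565 ∷ 7744 ∷ []) ∷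
   (3565 ∷ 4444 ∷ 5656 ∷ 6565 ∷ 7744 ∷ []) ∷
   (3565 ∷ 4444 ∷ 5356 ∷ 5656 ∷ 6565 ∷ []) ∷ []) ∷
  ((4545 ∷ 5454 ∷ 5457 ∷ 6633 ∷ 6666 ∷ 7575 ∷ []) ∷
   (4533 ∷ 4566 ∷ 5445 ∷ 5475 ∷ 5745 ∷ 6654 ∷ 6657 ∷ []) ∷
   (3345 ∷ 4554 ∷ 4557 ∷ 5433 ∷ 5466 ∷ 6645 ∷ 6675 ∷ []) ∷ []) ∷
  ((4343 ∷ 5555 ∷ 6464 ∷ 6467 ∷ 6767 ∷ 7643 ∷ 7676 ∷ []) ∷
   (3443 ∷ 4655 ∷ 5564 ∷ 5567 ∷ 6743 ∷ 6746 ∷ 7655 ∷ []) ∷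
   (3455 ∷ 4334 ∷ 4367 ∷ 4667 ∷ 5543 ∷ 5576 ∷ 6455 ∷ []) ∷ []) ∷
  ((4554 ∷ 4566 ∷ 5445 ∷ 5454 ∷ 6645 ∷ 6666 ∷ 7554 ∷ 7566 ∷ []) ∷
   (4545 ∷ 4554 ∷ 5466 ∷ 5745 ∷ 5766 ∷ 6654 ∷ 6666 ∷ []) ∷
   (3345 ∷ 3354 ∷ 4545 ∷ 4566 ∷ 5454 ∷ 5466 ∷ 6654 ∷ []) ∷ []) ∷
  ((4345 ∷ 5554 ∷ 5566 ∷ 6454 ∷ 6745 ∷ 7666 ∷ []) ∷
   (3466 ∷ 4654 ∷ 4675 ∷ 5545 ∷ 5554 ∷ 6745 ∷ 6757 ∷ 7666 ∷ []) ∷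
   (3466 ∷ 3475 ∷ 4333 ∷ 4345 ∷ 4654 ∷ 5545 ∷ 5566 ∷ 6454 ∷ []) ∷ []) ∷
  ((4343 ∷ 5555 ∷ 5564 ∷ 5576 ∷ 6455 ∷ 6767 ∷ 7655 ∷ []) ∷
   (3455 ∷ 4655 ∷ 5555 ∷ 5564 ∷ 6743 ∷ 6755 ∷ 6767 ∷ 7655 ∷ []) ∷
   (3455 ∷ 4343 ∷ 4355 ∷ 4367 ∷ 4655 ∷ 5555 ∷ 5576 ∷ 6455 ∷ []) ∷ []) ∷
  ((4555 ∷ 5434 ∷ 5464 ∷ 5467 ∷ 6643 ∷ 6646 ∷ 6676 ∷ 7555 ∷ []) ∷
   (3355 ∷ 4534 ∷ 4564 ∷ 4567 ∷ 5446 ∷ 5476 ∷ 5743 ∷ 6655 ∷ []) ∷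
   (3367 ∷ 4543 ∷ 4546 ∷ 4576 ∷ 5455 ∷ 5755 ∷ 6634 ∷ 6664 ∷ []) ∷ []) ∷
  ((5533 ∷ 5545 ∷ 5554 ∷ 5557 ∷ 5566 ∷ 6454 ∷ 6466 ∷ 7654 ∷ 7666 ∷ []) ∷
   (3445 ∷ 3454 ∷ 4654 ∷ 4666 ∷ 5545 ∷ 5566 ∷ 6757 ∷ 6766 ∷ []) ∷
   (3454 ∷ 3466 ∷ 4333 ∷ 4354 ∷ 4645 ∷ 4666 ∷ 5545 ∷ 5554 ∷ []) ∷ []) ∷
  ((4454 ∷ 4457 ∷ 5333 ∷ 5366 ∷ 5633 ∷ 5666 ∷ 6545 ∷ 6575 ∷ 7754 ∷ 7757 ∷ []) ∷
   (3533 ∷ 3566 ∷ 4445 ∷ 4475 ∷ 5654 ∷ 5657 ∷ 6566 ∷ 7745 ∷ []) ∷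
   (3554 ∷ 3557 ∷ 4433 ∷ 4466 ∷ 5345 ∷ 5645 ∷ 5675 ∷ 6554 ∷ []) ∷ []) ∷
  ((4355 ∷ 5555 ∷ 5564 ∷ 5576 ∷ 6443 ∷ 6755 ∷ 7667 ∷ []) ∷
   (4655 ∷ 4676 ∷ 5534 ∷ 5546 ∷ 5555 ∷ 5576 ∷ 6743 ∷ 6746 ∷ 7655 ∷ 7667 ∷ []) ∷
   (3455 ∷ 3464 ∷ 4334 ∷ 4367 ∷ 5534 ∷ 5546 ∷ 5555 ∷ 5564 ∷ 6443 ∷ 6455 ∷ []) ∷ []) ∷
  ((4444 ∷ 4465 ∷ 5656 ∷ 5665 ∷ 6544 ∷ 6556 ∷ 6565 ∷ []) ∷
   (3544 ∷ 3565 ∷ 4465 ∷ 5644 ∷ 5656 ∷ 5665 ∷ 5677 ∷ 6565 ∷ 7744 ∷ 7756 ∷ []) ∷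
   (3556 ∷ 3565 ∷ 4444 ∷ 4453 ∷ 4456 ∷ 4465 ∷ 5344 ∷ 5356 ∷ 5665 ∷ 6565 ∷ []) ∷ []) ∷
  ((5534 ∷ 5546 ∷ 5555 ∷ 5564 ∷ 5576 ∷ 6455 ∷ 7655 ∷ []) ∷
   (3455 ∷ 4655 ∷ 4676 ∷ 5546 ∷ 5555 ∷ 5576 ∷ 6743 ∷ 6746 ∷ 7655 ∷ 7667 ∷ []) ∷
   (3455 ∷ 3464 ∷ 4334 ∷ 4367 ∷ 4655 ∷ 5534 ∷ 5555 ∷ 5564 ∷ 6443 ∷ 6455 ∷ []) ∷ []) ∷
  ((4334 ∷ 5534 ∷ 5546 ∷ 5555 ∷ 6455 ∷ 6464 ∷ 6467 ∷ 6746 ∷ 7643 ∷ 7655 ∷ 7676 ∷ []) ∷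
   (4655 ∷ 5534 ∷ 5564 ∷ 5576 ∷ 6743 ∷ 6746 ∷ 6755 ∷ 6767 ∷ []) ∷
   (3455 ∷ 4334 ∷ 4343 ∷ 4355 ∷ 4367 ∷ 5546 ∷ 5564 ∷ 5576 ∷ []) ∷ []) ∷
  ((4534 ∷ 4546 ∷ 5446 ∷ 5455 ∷ 5464 ∷ 5467 ∷ 6634 ∷ 6643 ∷ 6655 ∷ 6676 ∷ 7555 ∷ []) ∷
   (4534 ∷ 4555 ∷ 4564 ∷ 5455 ∷ 5743 ∷ 5746 ∷ 6655 ∷ 6676 ∷ []) ∷
   (3334 ∷ 3367 ∷ 4546 ∷ 4555 ∷ 4576 ∷ 5455 ∷ 5464 ∷ 6655 ∷ []) ∷ []) ∷
  ((5333 ∷ 5345 ∷ 6545 ∷ 6554 ∷ 6566 ∷ 7745 ∷ 7757 ∷ []) ∷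
   (3554 ∷ 4454 ∷ 4466 ∷ 5633 ∷ 5645 ∷ 5654 ∷ 5657 ∷ 5666 ∷ 6545 ∷ 6575 ∷ []) ∷
   (3566 ∷ 4433 ∷ 4445 ∷ 4454 ∷ 4457 ∷ 4466 ∷ 5654 ∷ 5666 ∷ 6545 ∷ 6575 ∷ []) ∷ []) ∷
  ((5544 ∷ 5556 ∷ 6444 ∷ 6456 ∷ 6465 ∷ 7644 ∷ 7656 ∷ 7665 ∷ []) ∷
   (3465 ∷ 4656 ∷ 5544 ∷ 5556 ∷ 5565 ∷ 6735 ∷ 6744 ∷ 6756 ∷ 7656 ∷ 7665 ∷ []) ∷
   (3444 ∷ 4335 ∷ 4344 ∷ 4356 ∷ 4665 ∷ 5544 ∷ 5556 ∷ 5565 ∷ 6444 ∷ 6465 ∷ []) ∷ []) ∷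
  ((4555 ∷ 5446 ∷ 5455 ∷ 6634 ∷ 6655 ∷ 7534 ∷ 7546 ∷ 7555 ∷ 7564 ∷ 7576 ∷ []) ∷
   (4543 ∷ 4555 ∷ 4564 ∷ 4567 ∷ 5755 ∷ 6634 ∷ 6646 ∷ 6655 ∷ 6664 ∷ []) ∷
   (3355 ∷ 4543 ∷ 4555 ∷ 4567 ∷ 4576 ∷ 5434 ∷ 5446 ∷ 5455 ∷ 5476 ∷ []) ∷ []) ∷
  ((4456 ∷ 4465 ∷ 5365 ∷ 5644 ∷ 5665 ∷ 6535 ∷ 6544 ∷ 6556 ∷ 6565 ∷ 7765 ∷ []) ∷
   (3565 ∷ 4456 ∷ 5644 ∷ 5653 ∷ 5656 ∷ 5665 ∷ 5677 ∷ 6556 ∷ 7756 ∷ []) ∷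
   (3565 ∷ 4444 ∷ 4453 ∷ 4456 ∷ 4465 ∷ 4477 ∷ 5344 ∷ 5644 ∷ 6544 ∷ []) ∷ []) ∷
  ((5544 ∷ 5556 ∷ 6444 ∷ 6453 ∷ 6456 ∷ 7644 ∷ 7656 ∷ 7677 ∷ []) ∷
   (3465 ∷ 4635 ∷ 4656 ∷ 5544 ∷ 5556 ∷ 5565 ∷ 6744 ∷ 6756 ∷ 6765 ∷ 7665 ∷ []) ∷
   (3435 ∷ 3444 ∷ 4344 ∷ 4356 ∷ 4365 ∷ 4665 ∷ 5544 ∷ 5556 ∷ 5565 ∷ 6465 ∷ []) ∷ []) ∷
  ((4544 ∷ 4556 ∷ 5444 ∷ 5456 ∷ 5465 ∷ 6644 ∷ 6656 ∷ 6665 ∷ 7544 ∷ 7556 ∷ []) ∷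
   (4544 ∷ 4565 ∷ 5465 ∷ 5756 ∷ 5765 ∷ 6644 ∷ 6653 ∷ 6656 ∷ 6665 ∷ []) ∷
   (3344 ∷ 3365 ∷ 4556 ∷ 4565 ∷ 5444 ∷ 5456 ∷ 5465 ∷ 5477 ∷ 6665 ∷ []) ∷ []) ∷
  ((4554 ∷ 4566 ∷ 5445 ∷ 5454 ∷ 6645 ∷ 6666 ∷ 7554 ∷ 7566 ∷ []) ∷
   (3366 ∷ 4545 ∷ 4554 ∷ 4566 ∷ 5445 ∷ 5466 ∷ 5766 ∷ 6645 ∷ 6654 ∷ 6666 ∷ []) ∷
   (3354 ∷ 4545 ∷ 4554 ∷ 4566 ∷ 5445 ∷ 5454 ∷ 5466 ∷ 5754 ∷ 6645 ∷ 6654 ∷ []) ∷ []) ∷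
  ((4444 ∷ 4456 ∷ 4465 ∷ 5365 ∷ 5644 ∷ 5656 ∷ 5665 ∷ 6544 ∷ 6556 ∷ 6565 ∷ 7765 ∷ []) ∷
   (3565 ∷ 4456 ∷ 5644 ∷ 5653 ∷ 5656 ∷ 5665 ∷ 5677 ∷ 6556 ∷ 7756 ∷ []) ∷
   (3565 ∷ 4444 ∷ 4453 ∷ 4456 ∷ 4465 ∷ 4477 ∷ 5344 ∷ 5644 ∷ 6544 ∷ []) ∷ []) ∷
  ((4445 ∷ 4454 ∷ 4466 ∷ 5366 ∷ 5645 ∷ 5654 ∷ 5666 ∷ 6545 ∷ 6554 ∷ 6566 ∷ 7754 ∷ []) ∷
   (3566 ∷ 4445 ∷ 5645 ∷ 5654 ∷ 5666 ∷ 6545 ∷ 6554 ∷ 6566 ∷ 7766 ∷ []) ∷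
   (3554 ∷ 4445 ∷ 4454 ∷ 4466 ∷ 5354 ∷ 5645 ∷ 6545 ∷ 6554 ∷ 6566 ∷ []) ∷ []) ∷
  ((5434 ∷ 5446 ∷ 5455 ∷ 6634 ∷ 6646 ∷ 6655 ∷ 7555 ∷ []) ∷
   (3364 ∷ 4555 ∷ 4564 ∷ 4567 ∷ 5734 ∷ 5743 ∷ 5746 ∷ 6634 ∷ 6655 ∷ 6664 ∷ 6667 ∷ []) ∷
   (3334 ∷ 3346 ∷ 3367 ∷ 4543 ∷ 4555 ∷ 4576 ∷ 5443 ∷ 5446 ∷ 5455 ∷ 5476 ∷ 5776 ∷ []) ∷ []) ∷
  ((4555 ∷ 5443 ∷ 5455 ∷ 5464 ∷ 5467 ∷ 6643 ∷ 6655 ∷ 6667 ∷ 6676 ∷ 7555 ∷ 7564 ∷ 7576 ∷ []) ∷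
   (4534 ∷ 4546 ∷ 4555 ∷ 4564 ∷ 5746 ∷ 5755 ∷ 6643 ∷ 6655 ∷ 6676 ∷ []) ∷
   (3334 ∷ 3355 ∷ 4534 ∷ 4546 ∷ 4555 ∷ 4576 ∷ 5455 ∷ 5464 ∷ 5467 ∷ []) ∷ []) ∷
  ((4433 ∷ 4445 ∷ 5345 ∷ 5366 ∷ 5645 ∷ 5657 ∷ 6554 ∷ 6566 ∷ 6575 ∷ 7745 ∷ 7754 ∷ []) ∷
   (3533 ∷ 3554 ∷ 4457 ∷ 4466 ∷ 5654 ∷ 5666 ∷ 5675 ∷ 6545 ∷ 6554 ∷ 7745 ∷ []) ∷
   (3557 ∷ 3566 ∷ 4454 ∷ 4466 ∷ 4475 ∷ 5345 ∷ 5633 ∷ 5654 ∷ 6545 ∷ 6566 ∷ []) ∷ []) ∷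
  ((5434 ∷ 5455 ∷ 6646 ∷ 6655 ∷ 7543 ∷ 7555 ∷ 7567 ∷ []) ∷
   (4555 ∷ 4564 ∷ 4567 ∷ 5734 ∷ 5743 ∷ 5746 ∷ 5755 ∷ 6634 ∷ 6646 ∷ 6655 ∷ 6664 ∷ 6676 ∷ []) ∷
   (3334 ∷ 3346 ∷ 3355 ∷ 3367 ∷ 4543 ∷ 4555 ∷ 4576 ∷ 5434 ∷ 5446 ∷ 5455 ∷ 5464 ∷ 5476 ∷ []) ∷ []) ∷
  ((3545 ∷ 4445 ∷ 4454 ∷ 4457 ∷ 5333 ∷ 5345 ∷ 5633 ∷ 5645 ∷ 5666 ∷ 6554 ∷ 6566 ∷ 6575 ∷ 7745 ∷
    7757 ∷ []) ∷
   (4445 ∷ 4466 ∷ 5654 ∷ 5657 ∷ 5666 ∷ 5675 ∷ 6545 ∷ 6554 ∷ 6566 ∷ []) ∷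
   (4433 ∷ 4454 ∷ 4466 ∷ 4475 ∷ 5645 ∷ 5654 ∷ 6545 ∷ 6554 ∷ 6566 ∷ []) ∷ []) ∷
  ((4454 ∷ 5666 ∷ 6533 ∷ 6545 ∷ 6554 ∷ 6557 ∷ 6566 ∷ 6575 ∷ []) ∷
   (3566 ∷ 4454 ∷ 4475 ∷ 5633 ∷ 5645 ∷ 5654 ∷ 5657 ∷ 5666 ∷ 6545 ∷ 6557 ∷ 6575 ∷ 7754 ∷ []) ∷
   (3554 ∷ 4433 ∷ 4445 ∷ 4454 ∷ 4457 ∷ 4466 ∷ 5366 ∷ 5666 ∷ 5675 ∷ 6533 ∷ 6545 ∷ 6575 ∷ []) ∷ []) ∷
  ((4334 ∷ 4355 ∷ 4364 ∷ 5555 ∷ 6443 ∷ 6746 ∷ 6755 ∷ 6776 ∷ 7667 ∷ []) ∷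
   (3455 ∷ 4655 ∷ 4664 ∷ 5534 ∷ 5543 ∷ 5555 ∷ 5564 ∷ 6734 ∷ 6767 ∷ 7634 ∷ 7655 ∷ 7667 ∷ []) ∷
   (3455 ∷ 3476 ∷ 4343 ∷ 4346 ∷ 4655 ∷ 5546 ∷ 5555 ∷ 5567 ∷ 5576 ∷ 6443 ∷ 6446 ∷ 6455 ∷ []) ∷ []) ∷
  ((4534 ∷ 4546 ∷ 5434 ∷ 5446 ∷ 5464 ∷ 5467 ∷ 6634 ∷ 6643 ∷ 6646 ∷ 6676 ∷ 7564 ∷ 7576 ∷ []) ∷
   (4534 ∷ 4555 ∷ 4564 ∷ 4567 ∷ 5455 ∷ 5467 ∷ 5755 ∷ 6643 ∷ 6655 ∷ 6667 ∷ 6676 ∷ 7555 ∷ []) ∷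
   (3355 ∷ 4543 ∷ 4546 ∷ 4555 ∷ 4576 ∷ 5443 ∷ 5455 ∷ 5464 ∷ 5467 ∷ 6643 ∷ 6655 ∷ 7555 ∷ []) ∷ []) ∷
  ((4344 ∷ 4356 ∷ 5544 ∷ 5556 ∷ 5565 ∷ 6453 ∷ 6456 ∷ 6465 ∷ 6744 ∷ 6756 ∷ 7644 ∷ 7665 ∷ 7677 ∷
    []) ∷
   (3444 ∷ 3456 ∷ 4644 ∷ 4653 ∷ 4665 ∷ 5535 ∷ 5544 ∷ 5556 ∷ 6756 ∷ 6765 ∷ 7644 ∷ 7656 ∷ []) ∷
   (3456 ∷ 3465 ∷ 3477 ∷ 4344 ∷ 4365 ∷ 4644 ∷ 4656 ∷ 5535 ∷ 5544 ∷ 5556 ∷ 6444 ∷ 6456 ∷ []) ∷ []) ∷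
  ((3334 ∷ 4534 ∷ 4546 ∷ 5443 ∷ 5446 ∷ 5464 ∷ 5467 ∷ 5746 ∷ 6634 ∷ 6643 ∷ 6667 ∷ 6676 ∷ 7564 ∷
    7576 ∷ []) ∷
   (4534 ∷ 4546 ∷ 4555 ∷ 4564 ∷ 5455 ∷ 5467 ∷ 5755 ∷ 6643 ∷ 6655 ∷ 6667 ∷ 6676 ∷ 7555 ∷ []) ∷
   (3355 ∷ 4534 ∷ 4546 ∷ 4555 ∷ 4576 ∷ 5443 ∷ 5455 ∷ 5464 ∷ 5467 ∷ 6643 ∷ 6655 ∷ 7555 ∷ []) ∷ []) ∷
  ((4343 ∷ 4346 ∷ 5543 ∷ 5555 ∷ 5564 ∷ 5567 ∷ 5576 ∷ 6434 ∷ 6455 ∷ 6464 ∷ 6467 ∷ 6476 ∷ 6734 ∷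
    6767 ∷ 7643 ∷ 7646 ∷ 7655 ∷ 7664 ∷ 7676 ∷ []) ∷
   (4643 ∷ 4655 ∷ 5543 ∷ 5546 ∷ 5564 ∷ 5576 ∷ 6746 ∷ 6755 ∷ 6767 ∷ 7646 ∷ []) ∷
   (3455 ∷ 3467 ∷ 4334 ∷ 4343 ∷ 4355 ∷ 5534 ∷ 5564 ∷ 5567 ∷ 5576 ∷ 6434 ∷ []) ∷ []) ∷
  []

children₃ : List (Vec (List ℕ) 3)
children₃ =
  ((6555 ∷ []) ∷
   (5655 ∷ []) ∷
   (4455 ∷ []) ∷ []) ∷
  ((4555 ∷ 7555 ∷ []) ∷
   (3355 ∷ 6655 ∷ []) ∷
   (5455 ∷ 5755 ∷ []) ∷ []) ∷
  ((5555 ∷ []) ∷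
   (4355 ∷ 4655 ∷ 7655 ∷ []) ∷
   (3455 ∷ 6455 ∷ 6755 ∷ []) ∷ []) ∷
  ((5444 ∷ 6656 ∷ 7565 ∷ []) ∷
   (4565 ∷ 5744 ∷ 6656 ∷ []) ∷
   (3356 ∷ 4565 ∷ 5444 ∷ []) ∷ []) ∷
  ((4356 ∷ 5565 ∷ 6444 ∷ 6744 ∷ 7656 ∷ []) ∷
   (3444 ∷ 4656 ∷ 5565 ∷ 6744 ∷ 7656 ∷ []) ∷
   (3444 ∷ 4356 ∷ 4656 ∷ 5565 ∷ 6444 ∷ []) ∷ []) ∷
  ((4454 ∷ 4457 ∷ 5333 ∷ 5366 ∷ 5633 ∷ 5666 ∷ 6545 ∷ 6575 ∷ 7754 ∷ 7757 ∷ []) ∷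
   (3533 ∷ 3566 ∷ 4445 ∷ 4475 ∷ 5654 ∷ 5657 ∷ 6566 ∷ 7745 ∷ []) ∷
   (3554 ∷ 3557 ∷ 4433 ∷ 4466 ∷ 5345 ∷ 5645 ∷ 5675 ∷ 6554 ∷ []) ∷ []) ∷
  ((4333 ∷ 5545 ∷ 6454 ∷ 6757 ∷ 7666 ∷ []) ∷
   (3475 ∷ 4654 ∷ 5566 ∷ 6745 ∷ 7657 ∷ []) ∷
   (3466 ∷ 4345 ∷ 4675 ∷ 5554 ∷ 6433 ∷ []) ∷ []) ∷
  ((4444 ∷ 5356 ∷ 5656 ∷ 6565 ∷ 7744 ∷ []) ∷
   (3565 ∷ 4444 ∷ 5656 ∷ 6565 ∷ 7744 ∷ []) ∷
   (3565 ∷ 4444 ∷ 5356 ∷ 5656 ∷ 6565 ∷ []) ∷ []) ∷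
  ((5544 ∷ 5556 ∷ 6444 ∷ 7656 ∷ []) ∷
   (3465 ∷ 5544 ∷ 5565 ∷ 6744 ∷ 6756 ∷ 7665 ∷ []) ∷
   (4344 ∷ 4356 ∷ 4665 ∷ 5556 ∷ 5565 ∷ 6465 ∷ []) ∷ []) ∷
  ((3434 ∷ 3464 ∷ 3467 ∷ 4343 ∷ 4346 ∷ 4643 ∷ 4646 ∷ 4676 ∷ 5555 ∷ 6434 ∷ 6464 ∷ 6467 ∷ 6734 ∷
    6767 ∷ 7643 ∷ 7646 ∷ 7676 ∷ []) ∷
   (5555 ∷ []) ∷
   (5555 ∷ []) ∷ []) ∷
  ((3434 ∷ 3464 ∷ 3467 ∷ 4343 ∷ 4346 ∷ 4643 ∷ 4646 ∷ 4676 ∷ 5555 ∷ 6434 ∷ 6464 ∷ 6467 ∷ 6734 ∷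
    6767 ∷ 7643 ∷ 7646 ∷ 7676 ∷ []) ∷
   (5546 ∷ []) ∷
   (5534 ∷ []) ∷ []) ∷
  ((5555 ∷ []) ∷
   (4655 ∷ 6743 ∷ 6746 ∷ 7655 ∷ []) ∷
   (3455 ∷ 4334 ∷ 4367 ∷ 6455 ∷ []) ∷ []) ∷
  ((3343 ∷ 3346 ∷ 3376 ∷ 4555 ∷ 5434 ∷ 5464 ∷ 5467 ∷ 5734 ∷ 5764 ∷ 5767 ∷ 6643 ∷ 6646 ∷ 6676 ∷
    7555 ∷ []) ∷
   (5434 ∷ []) ∷
   (6646 ∷ []) ∷ []) ∷
  ((4343 ∷ 5555 ∷ 6767 ∷ []) ∷
   (4655 ∷ 6743 ∷ 7655 ∷ []) ∷
   (3455 ∷ 4367 ∷ 6455 ∷ []) ∷ []) ∷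
  ((3343 ∷ 3346 ∷ 3376 ∷ 4555 ∷ 5434 ∷ 5464 ∷ 5467 ∷ 5734 ∷ 5764 ∷ 5767 ∷ 6643 ∷ 6646 ∷ 6676 ∷
    7555 ∷ []) ∷
   (7543 ∷ []) ∷
   (7567 ∷ []) ∷ []) ∷
  ((4343 ∷ 4346 ∷ 5555 ∷ 6434 ∷ 6464 ∷ 6467 ∷ 6734 ∷ 6767 ∷ 7643 ∷ 7646 ∷ 7676 ∷ []) ∷
   (4655 ∷ []) ∷
   (3455 ∷ []) ∷ []) ∷
  ((4444 ∷ 4465 ∷ 5656 ∷ 5665 ∷ 6544 ∷ 6556 ∷ 6565 ∷ []) ∷
   (3565 ∷ 5644 ∷ 5656 ∷ 6565 ∷ 7744 ∷ 7756 ∷ []) ∷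
   (3565 ∷ 4444 ∷ 4456 ∷ 5344 ∷ 5356 ∷ 6565 ∷ []) ∷ []) ∷
  ((4456 ∷ 4465 ∷ 5365 ∷ 5644 ∷ 5665 ∷ 6544 ∷ 6556 ∷ 6565 ∷ 7765 ∷ []) ∷
   (3565 ∷ 4456 ∷ 5644 ∷ 5656 ∷ 5665 ∷ 6556 ∷ 7756 ∷ []) ∷
   (3565 ∷ 4444 ∷ 4456 ∷ 4465 ∷ 5344 ∷ 5644 ∷ 6544 ∷ []) ∷ []) ∷
  ((3335 ∷ 3365 ∷ 5444 ∷ 5456 ∷ 5735 ∷ 5765 ∷ 6644 ∷ 6656 ∷ 7565 ∷ []) ∷
   (4544 ∷ 4565 ∷ 5756 ∷ 6656 ∷ 6677 ∷ []) ∷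
   (3344 ∷ 4556 ∷ 4565 ∷ 5444 ∷ 5453 ∷ []) ∷ []) ∷
  ((5554 ∷ 5566 ∷ 6454 ∷ 7666 ∷ []) ∷
   (3466 ∷ 5545 ∷ 5554 ∷ 6745 ∷ []) ∷
   (4345 ∷ 4654 ∷ 5545 ∷ 5566 ∷ []) ∷ []) ∷
  ((4544 ∷ 4556 ∷ 5444 ∷ 5456 ∷ 5465 ∷ 6644 ∷ 6656 ∷ 6665 ∷ 7544 ∷ 7556 ∷ []) ∷
   (4544 ∷ 4565 ∷ 5756 ∷ 5765 ∷ 6665 ∷ []) ∷
   (3344 ∷ 3365 ∷ 4556 ∷ 4565 ∷ 5465 ∷ []) ∷ []) ∷
  ((5534 ∷ 5546 ∷ 5555 ∷ 6455 ∷ 6464 ∷ 6467 ∷ 7643 ∷ 7655 ∷ 7676 ∷ []) ∷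
   (4655 ∷ 5534 ∷ 5564 ∷ 5576 ∷ 6743 ∷ 6746 ∷ 6755 ∷ 6767 ∷ []) ∷
   (3455 ∷ 4334 ∷ 4343 ∷ 4355 ∷ 4367 ∷ 5546 ∷ 5564 ∷ 5576 ∷ []) ∷ []) ∷
  ((4555 ∷ 5446 ∷ 5455 ∷ 6634 ∷ 6655 ∷ 7555 ∷ 7564 ∷ 7576 ∷ []) ∷
   (4543 ∷ 5755 ∷ 6646 ∷ 6655 ∷ []) ∷
   (3355 ∷ 4567 ∷ 5434 ∷ 5455 ∷ []) ∷ []) ∷
  ((3545 ∷ 3575 ∷ 4454 ∷ 4457 ∷ 5333 ∷ 5633 ∷ 5666 ∷ 6545 ∷ 7757 ∷ []) ∷
   (4454 ∷ 5333 ∷ 5633 ∷ 5666 ∷ 6545 ∷ 6575 ∷ 7754 ∷ []) ∷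
   (4454 ∷ 4457 ∷ 5366 ∷ 5666 ∷ 6545 ∷ 6575 ∷ 7757 ∷ []) ∷ []) ∷
  ((4534 ∷ 4546 ∷ 5446 ∷ 6634 ∷ []) ∷
   (4534 ∷ 4555 ∷ 4564 ∷ 5455 ∷ 5467 ∷ 5755 ∷ 6643 ∷ 6655 ∷ 6667 ∷ 6676 ∷ 7555 ∷ []) ∷
   (3355 ∷ 4546 ∷ 4555 ∷ 4576 ∷ 5443 ∷ 5455 ∷ 5464 ∷ 5467 ∷ 6643 ∷ 6655 ∷ 7555 ∷ []) ∷ []) ∷
  ((4545 ∷ 5454 ∷ 5457 ∷ 6633 ∷ 6666 ∷ []) ∷
   (4533 ∷ 4566 ∷ 5445 ∷ 5475 ∷ 5745 ∷ 6654 ∷ 6657 ∷ []) ∷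
   (3345 ∷ 4554 ∷ 4557 ∷ 5433 ∷ 5466 ∷ 6645 ∷ 6675 ∷ []) ∷ []) ∷
  ((4344 ∷ 4356 ∷ 5544 ∷ 5556 ∷ 5565 ∷ 6456 ∷ 6465 ∷ 6744 ∷ 6756 ∷ 7644 ∷ 7665 ∷ []) ∷
   (3444 ∷ 3456 ∷ 4644 ∷ 4665 ∷ 5544 ∷ 5556 ∷ 6756 ∷ 6765 ∷ []) ∷
   (3456 ∷ 3465 ∷ 4344 ∷ 4365 ∷ 4644 ∷ 4656 ∷ 5544 ∷ 5556 ∷ []) ∷ []) ∷
  ((3455 ∷ 3464 ∷ 4655 ∷ 4676 ∷ 5564 ∷ 5576 ∷ 6455 ∷ 7655 ∷ []) ∷
   (3455 ∷ 4355 ∷ 4364 ∷ 5534 ∷ 5555 ∷ 5564 ∷ 6734 ∷ 6755 ∷ 7655 ∷ []) ∷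
   (4346 ∷ 4355 ∷ 4655 ∷ 5546 ∷ 5555 ∷ 5576 ∷ 6455 ∷ 6755 ∷ 6776 ∷ []) ∷ []) ∷
  ((5545 ∷ 5554 ∷ 5566 ∷ 6454 ∷ 7666 ∷ []) ∷
   (3454 ∷ 5545 ∷ 5566 ∷ 6766 ∷ []) ∷
   (4354 ∷ 4666 ∷ 5545 ∷ 5554 ∷ []) ∷ []) ∷
  ((3333 ∷ 4545 ∷ 4554 ∷ 4566 ∷ 5454 ∷ 5466 ∷ 5757 ∷ 6654 ∷ 6666 ∷ []) ∷
   (4545 ∷ 5466 ∷ 5475 ∷ 5745 ∷ 6633 ∷ 6654 ∷ 7566 ∷ []) ∷
   (3345 ∷ 4545 ∷ 5457 ∷ 5466 ∷ 6654 ∷ 6675 ∷ 7554 ∷ []) ∷ []) ∷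
  ((4356 ∷ 5535 ∷ 5544 ∷ 5556 ∷ 5565 ∷ 6456 ∷ 6744 ∷ 7644 ∷ []) ∷
   (3444 ∷ 3456 ∷ 3477 ∷ 4356 ∷ 4656 ∷ 4665 ∷ 5556 ∷ 6465 ∷ 6756 ∷ 6765 ∷ 7644 ∷ []) ∷
   (3444 ∷ 3465 ∷ 4344 ∷ 4365 ∷ 4644 ∷ 4653 ∷ 4656 ∷ 5544 ∷ 6456 ∷ 6744 ∷ 7665 ∷ []) ∷ []) ∷
  ((5446 ∷ 5455 ∷ 6634 ∷ 6655 ∷ 7555 ∷ []) ∷
   (4534 ∷ 4555 ∷ 4564 ∷ 5455 ∷ 5743 ∷ 5746 ∷ 6655 ∷ 6676 ∷ []) ∷
   (3334 ∷ 3367 ∷ 4546 ∷ 4555 ∷ 4576 ∷ 5455 ∷ 5464 ∷ 6655 ∷ []) ∷ []) ∷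
  ((3455 ∷ 4655 ∷ 5555 ∷ 5564 ∷ 5576 ∷ 6455 ∷ 7655 ∷ []) ∷
   (3455 ∷ 3476 ∷ 4364 ∷ 5534 ∷ 5543 ∷ 5546 ∷ 5564 ∷ 6734 ∷ 6755 ∷ []) ∷
   (4346 ∷ 4355 ∷ 4655 ∷ 4664 ∷ 5534 ∷ 5546 ∷ 5567 ∷ 5576 ∷ 6776 ∷ []) ∷ []) ∷
  ((4433 ∷ 4445 ∷ 5645 ∷ 5657 ∷ 6554 ∷ 6566 ∷ 6575 ∷ []) ∷
   (3554 ∷ 4466 ∷ 5666 ∷ 5675 ∷ 6545 ∷ 6554 ∷ 7745 ∷ []) ∷
   (3566 ∷ 4454 ∷ 4475 ∷ 5345 ∷ 5654 ∷ 6545 ∷ 6566 ∷ []) ∷ []) ∷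
  ((5434 ∷ 5455 ∷ 6646 ∷ 6655 ∷ 7555 ∷ []) ∷
   (4555 ∷ 4564 ∷ 4567 ∷ 5734 ∷ 5743 ∷ 5746 ∷ 6646 ∷ 6655 ∷ 6664 ∷ 6676 ∷ []) ∷
   (3334 ∷ 3346 ∷ 3367 ∷ 4543 ∷ 4555 ∷ 4576 ∷ 5434 ∷ 5455 ∷ 5464 ∷ 5476 ∷ []) ∷ []) ∷
  ((4445 ∷ 4454 ∷ 4466 ∷ 5645 ∷ 5654 ∷ 5666 ∷ 6545 ∷ 6554 ∷ 6566 ∷ []) ∷
   (3566 ∷ 5645 ∷ 5654 ∷ 5666 ∷ 6545 ∷ 6554 ∷ 6566 ∷ []) ∷
   (3554 ∷ 4445 ∷ 4454 ∷ 4466 ∷ 6545 ∷ 6554 ∷ 6566 ∷ []) ∷ []) ∷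
  ((3344 ∷ 4544 ∷ 4556 ∷ 5444 ∷ 5456 ∷ 5465 ∷ 5756 ∷ 6644 ∷ 6656 ∷ 6665 ∷ 7565 ∷ []) ∷
   (4544 ∷ 4556 ∷ 4565 ∷ 5444 ∷ 5456 ∷ 5465 ∷ 5756 ∷ 7565 ∷ []) ∷
   (3344 ∷ 4544 ∷ 4556 ∷ 4565 ∷ 6644 ∷ 6656 ∷ 6665 ∷ 7565 ∷ []) ∷ []) ∷
  ((4434 ∷ 4464 ∷ 4467 ∷ 5643 ∷ 5646 ∷ 5676 ∷ 6555 ∷ []) ∷
   (4455 ∷ 5364 ∷ 6546 ∷ 7755 ∷ []) ∷
   (5355 ∷ 5655 ∷ 6534 ∷ 7776 ∷ []) ∷ []) ∷
  ((5434 ∷ 5446 ∷ 5455 ∷ 6634 ∷ 6646 ∷ 6655 ∷ 7555 ∷ []) ∷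
   (3364 ∷ 4555 ∷ 4564 ∷ 4567 ∷ 5743 ∷ 5746 ∷ 6634 ∷ 6655 ∷ 6664 ∷ []) ∷
   (3334 ∷ 3367 ∷ 4543 ∷ 4555 ∷ 4576 ∷ 5446 ∷ 5455 ∷ 5476 ∷ 5776 ∷ []) ∷ []) ∷
  ((4555 ∷ 5443 ∷ 5455 ∷ 6655 ∷ 6667 ∷ 7564 ∷ 7576 ∷ []) ∷
   (4546 ∷ 4555 ∷ 5755 ∷ 6643 ∷ 6655 ∷ 6676 ∷ []) ∷
   (3355 ∷ 4534 ∷ 4555 ∷ 5455 ∷ 5464 ∷ 5467 ∷ []) ∷ []) ∷
  ((4434 ∷ 4464 ∷ 4467 ∷ 5643 ∷ 5646 ∷ 5676 ∷ 6555 ∷ []) ∷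
   (3555 ∷ 5676 ∷ 6555 ∷ 7734 ∷ []) ∷
   (3555 ∷ 4464 ∷ 5346 ∷ 6555 ∷ []) ∷ []) ∷
  ((5445 ∷ 5454 ∷ 6645 ∷ 6666 ∷ []) ∷
   (3333 ∷ 3366 ∷ 4545 ∷ 4554 ∷ 5445 ∷ 5466 ∷ 5475 ∷ 6654 ∷ []) ∷
   (4545 ∷ 4566 ∷ 5466 ∷ 5754 ∷ 5757 ∷ 6645 ∷ 6654 ∷ 6675 ∷ []) ∷ []) ∷
  ((3444 ∷ 4356 ∷ 4656 ∷ 5535 ∷ 5565 ∷ 6444 ∷ 6744 ∷ 7656 ∷ []) ∷
   (3465 ∷ 4344 ∷ 4644 ∷ 5553 ∷ 5556 ∷ 6465 ∷ 6735 ∷ 6765 ∷ 7644 ∷ 7677 ∷ []) ∷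
   (3456 ∷ 4335 ∷ 4365 ∷ 4665 ∷ 5544 ∷ 5577 ∷ 6453 ∷ 6456 ∷ 6756 ∷ 7665 ∷ []) ∷ []) ∷
  ((3544 ∷ 3556 ∷ 4456 ∷ 4465 ∷ 5356 ∷ 5644 ∷ 5665 ∷ 6565 ∷ 7744 ∷ []) ∷
   (4444 ∷ 4456 ∷ 5656 ∷ 5665 ∷ 6565 ∷ 7744 ∷ 7756 ∷ []) ∷
   (4444 ∷ 4465 ∷ 5344 ∷ 5356 ∷ 5644 ∷ 5656 ∷ 6565 ∷ []) ∷ []) ∷
  ((3333 ∷ 4545 ∷ 5454 ∷ 5457 ∷ 5757 ∷ 6633 ∷ 6666 ∷ []) ∷
   (3333 ∷ 3366 ∷ 4545 ∷ 4575 ∷ 5454 ∷ 5457 ∷ 6633 ∷ 6666 ∷ 7545 ∷ []) ∷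
   (4545 ∷ 4575 ∷ 5454 ∷ 5457 ∷ 5754 ∷ 5757 ∷ 6633 ∷ 6666 ∷ 7545 ∷ []) ∷ []) ∷
  ((4454 ∷ 5666 ∷ 6533 ∷ 6545 ∷ 6554 ∷ 6557 ∷ 6566 ∷ 6575 ∷ []) ∷
   (3566 ∷ 4454 ∷ 4475 ∷ 5633 ∷ 5645 ∷ 5654 ∷ 5657 ∷ 5666 ∷ 6545 ∷ 6557 ∷ 6575 ∷ 7754 ∷ []) ∷
   (3554 ∷ 4433 ∷ 4445 ∷ 4454 ∷ 4457 ∷ 4466 ∷ 5366 ∷ 5666 ∷ 5675 ∷ 6533 ∷ 6545 ∷ 6575 ∷ []) ∷ []) ∷
  ((3545 ∷ 4445 ∷ 4454 ∷ 5645 ∷ 5666 ∷ 6554 ∷ 6566 ∷ []) ∷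
   (4445 ∷ 4466 ∷ 5666 ∷ 6545 ∷ 6554 ∷ 6566 ∷ []) ∷
   (4454 ∷ 5645 ∷ 5654 ∷ 6545 ∷ 6554 ∷ 6566 ∷ []) ∷ []) ∷
  ((4545 ∷ 4554 ∷ 4566 ∷ 5445 ∷ 5454 ∷ 5457 ∷ 5466 ∷ 5475 ∷ 6633 ∷ 6645 ∷ 6654 ∷ 6666 ∷ 6675 ∷
    7545 ∷ []) ∷
   (4554 ∷ 4566 ∷ 5433 ∷ 5733 ∷ 5766 ∷ 6657 ∷ 6666 ∷ []) ∷
   (3354 ∷ 3357 ∷ 4554 ∷ 4566 ∷ 5433 ∷ 5454 ∷ 6657 ∷ []) ∷ []) ∷
  ((3544 ∷ 3556 ∷ 4444 ∷ 4465 ∷ 5656 ∷ 5665 ∷ 6544 ∷ 6556 ∷ []) ∷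
   (5335 ∷ 5365 ∷ 5644 ∷ 5656 ∷ 6544 ∷ 6565 ∷ 7744 ∷ []) ∷
   (4444 ∷ 4456 ∷ 5356 ∷ 6556 ∷ 6565 ∷ 7735 ∷ 7765 ∷ []) ∷ []) ∷
  ((5545 ∷ 5554 ∷ 5566 ∷ []) ∷
   (4645 ∷ 5545 ∷ 5554 ∷ 5566 ∷ []) ∷
   (3445 ∷ 5545 ∷ 5554 ∷ 5566 ∷ []) ∷ []) ∷
  ((4334 ∷ 4355 ∷ 6746 ∷ 6755 ∷ []) ∷
   (3455 ∷ 4655 ∷ 4664 ∷ 5534 ∷ 5543 ∷ 5555 ∷ 5564 ∷ 7634 ∷ 7655 ∷ 7667 ∷ []) ∷
   (3455 ∷ 3476 ∷ 4655 ∷ 5546 ∷ 5555 ∷ 5567 ∷ 5576 ∷ 6443 ∷ 6446 ∷ 6455 ∷ []) ∷ []) ∷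
  ((3354 ∷ 4533 ∷ 4545 ∷ 4557 ∷ 5766 ∷ 7554 ∷ 7566 ∷ []) ∷
   (3333 ∷ 3354 ∷ 4554 ∷ 4566 ∷ 5433 ∷ 5445 ∷ 5454 ∷ 5475 ∷ 6645 ∷ 6666 ∷ 7545 ∷ []) ∷
   (4554 ∷ 4566 ∷ 5445 ∷ 5454 ∷ 5757 ∷ 5766 ∷ 6645 ∷ 6657 ∷ 6666 ∷ 6675 ∷ 7545 ∷ []) ∷ []) ∷
  ((5333 ∷ 6545 ∷ 6554 ∷ 6566 ∷ 7757 ∷ []) ∷
   (3554 ∷ 4454 ∷ 4466 ∷ 5633 ∷ 5645 ∷ 5654 ∷ 5657 ∷ 5666 ∷ 6545 ∷ 6575 ∷ []) ∷
   (3566 ∷ 4433 ∷ 4445 ∷ 4454 ∷ 4457 ∷ 4466 ∷ 5654 ∷ 5666 ∷ 6545 ∷ 6575 ∷ []) ∷ []) ∷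
  ((4444 ∷ 5356 ∷ 5656 ∷ 6565 ∷ 7744 ∷ []) ∷
   (3553 ∷ 4435 ∷ 4465 ∷ 5344 ∷ 5377 ∷ 5644 ∷ 5677 ∷ 6553 ∷ 6556 ∷ []) ∷
   (3577 ∷ 4453 ∷ 4456 ∷ 5635 ∷ 5665 ∷ 6544 ∷ 6577 ∷ 7753 ∷ 7756 ∷ []) ∷ []) ∷
  ((4445 ∷ 4454 ∷ 5645 ∷ 5666 ∷ 6554 ∷ 6566 ∷ []) ∷
   (3554 ∷ 4445 ∷ 4466 ∷ 5666 ∷ 6545 ∷ 6554 ∷ []) ∷
   (3566 ∷ 4454 ∷ 5645 ∷ 5654 ∷ 6545 ∷ 6566 ∷ []) ∷ []) ∷
  ((4554 ∷ 4566 ∷ 5445 ∷ 5454 ∷ 6645 ∷ 6666 ∷ 7554 ∷ 7566 ∷ []) ∷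
   (4545 ∷ 4554 ∷ 5745 ∷ 6654 ∷ 6666 ∷ []) ∷
   (3345 ∷ 4545 ∷ 4566 ∷ 5454 ∷ 5466 ∷ []) ∷ []) ∷
  ((3364 ∷ 5434 ∷ 5443 ∷ 5455 ∷ 5776 ∷ 6646 ∷ 6655 ∷ 6667 ∷ 7555 ∷ []) ∷
   (3343 ∷ 3355 ∷ 4555 ∷ 4564 ∷ 4576 ∷ 5443 ∷ 5734 ∷ 5767 ∷ 6643 ∷ 6676 ∷ 7546 ∷ []) ∷
   (3343 ∷ 3346 ∷ 4555 ∷ 4564 ∷ 4576 ∷ 5464 ∷ 5467 ∷ 5755 ∷ 5767 ∷ 6667 ∷ 7534 ∷ []) ∷ []) ∷
  ((3554 ∷ 3566 ∷ 4445 ∷ 4466 ∷ 5645 ∷ 5654 ∷ 6533 ∷ 6545 ∷ 6557 ∷ []) ∷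
   (4433 ∷ 4475 ∷ 5645 ∷ 5654 ∷ 6554 ∷ 6566 ∷ []) ∷
   (4445 ∷ 4466 ∷ 5657 ∷ 5675 ∷ 6554 ∷ 6566 ∷ []) ∷ []) ∷
  ((4554 ∷ 4566 ∷ 5445 ∷ 5454 ∷ 6645 ∷ 6666 ∷ 7554 ∷ 7566 ∷ []) ∷
   (3366 ∷ 4545 ∷ 4554 ∷ 6654 ∷ 6666 ∷ []) ∷
   (4545 ∷ 4566 ∷ 5454 ∷ 5466 ∷ 5754 ∷ []) ∷ []) ∷
  ((3454 ∷ 4366 ∷ 4666 ∷ 5545 ∷ 6454 ∷ 6754 ∷ 7666 ∷ []) ∷
   (4666 ∷ 5545 ∷ 6754 ∷ 7666 ∷ []) ∷
   (3454 ∷ 4366 ∷ 5545 ∷ 6454 ∷ []) ∷ []) ∷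
  ((3354 ∷ 4533 ∷ 4554 ∷ 4557 ∷ 4566 ∷ 5433 ∷ 5445 ∷ 5454 ∷ 5457 ∷ 5466 ∷ 5766 ∷ 6633 ∷ 6645 ∷
    6654 ∷ 6657 ∷ 6666 ∷ 7545 ∷ 7554 ∷ 7566 ∷ []) ∷
   (3354 ∷ 4554 ∷ 4575 ∷ 5433 ∷ 5454 ∷ 5745 ∷ 6633 ∷ 6666 ∷ 7545 ∷ []) ∷
   (3345 ∷ 4566 ∷ 4575 ∷ 5454 ∷ 5457 ∷ 5766 ∷ 6657 ∷ 6666 ∷ 7545 ∷ []) ∷ []) ∷
  ((3353 ∷ 3356 ∷ 4535 ∷ 4565 ∷ 5444 ∷ 5477 ∷ 5744 ∷ 5777 ∷ 6653 ∷ 6656 ∷ []) ∷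
   (3344 ∷ 4553 ∷ 4556 ∷ 5465 ∷ 5735 ∷ 5765 ∷ 6644 ∷ 6677 ∷ 7556 ∷ []) ∷
   (3335 ∷ 3365 ∷ 4544 ∷ 4577 ∷ 5453 ∷ 5456 ∷ 5756 ∷ 6665 ∷ 7544 ∷ []) ∷ []) ∷
  []

branches₃ : List (Vec (List ℕ) 3)
branches₃ =
  ((4444 ∷ 5656 ∷ 6565 ∷ []) ∷
   (4465 ∷ 5644 ∷ 6556 ∷ []) ∷
   (4456 ∷ 5665 ∷ 6544 ∷ []) ∷ []) ∷
  ((3356 ∷ 4565 ∷ 5444 ∷ 5744 ∷ 6656 ∷ 7565 ∷ []) ∷
   (3344 ∷ 4556 ∷ 5465 ∷ 5765 ∷ 6644 ∷ 7556 ∷ []) ∷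
   (3365 ∷ 4544 ∷ 5456 ∷ 5756 ∷ 6665 ∷ 7544 ∷ []) ∷ []) ∷
  ((3444 ∷ 4356 ∷ 4656 ∷ 5565 ∷ 6444 ∷ 6744 ∷ 7656 ∷ []) ∷
   (3465 ∷ 4344 ∷ 4644 ∷ 5556 ∷ 6465 ∷ 7644 ∷ []) ∷
   (3456 ∷ 4665 ∷ 5544 ∷ 6456 ∷ 6756 ∷ 7665 ∷ []) ∷ []) ∷
  ((3345 ∷ 4554 ∷ 4566 ∷ 5433 ∷ 5454 ∷ 5745 ∷ 6657 ∷ 6666 ∷ 7575 ∷ []) ∷
   (3366 ∷ 4554 ∷ 4575 ∷ 5445 ∷ 5454 ∷ 6645 ∷ 6657 ∷ 7566 ∷ []) ∷
   (4566 ∷ 4575 ∷ 5433 ∷ 5445 ∷ 5754 ∷ 6645 ∷ 6666 ∷ 7554 ∷ []) ∷ []) ∷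
  ((5555 ∷ []) ∷
   (5555 ∷ []) ∷
   (5555 ∷ []) ∷ []) ∷
  ((3333 ∷ 4545 ∷ 5454 ∷ 5757 ∷ 6666 ∷ []) ∷
   (3375 ∷ 4554 ∷ 5466 ∷ 6645 ∷ 6654 ∷ 7557 ∷ []) ∷
   (4566 ∷ 5445 ∷ 5466 ∷ 5775 ∷ 6654 ∷ 7533 ∷ []) ∷ []) ∷
  ((3433 ∷ 3445 ∷ 4345 ∷ 4366 ∷ 4645 ∷ 4657 ∷ 5554 ∷ 5566 ∷ 5575 ∷ 6433 ∷ 6745 ∷ 6754 ∷ 7657 ∷
    []) ∷
   (3433 ∷ 3454 ∷ 4357 ∷ 4366 ∷ 4645 ∷ 4666 ∷ 5554 ∷ 5566 ∷ 5575 ∷ 6445 ∷ 6454 ∷ 7645 ∷ []) ∷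
   (3445 ∷ 3454 ∷ 4657 ∷ 4666 ∷ 5554 ∷ 5566 ∷ 5575 ∷ 6445 ∷ 6733 ∷ 6754 ∷ 7645 ∷ 7666 ∷ []) ∷ []) ∷
  ((3466 ∷ 4333 ∷ 4345 ∷ 4654 ∷ 5545 ∷ 5554 ∷ 5566 ∷ 6454 ∷ 6745 ∷ 6757 ∷ 7666 ∷ []) ∷
   (3454 ∷ 4354 ∷ 4366 ∷ 5533 ∷ 5545 ∷ 5554 ∷ 5557 ∷ 5566 ∷ 5575 ∷ 6445 ∷ 6475 ∷ 7654 ∷ []) ∷
   (4666 ∷ 5533 ∷ 5545 ∷ 5554 ∷ 5557 ∷ 5566 ∷ 5575 ∷ 6466 ∷ 6754 ∷ 6766 ∷ 7645 ∷ 7675 ∷ []) ∷ []) ∷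
  ((3444 ∷ 4344 ∷ 4356 ∷ 4656 ∷ 5535 ∷ 5544 ∷ 5556 ∷ 5565 ∷ 6744 ∷ 6756 ∷ []) ∷
   (3465 ∷ 4344 ∷ 5553 ∷ 5556 ∷ 5565 ∷ 6456 ∷ 6465 ∷ 6744 ∷ 6756 ∷ 7644 ∷ 7656 ∷ []) ∷
   (4344 ∷ 4356 ∷ 4665 ∷ 5544 ∷ 5565 ∷ 5577 ∷ 6444 ∷ 6456 ∷ 6756 ∷ 7644 ∷ 7665 ∷ []) ∷ []) ∷
  ((4544 ∷ 4556 ∷ 4565 ∷ 5444 ∷ 5456 ∷ 5465 ∷ 6644 ∷ 6656 ∷ 6665 ∷ []) ∷
   (3365 ∷ 4556 ∷ 4577 ∷ 5444 ∷ 5456 ∷ 5465 ∷ 6635 ∷ 6644 ∷ 6656 ∷ 7556 ∷ 7565 ∷ []) ∷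
   (4544 ∷ 4553 ∷ 5435 ∷ 5444 ∷ 5456 ∷ 5765 ∷ 6644 ∷ 6656 ∷ 6665 ∷ 7544 ∷ 7565 ∷ []) ∷ []) ∷
  ((4544 ∷ 4556 ∷ 4565 ∷ 5444 ∷ 5453 ∷ 5456 ∷ 6644 ∷ 6656 ∷ 6677 ∷ []) ∷
   (3365 ∷ 4535 ∷ 4544 ∷ 4556 ∷ 5444 ∷ 5456 ∷ 5465 ∷ 6644 ∷ 6656 ∷ 6665 ∷ 7565 ∷ []) ∷
   (4535 ∷ 4544 ∷ 4556 ∷ 5444 ∷ 5456 ∷ 5465 ∷ 5765 ∷ 6644 ∷ 6656 ∷ 6665 ∷ 7565 ∷ []) ∷ []) ∷
  ((3343 ∷ 3346 ∷ 4543 ∷ 4555 ∷ 4564 ∷ 4567 ∷ 4576 ∷ 5434 ∷ 5455 ∷ 5464 ∷ 5467 ∷ 5476 ∷ 5734 ∷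
    5767 ∷ 6643 ∷ 6646 ∷ 6655 ∷ 6664 ∷ 6676 ∷ 7555 ∷ []) ∷
   (4543 ∷ 4546 ∷ 4555 ∷ 5443 ∷ 5446 ∷ 5464 ∷ 5476 ∷ 6646 ∷ 6655 ∷ 6667 ∷ 7546 ∷ []) ∷
   (4534 ∷ 4555 ∷ 4567 ∷ 5434 ∷ 5443 ∷ 5455 ∷ 6634 ∷ 6664 ∷ 6667 ∷ 6676 ∷ 7534 ∷ []) ∷ []) ∷
  ((3454 ∷ 3457 ∷ 4333 ∷ 4366 ∷ 4633 ∷ 4666 ∷ 5545 ∷ 5554 ∷ 5566 ∷ 5575 ∷ 6754 ∷ 6757 ∷ []) ∷
   (3433 ∷ 3466 ∷ 4345 ∷ 4375 ∷ 4666 ∷ 5554 ∷ 5557 ∷ 6466 ∷ 7645 ∷ []) ∷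
   (3454 ∷ 4654 ∷ 4657 ∷ 5533 ∷ 5566 ∷ 6445 ∷ 6745 ∷ 6775 ∷ 7654 ∷ []) ∷ []) ∷
  ((3456 ∷ 3465 ∷ 4344 ∷ 4365 ∷ 4644 ∷ 4665 ∷ 5535 ∷ 5544 ∷ 5556 ∷ 5565 ∷ 6756 ∷ 6765 ∷ []) ∷
   (3465 ∷ 4356 ∷ 5544 ∷ 5553 ∷ 5556 ∷ 5565 ∷ 5577 ∷ 6456 ∷ 7656 ∷ []) ∷
   (4665 ∷ 5544 ∷ 5553 ∷ 5556 ∷ 5565 ∷ 5577 ∷ 6444 ∷ 6744 ∷ 7644 ∷ []) ∷ []) ∷
  ((3356 ∷ 4565 ∷ 5444 ∷ 5744 ∷ 6656 ∷ 7565 ∷ []) ∷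
   (3344 ∷ 4556 ∷ 4565 ∷ 5465 ∷ 6635 ∷ 6644 ∷ 7556 ∷ []) ∷
   (4544 ∷ 4565 ∷ 5435 ∷ 5456 ∷ 5756 ∷ 6665 ∷ 7544 ∷ []) ∷ []) ∷
  ((3564 ∷ 3576 ∷ 4434 ∷ 4455 ∷ 4476 ∷ 5646 ∷ 5655 ∷ 5664 ∷ 6543 ∷ 6555 ∷ 6567 ∷ []) ∷
   (4455 ∷ 4464 ∷ 4467 ∷ 5634 ∷ 5643 ∷ 5646 ∷ 5655 ∷ 5667 ∷ 6534 ∷ 6546 ∷ 6555 ∷ 6564 ∷ 6576 ∷
    []) ∷
   (4434 ∷ 4443 ∷ 4446 ∷ 4455 ∷ 4467 ∷ 5643 ∷ 5655 ∷ 5676 ∷ 6534 ∷ 6546 ∷ 6555 ∷ 6564 ∷ 6576 ∷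
    []) ∷ []) ∷
  ((3543 ∷ 3567 ∷ 4434 ∷ 4455 ∷ 4476 ∷ 5646 ∷ 5655 ∷ 5664 ∷ 6543 ∷ 6555 ∷ 6567 ∷ []) ∷
   (4455 ∷ 4464 ∷ 4467 ∷ 5634 ∷ 5643 ∷ 5646 ∷ 5655 ∷ 5667 ∷ 6534 ∷ 6546 ∷ 6555 ∷ 6564 ∷ 6576 ∷
    []) ∷
   (4434 ∷ 4443 ∷ 4446 ∷ 4455 ∷ 4467 ∷ 5643 ∷ 5655 ∷ 5676 ∷ 6534 ∷ 6546 ∷ 6555 ∷ 6564 ∷ 6576 ∷
    []) ∷ []) ∷
  ((3334 ∷ 3343 ∷ 4555 ∷ 4564 ∷ 4576 ∷ 5446 ∷ 5455 ∷ 5464 ∷ 5467 ∷ 5746 ∷ 5767 ∷ 6634 ∷ 6643 ∷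
    6655 ∷ 6676 ∷ []) ∷
   (3355 ∷ 4534 ∷ 4555 ∷ 5455 ∷ 5464 ∷ 6643 ∷ 6655 ∷ 6667 ∷ 7555 ∷ []) ∷
   (4546 ∷ 4555 ∷ 5443 ∷ 5455 ∷ 5467 ∷ 5755 ∷ 6655 ∷ 6676 ∷ 7555 ∷ []) ∷ []) ∷
  ((3445 ∷ 3454 ∷ 3466 ∷ 4366 ∷ 4645 ∷ 4654 ∷ 4666 ∷ 5545 ∷ 5554 ∷ 5566 ∷ 5575 ∷ 6754 ∷ []) ∷
   (3466 ∷ 4345 ∷ 5545 ∷ 5554 ∷ 5566 ∷ 6445 ∷ 6454 ∷ 6466 ∷ 6754 ∷ 7666 ∷ []) ∷
   (4366 ∷ 4654 ∷ 5545 ∷ 5554 ∷ 5566 ∷ 6454 ∷ 6745 ∷ 7645 ∷ 7654 ∷ 7666 ∷ []) ∷ []) ∷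
  ((3555 ∷ 4443 ∷ 4446 ∷ 4455 ∷ 5634 ∷ 5655 ∷ 5667 ∷ 6534 ∷ 6546 ∷ 6555 ∷ 6564 ∷ 6576 ∷ []) ∷
   (4443 ∷ 4455 ∷ 4464 ∷ 4467 ∷ 5646 ∷ 5655 ∷ 5664 ∷ 6534 ∷ 6546 ∷ 6555 ∷ 6564 ∷ 6567 ∷ []) ∷
   (4434 ∷ 4455 ∷ 4476 ∷ 5643 ∷ 5655 ∷ 5667 ∷ 5676 ∷ 6534 ∷ 6543 ∷ 6546 ∷ 6555 ∷ 6576 ∷ []) ∷ []) ∷
  ((4533 ∷ 4545 ∷ 4554 ∷ 4557 ∷ 4566 ∷ 5445 ∷ 5454 ∷ 5466 ∷ 6645 ∷ 6654 ∷ 6666 ∷ []) ∷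
   (3345 ∷ 3354 ∷ 4554 ∷ 4566 ∷ 5445 ∷ 5454 ∷ 5466 ∷ 5745 ∷ 6654 ∷ 6657 ∷ 6666 ∷ 7554 ∷ []) ∷
   (3345 ∷ 4554 ∷ 4566 ∷ 5433 ∷ 5454 ∷ 5466 ∷ 5745 ∷ 5766 ∷ 6645 ∷ 6654 ∷ 6666 ∷ 7566 ∷ []) ∷ []) ∷
  ((3554 ∷ 3566 ∷ 4445 ∷ 4454 ∷ 5345 ∷ 5366 ∷ 5645 ∷ 5666 ∷ 6554 ∷ 6566 ∷ 7745 ∷ 7754 ∷ []) ∷
   (4445 ∷ 4454 ∷ 5366 ∷ 5645 ∷ 5666 ∷ 6554 ∷ 6566 ∷ 7745 ∷ []) ∷
   (4445 ∷ 4454 ∷ 5345 ∷ 5645 ∷ 5666 ∷ 6554 ∷ 6566 ∷ 7754 ∷ []) ∷ []) ∷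
  ((3334 ∷ 4534 ∷ 4546 ∷ 4555 ∷ 5455 ∷ 5464 ∷ 5467 ∷ 5746 ∷ 6643 ∷ 6655 ∷ 6676 ∷ []) ∷
   (3355 ∷ 4555 ∷ 5434 ∷ 5455 ∷ 5464 ∷ 5476 ∷ 6643 ∷ 6646 ∷ 6655 ∷ 6667 ∷ []) ∷
   (4555 ∷ 5434 ∷ 5443 ∷ 5455 ∷ 5467 ∷ 5755 ∷ 6646 ∷ 6655 ∷ 6664 ∷ 6676 ∷ []) ∷ []) ∷
  ((3555 ∷ 4443 ∷ 4455 ∷ 4464 ∷ 4467 ∷ 5643 ∷ 5655 ∷ 5667 ∷ 5676 ∷ 6534 ∷ 6546 ∷ 6555 ∷ 6564 ∷
    6576 ∷ []) ∷
   (4434 ∷ 4446 ∷ 4455 ∷ 4464 ∷ 5646 ∷ 5655 ∷ 5664 ∷ 6543 ∷ 6555 ∷ 6567 ∷ 6576 ∷ []) ∷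
   (4434 ∷ 4455 ∷ 4476 ∷ 5634 ∷ 5646 ∷ 5655 ∷ 5676 ∷ 6543 ∷ 6555 ∷ 6564 ∷ 6567 ∷ []) ∷ []) ∷
  ((3344 ∷ 3356 ∷ 4544 ∷ 4556 ∷ 4565 ∷ 5444 ∷ 5453 ∷ 5456 ∷ 5465 ∷ 5744 ∷ 5756 ∷ 6644 ∷ 6656 ∷
    6665 ∷ 6677 ∷ []) ∷
   (3344 ∷ 3356 ∷ 3365 ∷ 4544 ∷ 4553 ∷ 4565 ∷ 5435 ∷ 5444 ∷ 5456 ∷ 5756 ∷ 6656 ∷ 6665 ∷ 6677 ∷
    7544 ∷ 7556 ∷ []) ∷
   (3344 ∷ 4556 ∷ 4565 ∷ 4577 ∷ 5444 ∷ 5453 ∷ 5465 ∷ 5744 ∷ 5756 ∷ 5765 ∷ 6635 ∷ 6644 ∷ 6656 ∷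
    7544 ∷ 7556 ∷ []) ∷ []) ∷
  ((3334 ∷ 3355 ∷ 3364 ∷ 4543 ∷ 4555 ∷ 4567 ∷ 5434 ∷ 5443 ∷ 5446 ∷ 5476 ∷ 5746 ∷ 5755 ∷ 5776 ∷
    6634 ∷ 6646 ∷ 6664 ∷ 6667 ∷ []) ∷
   (3355 ∷ 4534 ∷ 4555 ∷ 4564 ∷ 4576 ∷ 5434 ∷ 5443 ∷ 5455 ∷ 5464 ∷ 6634 ∷ 6655 ∷ 6667 ∷ 7534 ∷
    7555 ∷ 7567 ∷ []) ∷
   (4546 ∷ 4555 ∷ 4564 ∷ 4576 ∷ 5443 ∷ 5446 ∷ 5455 ∷ 5755 ∷ 6646 ∷ 6655 ∷ 6667 ∷ 6676 ∷ 7543 ∷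
    7546 ∷ 7555 ∷ []) ∷ []) ∷
  ((3555 ∷ 4446 ∷ 4455 ∷ 5343 ∷ 5634 ∷ 5655 ∷ 6534 ∷ 6546 ∷ 6555 ∷ 6564 ∷ 6576 ∷ 7767 ∷ []) ∷
   (3576 ∷ 4443 ∷ 4455 ∷ 4464 ∷ 4467 ∷ 5634 ∷ 5655 ∷ 6534 ∷ 6546 ∷ 6555 ∷ 6564 ∷ 7767 ∷ []) ∷
   (3564 ∷ 4446 ∷ 4455 ∷ 5343 ∷ 5643 ∷ 5655 ∷ 5667 ∷ 5676 ∷ 6534 ∷ 6546 ∷ 6555 ∷ 6576 ∷ []) ∷ []) ∷
  ((4534 ∷ 4546 ∷ 4555 ∷ 4564 ∷ 4576 ∷ 5443 ∷ 5455 ∷ 5464 ∷ 6655 ∷ 6667 ∷ 6676 ∷ []) ∷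
   (3355 ∷ 4534 ∷ 4543 ∷ 4555 ∷ 4576 ∷ 5446 ∷ 5455 ∷ 5476 ∷ 6643 ∷ 6646 ∷ 6655 ∷ 7555 ∷ 7567 ∷
    []) ∷
   (4546 ∷ 4555 ∷ 4564 ∷ 4567 ∷ 5434 ∷ 5455 ∷ 5467 ∷ 5755 ∷ 6634 ∷ 6655 ∷ 6664 ∷ 7543 ∷ 7555 ∷
    []) ∷ []) ∷
  ((3534 ∷ 3543 ∷ 3546 ∷ 3567 ∷ 4446 ∷ 4455 ∷ 4464 ∷ 4467 ∷ 5343 ∷ 5634 ∷ 5643 ∷ 5655 ∷ 5676 ∷
    6543 ∷ 6555 ∷ 6567 ∷ 7767 ∷ []) ∷
   (4434 ∷ 4455 ∷ 4464 ∷ 5355 ∷ 5643 ∷ 5646 ∷ 5655 ∷ 6555 ∷ 6576 ∷ 7755 ∷ []) ∷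
   (4434 ∷ 4455 ∷ 4467 ∷ 5355 ∷ 5646 ∷ 5655 ∷ 5676 ∷ 6555 ∷ 6564 ∷ 7755 ∷ []) ∷ []) ∷
  ((3554 ∷ 3566 ∷ 4433 ∷ 4445 ∷ 4454 ∷ 5333 ∷ 5645 ∷ 5657 ∷ 5666 ∷ 6554 ∷ 6566 ∷ 7757 ∷ []) ∷
   (3554 ∷ 4445 ∷ 4454 ∷ 5366 ∷ 5645 ∷ 5666 ∷ 6554 ∷ 6566 ∷ 7745 ∷ []) ∷
   (3566 ∷ 4445 ∷ 4454 ∷ 5345 ∷ 5645 ∷ 5666 ∷ 6554 ∷ 6566 ∷ 7754 ∷ []) ∷ []) ∷
  []

only₃ : List ℕ
only₃ =
  0 ∷ 3 ∷ 4 ∷ 6 ∷ 7 ∷ 25 ∷ 11 ∷ 55 ∷ 19 ∷ 13 ∷ 1 ∷ 28 ∷ 5 ∷ 11 ∷ 16 ∷ 11 ∷ 21 ∷ 31 ∷ 52 ∷ 8 ∷ 22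
  ∷ 17 ∷ 8 ∷ 20 ∷ 58 ∷ 17 ∷ 35 ∷ 38 ∷ 39 ∷ 33 ∷ 34 ∷ 46 ∷ 45 ∷ 50 ∷ 24 ∷ 26 ∷ 24 ∷ 15 ∷ []

join₃ : List ℕ
join₃ =
  0 ∷ 1 ∷ 2 ∷ 3 ∷ 6 ∷ 28 ∷ 4 ∷ 21 ∷ 7 ∷ 2 ∷ 2 ∷ 2 ∷ 1 ∷ 2 ∷ 1 ∷ 2 ∷ 29 ∷ 29 ∷ 3 ∷ 4 ∷ 5 ∷ 8 ∷ 9
  ∷ 26 ∷ 10 ∷ 22 ∷ 12 ∷ 13 ∷ 4 ∷ 17 ∷ 12 ∷ 14 ∷ 13 ∷ 23 ∷ 14 ∷ 16 ∷ 20 ∷ 0 ∷ 14 ∷ 10 ∷ 0 ∷ 22 ∷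
  18 ∷ 21 ∷ 17 ∷ 16 ∷ 23 ∷ 11 ∷ 21 ∷ 4 ∷ 13 ∷ 25 ∷ 19 ∷ 21 ∷ 23 ∷ 27 ∷ 24 ∷ 15 ∷ 27 ∷ 4 ∷ 25 ∷
  20 ∷ []

also₃ : List (List ℕ)
also₃ =
  (1 ∷ 8 ∷ 43 ∷ 57 ∷ 36 ∷ 49 ∷ 0 ∷ 19 ∷ 54 ∷ 0 ∷ 2 ∷ 35 ∷ 41 ∷ 0 ∷ 20 ∷ 0 ∷ 0 ∷ 27 ∷ 51 ∷ 16 ∷ 2
   ∷ 3 ∷ 16 ∷ 8 ∷ 19 ∷ 3 ∷ 55 ∷ 27 ∷ 2 ∷ 55 ∷ 27 ∷ 55 ∷ 51 ∷ 0 ∷ 32 ∷ 43 ∷ 32 ∷ 0 ∷ []) ∷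
  (2 ∷ 16 ∷ 3 ∷ 29 ∷ 4 ∷ 46 ∷ 1 ∷ 54 ∷ 55 ∷ 1 ∷ 0 ∷ 55 ∷ 19 ∷ 1 ∷ 8 ∷ 1 ∷ 1 ∷ 0 ∷ 49 ∷ 3 ∷ 0 ∷ 4
   ∷ 3 ∷ 16 ∷ 54 ∷ 4 ∷ 49 ∷ 0 ∷ 0 ∷ 19 ∷ 0 ∷ 49 ∷ 49 ∷ 1 ∷ 0 ∷ 3 ∷ 0 ∷ 1 ∷ []) ∷
  (0 ∷ 3 ∷ 4 ∷ 49 ∷ 7 ∷ 55 ∷ 2 ∷ 55 ∷ 19 ∷ 2 ∷ 1 ∷ 49 ∷ 54 ∷ 2 ∷ 16 ∷ 2 ∷ 2 ∷ 1 ∷ 54 ∷ 4 ∷ 1 ∷ 7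
   ∷ 4 ∷ 3 ∷ 55 ∷ 7 ∷ 54 ∷ 1 ∷ 1 ∷ 54 ∷ 1 ∷ 54 ∷ 54 ∷ 2 ∷ 1 ∷ 4 ∷ 1 ∷ 2 ∷ []) ∷
  (8 ∷ 23 ∷ 44 ∷ 56 ∷ 59 ∷ 0 ∷ 3 ∷ 0 ∷ 1 ∷ 3 ∷ 7 ∷ 1 ∷ 15 ∷ 3 ∷ 49 ∷ 3 ∷ 3 ∷ 7 ∷ 2 ∷ 55 ∷ 16 ∷
   49 ∷ 55 ∷ 54 ∷ 0 ∷ 49 ∷ 2 ∷ 48 ∷ 7 ∷ 2 ∷ 16 ∷ 2 ∷ 9 ∷ 3 ∷ 7 ∷ 55 ∷ 7 ∷ 3 ∷ []) ∷
  (43 ∷ 44 ∷ 59 ∷ 15 ∷ 23 ∷ 1 ∷ 4 ∷ 1 ∷ 2 ∷ 4 ∷ 3 ∷ 2 ∷ 0 ∷ 4 ∷ 54 ∷ 4 ∷ 4 ∷ 3 ∷ 0 ∷ 49 ∷ 3 ∷ 54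
   ∷ 49 ∷ 55 ∷ 1 ∷ 54 ∷ 0 ∷ 3 ∷ 3 ∷ 0 ∷ 3 ∷ 0 ∷ 0 ∷ 4 ∷ 3 ∷ 49 ∷ 3 ∷ 4 ∷ []) ∷
  (41 ∷ 15 ∷ 0 ∷ 53 ∷ 1 ∷ 42 ∷ 54 ∷ 4 ∷ 7 ∷ 54 ∷ 49 ∷ 7 ∷ 61 ∷ 54 ∷ 1 ∷ 54 ∷ 54 ∷ 49 ∷ 3 ∷ 0 ∷
   49 ∷ 1 ∷ 0 ∷ 2 ∷ 4 ∷ 1 ∷ 3 ∷ 49 ∷ 49 ∷ 3 ∷ 49 ∷ 3 ∷ 3 ∷ 54 ∷ 49 ∷ 0 ∷ 49 ∷ 54 ∷ []) ∷
  (57 ∷ 56 ∷ 15 ∷ 42 ∷ 0 ∷ 61 ∷ 49 ∷ 3 ∷ 8 ∷ 49 ∷ 25 ∷ 4 ∷ 53 ∷ 49 ∷ 0 ∷ 49 ∷ 6 ∷ 58 ∷ 48 ∷ 2 ∷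
   55 ∷ 0 ∷ 2 ∷ 1 ∷ 3 ∷ 0 ∷ 7 ∷ 55 ∷ 55 ∷ 7 ∷ 55 ∷ 7 ∷ 16 ∷ 49 ∷ 55 ∷ 2 ∷ 55 ∷ 49 ∷ []) ∷
  (36 ∷ 59 ∷ 23 ∷ 0 ∷ 44 ∷ 2 ∷ 7 ∷ 2 ∷ 0 ∷ 7 ∷ 4 ∷ 0 ∷ 1 ∷ 7 ∷ 55 ∷ 7 ∷ 7 ∷ 4 ∷ 1 ∷ 54 ∷ 4 ∷ 55
   ∷ 54 ∷ 49 ∷ 2 ∷ 55 ∷ 1 ∷ 4 ∷ 4 ∷ 1 ∷ 4 ∷ 1 ∷ 1 ∷ 7 ∷ 4 ∷ 54 ∷ 4 ∷ 7 ∷ []) ∷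
  (16 ∷ 60 ∷ 49 ∷ 50 ∷ 54 ∷ 1 ∷ 4 ∷ 1 ∷ 2 ∷ 4 ∷ 3 ∷ 2 ∷ 0 ∷ 4 ∷ 54 ∷ 4 ∷ 4 ∷ 3 ∷ 0 ∷ 49 ∷ 3 ∷ 54
   ∷ 49 ∷ 55 ∷ 1 ∷ 54 ∷ 0 ∷ 3 ∷ 3 ∷ 0 ∷ 3 ∷ 0 ∷ 0 ∷ 4 ∷ 3 ∷ 49 ∷ 3 ∷ 8 ∷ []) ∷
  (0 ∷ 3 ∷ 4 ∷ 19 ∷ 7 ∷ 25 ∷ 2 ∷ 55 ∷ 49 ∷ 2 ∷ 1 ∷ 49 ∷ 54 ∷ 2 ∷ 7 ∷ 11 ∷ 2 ∷ 1 ∷ 54 ∷ 4 ∷ 1 ∷ 7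
   ∷ 4 ∷ 3 ∷ 55 ∷ 7 ∷ 54 ∷ 1 ∷ 1 ∷ 54 ∷ 1 ∷ 54 ∷ 54 ∷ 2 ∷ 1 ∷ 4 ∷ 1 ∷ 2 ∷ []) ∷
  (0 ∷ 3 ∷ 4 ∷ 6 ∷ 7 ∷ 25 ∷ 2 ∷ 55 ∷ 49 ∷ 2 ∷ 1 ∷ 49 ∷ 5 ∷ 11 ∷ 7 ∷ 11 ∷ 2 ∷ 1 ∷ 54 ∷ 4 ∷ 1 ∷ 7
   ∷ 4 ∷ 3 ∷ 55 ∷ 7 ∷ 54 ∷ 1 ∷ 1 ∷ 54 ∷ 1 ∷ 54 ∷ 54 ∷ 2 ∷ 1 ∷ 4 ∷ 1 ∷ 2 ∷ []) ∷
  (0 ∷ 3 ∷ 4 ∷ 6 ∷ 7 ∷ 25 ∷ 2 ∷ 55 ∷ 19 ∷ 2 ∷ 1 ∷ 49 ∷ 57 ∷ 2 ∷ 16 ∷ 2 ∷ 2 ∷ 1 ∷ 54 ∷ 4 ∷ 1 ∷ 7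
   ∷ 4 ∷ 3 ∷ 55 ∷ 7 ∷ 54 ∷ 1 ∷ 1 ∷ 54 ∷ 1 ∷ 54 ∷ 57 ∷ 2 ∷ 1 ∷ 4 ∷ 1 ∷ 2 ∷ []) ∷
  (11 ∷ 7 ∷ 3 ∷ 25 ∷ 4 ∷ 5 ∷ 1 ∷ 54 ∷ 55 ∷ 1 ∷ 0 ∷ 55 ∷ 6 ∷ 1 ∷ 4 ∷ 12 ∷ 1 ∷ 0 ∷ 49 ∷ 3 ∷ 0 ∷ 4
   ∷ 3 ∷ 7 ∷ 54 ∷ 4 ∷ 49 ∷ 0 ∷ 0 ∷ 49 ∷ 0 ∷ 49 ∷ 49 ∷ 1 ∷ 0 ∷ 3 ∷ 0 ∷ 1 ∷ []) ∷
  (0 ∷ 3 ∷ 4 ∷ 6 ∷ 7 ∷ 25 ∷ 2 ∷ 55 ∷ 19 ∷ 2 ∷ 1 ∷ 49 ∷ 57 ∷ 2 ∷ 16 ∷ 2 ∷ 2 ∷ 1 ∷ 54 ∷ 4 ∷ 1 ∷ 7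
   ∷ 4 ∷ 3 ∷ 55 ∷ 7 ∷ 54 ∷ 1 ∷ 1 ∷ 54 ∷ 1 ∷ 54 ∷ 57 ∷ 2 ∷ 1 ∷ 4 ∷ 1 ∷ 2 ∷ []) ∷
  (11 ∷ 7 ∷ 3 ∷ 25 ∷ 4 ∷ 5 ∷ 1 ∷ 54 ∷ 55 ∷ 1 ∷ 0 ∷ 55 ∷ 6 ∷ 1 ∷ 4 ∷ 12 ∷ 1 ∷ 0 ∷ 49 ∷ 3 ∷ 0 ∷ 4
   ∷ 3 ∷ 7 ∷ 54 ∷ 4 ∷ 49 ∷ 0 ∷ 0 ∷ 49 ∷ 0 ∷ 49 ∷ 49 ∷ 1 ∷ 0 ∷ 3 ∷ 0 ∷ 1 ∷ []) ∷
  (0 ∷ 3 ∷ 4 ∷ 6 ∷ 7 ∷ 25 ∷ 2 ∷ 55 ∷ 19 ∷ 2 ∷ 1 ∷ 49 ∷ 5 ∷ 2 ∷ 7 ∷ 2 ∷ 2 ∷ 1 ∷ 52 ∷ 8 ∷ 1 ∷ 7 ∷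
   8 ∷ 3 ∷ 55 ∷ 7 ∷ 54 ∷ 1 ∷ 1 ∷ 54 ∷ 1 ∷ 54 ∷ 57 ∷ 2 ∷ 1 ∷ 4 ∷ 1 ∷ 2 ∷ []) ∷
  (20 ∷ 19 ∷ 54 ∷ 0 ∷ 55 ∷ 2 ∷ 7 ∷ 2 ∷ 0 ∷ 7 ∷ 4 ∷ 0 ∷ 1 ∷ 7 ∷ 55 ∷ 7 ∷ 7 ∷ 4 ∷ 1 ∷ 54 ∷ 4 ∷ 55
   ∷ 54 ∷ 49 ∷ 2 ∷ 55 ∷ 1 ∷ 4 ∷ 4 ∷ 1 ∷ 4 ∷ 1 ∷ 1 ∷ 7 ∷ 4 ∷ 54 ∷ 4 ∷ 7 ∷ []) ∷
  (3 ∷ 49 ∷ 54 ∷ 0 ∷ 55 ∷ 2 ∷ 7 ∷ 2 ∷ 0 ∷ 7 ∷ 4 ∷ 0 ∷ 1 ∷ 7 ∷ 55 ∷ 7 ∷ 7 ∷ 4 ∷ 1 ∷ 54 ∷ 4 ∷ 55 ∷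
   54 ∷ 49 ∷ 2 ∷ 55 ∷ 1 ∷ 4 ∷ 4 ∷ 1 ∷ 4 ∷ 1 ∷ 1 ∷ 7 ∷ 4 ∷ 54 ∷ 4 ∷ 7 ∷ []) ∷
  (8 ∷ 54 ∷ 55 ∷ 31 ∷ 49 ∷ 0 ∷ 3 ∷ 0 ∷ 1 ∷ 3 ∷ 7 ∷ 1 ∷ 2 ∷ 3 ∷ 49 ∷ 3 ∷ 3 ∷ 7 ∷ 2 ∷ 55 ∷ 7 ∷ 49
   ∷ 55 ∷ 54 ∷ 0 ∷ 49 ∷ 2 ∷ 7 ∷ 7 ∷ 2 ∷ 7 ∷ 2 ∷ 2 ∷ 3 ∷ 7 ∷ 55 ∷ 7 ∷ 3 ∷ []) ∷
  (54 ∷ 1 ∷ 2 ∷ 8 ∷ 0 ∷ 3 ∷ 19 ∷ 3 ∷ 4 ∷ 49 ∷ 55 ∷ 4 ∷ 7 ∷ 49 ∷ 0 ∷ 49 ∷ 49 ∷ 55 ∷ 7 ∷ 2 ∷ 55 ∷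
   0 ∷ 2 ∷ 1 ∷ 3 ∷ 0 ∷ 7 ∷ 55 ∷ 55 ∷ 7 ∷ 55 ∷ 7 ∷ 7 ∷ 49 ∷ 58 ∷ 2 ∷ 55 ∷ 49 ∷ []) ∷
  (8 ∷ 54 ∷ 55 ∷ 1 ∷ 49 ∷ 0 ∷ 3 ∷ 0 ∷ 1 ∷ 3 ∷ 7 ∷ 1 ∷ 2 ∷ 3 ∷ 49 ∷ 3 ∷ 3 ∷ 7 ∷ 2 ∷ 55 ∷ 7 ∷ 49 ∷
   55 ∷ 54 ∷ 0 ∷ 49 ∷ 2 ∷ 7 ∷ 7 ∷ 2 ∷ 7 ∷ 2 ∷ 2 ∷ 3 ∷ 7 ∷ 55 ∷ 7 ∷ 3 ∷ []) ∷
  (0 ∷ 3 ∷ 4 ∷ 6 ∷ 7 ∷ 55 ∷ 2 ∷ 55 ∷ 49 ∷ 2 ∷ 1 ∷ 49 ∷ 54 ∷ 2 ∷ 7 ∷ 2 ∷ 2 ∷ 1 ∷ 54 ∷ 4 ∷ 1 ∷ 7 ∷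
   4 ∷ 3 ∷ 55 ∷ 7 ∷ 54 ∷ 1 ∷ 1 ∷ 54 ∷ 1 ∷ 54 ∷ 54 ∷ 2 ∷ 1 ∷ 4 ∷ 1 ∷ 2 ∷ []) ∷
  (2 ∷ 16 ∷ 3 ∷ 55 ∷ 4 ∷ 46 ∷ 1 ∷ 54 ∷ 55 ∷ 1 ∷ 0 ∷ 55 ∷ 49 ∷ 1 ∷ 4 ∷ 1 ∷ 1 ∷ 0 ∷ 49 ∷ 3 ∷ 0 ∷ 4
   ∷ 3 ∷ 7 ∷ 54 ∷ 4 ∷ 49 ∷ 0 ∷ 0 ∷ 49 ∷ 0 ∷ 49 ∷ 49 ∷ 1 ∷ 0 ∷ 3 ∷ 0 ∷ 1 ∷ []) ∷
  (47 ∷ 9 ∷ 40 ∷ 48 ∷ 12 ∷ 4 ∷ 54 ∷ 4 ∷ 7 ∷ 54 ∷ 49 ∷ 7 ∷ 3 ∷ 54 ∷ 1 ∷ 54 ∷ 54 ∷ 49 ∷ 3 ∷ 0 ∷ 49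
   ∷ 1 ∷ 0 ∷ 2 ∷ 4 ∷ 1 ∷ 3 ∷ 49 ∷ 49 ∷ 3 ∷ 49 ∷ 3 ∷ 3 ∷ 54 ∷ 49 ∷ 0 ∷ 49 ∷ 54 ∷ []) ∷
  (32 ∷ 7 ∷ 3 ∷ 55 ∷ 4 ∷ 54 ∷ 1 ∷ 54 ∷ 55 ∷ 1 ∷ 0 ∷ 55 ∷ 49 ∷ 1 ∷ 4 ∷ 1 ∷ 39 ∷ 0 ∷ 49 ∷ 3 ∷ 0 ∷
   4 ∷ 3 ∷ 7 ∷ 54 ∷ 4 ∷ 49 ∷ 0 ∷ 0 ∷ 49 ∷ 0 ∷ 49 ∷ 49 ∷ 1 ∷ 0 ∷ 3 ∷ 0 ∷ 1 ∷ []) ∷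
  (49 ∷ 0 ∷ 1 ∷ 61 ∷ 2 ∷ 53 ∷ 55 ∷ 7 ∷ 3 ∷ 55 ∷ 54 ∷ 3 ∷ 42 ∷ 55 ∷ 2 ∷ 55 ∷ 55 ∷ 54 ∷ 4 ∷ 1 ∷ 54
   ∷ 2 ∷ 1 ∷ 0 ∷ 7 ∷ 2 ∷ 4 ∷ 54 ∷ 54 ∷ 4 ∷ 54 ∷ 4 ∷ 4 ∷ 55 ∷ 54 ∷ 1 ∷ 54 ∷ 55 ∷ []) ∷
  (43 ∷ 55 ∷ 49 ∷ 2 ∷ 54 ∷ 39 ∷ 4 ∷ 1 ∷ 2 ∷ 4 ∷ 3 ∷ 2 ∷ 0 ∷ 4 ∷ 54 ∷ 4 ∷ 4 ∷ 3 ∷ 0 ∷ 49 ∷ 3 ∷ 54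
   ∷ 49 ∷ 55 ∷ 1 ∷ 54 ∷ 0 ∷ 3 ∷ 3 ∷ 0 ∷ 3 ∷ 0 ∷ 0 ∷ 4 ∷ 3 ∷ 49 ∷ 3 ∷ 4 ∷ []) ∷
  (0 ∷ 20 ∷ 4 ∷ 49 ∷ 7 ∷ 55 ∷ 2 ∷ 55 ∷ 49 ∷ 2 ∷ 1 ∷ 49 ∷ 54 ∷ 2 ∷ 7 ∷ 2 ∷ 2 ∷ 1 ∷ 54 ∷ 4 ∷ 1 ∷ 7
   ∷ 4 ∷ 3 ∷ 55 ∷ 7 ∷ 54 ∷ 1 ∷ 1 ∷ 54 ∷ 1 ∷ 54 ∷ 54 ∷ 2 ∷ 1 ∷ 4 ∷ 1 ∷ 2 ∷ []) ∷
  (35 ∷ 1 ∷ 2 ∷ 4 ∷ 0 ∷ 3 ∷ 49 ∷ 3 ∷ 4 ∷ 49 ∷ 55 ∷ 8 ∷ 7 ∷ 49 ∷ 0 ∷ 49 ∷ 49 ∷ 55 ∷ 7 ∷ 2 ∷ 55 ∷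
   0 ∷ 2 ∷ 1 ∷ 3 ∷ 0 ∷ 7 ∷ 55 ∷ 55 ∷ 7 ∷ 55 ∷ 17 ∷ 7 ∷ 49 ∷ 55 ∷ 2 ∷ 55 ∷ 49 ∷ []) ∷
  (49 ∷ 0 ∷ 1 ∷ 3 ∷ 2 ∷ 7 ∷ 55 ∷ 7 ∷ 3 ∷ 55 ∷ 54 ∷ 3 ∷ 4 ∷ 55 ∷ 2 ∷ 55 ∷ 55 ∷ 54 ∷ 4 ∷ 1 ∷ 54 ∷
   2 ∷ 1 ∷ 0 ∷ 7 ∷ 2 ∷ 4 ∷ 54 ∷ 54 ∷ 4 ∷ 54 ∷ 4 ∷ 4 ∷ 55 ∷ 54 ∷ 1 ∷ 54 ∷ 55 ∷ []) ∷
  (43 ∷ 55 ∷ 49 ∷ 2 ∷ 54 ∷ 1 ∷ 4 ∷ 1 ∷ 2 ∷ 4 ∷ 3 ∷ 2 ∷ 0 ∷ 4 ∷ 54 ∷ 4 ∷ 4 ∷ 3 ∷ 0 ∷ 49 ∷ 3 ∷ 54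
   ∷ 49 ∷ 55 ∷ 1 ∷ 54 ∷ 0 ∷ 3 ∷ 3 ∷ 0 ∷ 3 ∷ 0 ∷ 0 ∷ 4 ∷ 3 ∷ 49 ∷ 3 ∷ 4 ∷ []) ∷
  (27 ∷ 16 ∷ 3 ∷ 58 ∷ 4 ∷ 54 ∷ 1 ∷ 54 ∷ 55 ∷ 1 ∷ 0 ∷ 55 ∷ 49 ∷ 1 ∷ 4 ∷ 1 ∷ 1 ∷ 0 ∷ 49 ∷ 3 ∷ 0 ∷
   4 ∷ 3 ∷ 7 ∷ 54 ∷ 4 ∷ 49 ∷ 0 ∷ 0 ∷ 49 ∷ 0 ∷ 49 ∷ 49 ∷ 1 ∷ 0 ∷ 3 ∷ 0 ∷ 1 ∷ []) ∷
  (0 ∷ 3 ∷ 4 ∷ 49 ∷ 7 ∷ 55 ∷ 2 ∷ 55 ∷ 49 ∷ 2 ∷ 1 ∷ 49 ∷ 54 ∷ 2 ∷ 7 ∷ 2 ∷ 2 ∷ 1 ∷ 54 ∷ 4 ∷ 1 ∷ 7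
   ∷ 4 ∷ 3 ∷ 55 ∷ 7 ∷ 54 ∷ 1 ∷ 1 ∷ 54 ∷ 1 ∷ 54 ∷ 54 ∷ 2 ∷ 39 ∷ 4 ∷ 39 ∷ 2 ∷ []) ∷
  (55 ∷ 2 ∷ 0 ∷ 7 ∷ 1 ∷ 4 ∷ 54 ∷ 8 ∷ 7 ∷ 54 ∷ 49 ∷ 7 ∷ 3 ∷ 54 ∷ 1 ∷ 54 ∷ 54 ∷ 49 ∷ 3 ∷ 0 ∷ 49 ∷
   1 ∷ 0 ∷ 2 ∷ 4 ∷ 1 ∷ 3 ∷ 49 ∷ 49 ∷ 3 ∷ 49 ∷ 3 ∷ 3 ∷ 54 ∷ 49 ∷ 0 ∷ 49 ∷ 54 ∷ []) ∷
  (27 ∷ 16 ∷ 3 ∷ 55 ∷ 4 ∷ 54 ∷ 1 ∷ 54 ∷ 55 ∷ 1 ∷ 0 ∷ 55 ∷ 49 ∷ 1 ∷ 4 ∷ 1 ∷ 1 ∷ 0 ∷ 49 ∷ 3 ∷ 0 ∷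
   4 ∷ 3 ∷ 7 ∷ 54 ∷ 4 ∷ 49 ∷ 0 ∷ 0 ∷ 49 ∷ 0 ∷ 49 ∷ 49 ∷ 1 ∷ 0 ∷ 3 ∷ 0 ∷ 1 ∷ []) ∷
  (55 ∷ 2 ∷ 0 ∷ 7 ∷ 1 ∷ 4 ∷ 54 ∷ 4 ∷ 7 ∷ 54 ∷ 49 ∷ 7 ∷ 3 ∷ 54 ∷ 1 ∷ 54 ∷ 54 ∷ 49 ∷ 3 ∷ 0 ∷ 49 ∷
   1 ∷ 0 ∷ 2 ∷ 4 ∷ 1 ∷ 3 ∷ 49 ∷ 49 ∷ 3 ∷ 49 ∷ 3 ∷ 3 ∷ 54 ∷ 49 ∷ 0 ∷ 49 ∷ 54 ∷ []) ∷
  (8 ∷ 54 ∷ 55 ∷ 1 ∷ 49 ∷ 0 ∷ 3 ∷ 0 ∷ 1 ∷ 3 ∷ 7 ∷ 1 ∷ 2 ∷ 3 ∷ 49 ∷ 3 ∷ 3 ∷ 7 ∷ 2 ∷ 55 ∷ 7 ∷ 49 ∷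
   55 ∷ 54 ∷ 0 ∷ 49 ∷ 2 ∷ 7 ∷ 7 ∷ 2 ∷ 7 ∷ 2 ∷ 2 ∷ 3 ∷ 7 ∷ 55 ∷ 7 ∷ 3 ∷ []) ∷
  (31 ∷ 4 ∷ 7 ∷ 5 ∷ 3 ∷ 6 ∷ 0 ∷ 49 ∷ 54 ∷ 0 ∷ 2 ∷ 54 ∷ 25 ∷ 0 ∷ 3 ∷ 0 ∷ 0 ∷ 2 ∷ 55 ∷ 7 ∷ 2 ∷ 3 ∷
   7 ∷ 4 ∷ 49 ∷ 3 ∷ 55 ∷ 2 ∷ 2 ∷ 55 ∷ 2 ∷ 55 ∷ 55 ∷ 0 ∷ 2 ∷ 7 ∷ 2 ∷ 0 ∷ []) ∷
  (27 ∷ 48 ∷ 3 ∷ 55 ∷ 4 ∷ 54 ∷ 1 ∷ 54 ∷ 55 ∷ 1 ∷ 0 ∷ 55 ∷ 49 ∷ 1 ∷ 4 ∷ 1 ∷ 1 ∷ 0 ∷ 49 ∷ 3 ∷ 0 ∷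
   4 ∷ 3 ∷ 7 ∷ 54 ∷ 4 ∷ 49 ∷ 0 ∷ 0 ∷ 49 ∷ 0 ∷ 49 ∷ 49 ∷ 1 ∷ 0 ∷ 3 ∷ 0 ∷ 1 ∷ []) ∷
  (2 ∷ 16 ∷ 3 ∷ 55 ∷ 8 ∷ 54 ∷ 1 ∷ 54 ∷ 55 ∷ 1 ∷ 0 ∷ 55 ∷ 49 ∷ 1 ∷ 4 ∷ 1 ∷ 1 ∷ 0 ∷ 49 ∷ 3 ∷ 0 ∷ 4
   ∷ 3 ∷ 7 ∷ 54 ∷ 4 ∷ 49 ∷ 0 ∷ 0 ∷ 49 ∷ 0 ∷ 49 ∷ 49 ∷ 1 ∷ 0 ∷ 3 ∷ 0 ∷ 1 ∷ []) ∷
  (31 ∷ 4 ∷ 7 ∷ 54 ∷ 3 ∷ 49 ∷ 0 ∷ 49 ∷ 54 ∷ 0 ∷ 2 ∷ 54 ∷ 55 ∷ 0 ∷ 3 ∷ 0 ∷ 0 ∷ 11 ∷ 55 ∷ 7 ∷ 2 ∷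
   3 ∷ 7 ∷ 4 ∷ 49 ∷ 3 ∷ 55 ∷ 2 ∷ 2 ∷ 55 ∷ 2 ∷ 55 ∷ 55 ∷ 0 ∷ 2 ∷ 7 ∷ 2 ∷ 0 ∷ []) ∷
  (19 ∷ 0 ∷ 1 ∷ 3 ∷ 2 ∷ 7 ∷ 55 ∷ 7 ∷ 3 ∷ 55 ∷ 54 ∷ 3 ∷ 4 ∷ 55 ∷ 2 ∷ 55 ∷ 55 ∷ 46 ∷ 4 ∷ 1 ∷ 54 ∷
   2 ∷ 1 ∷ 0 ∷ 7 ∷ 2 ∷ 4 ∷ 54 ∷ 54 ∷ 4 ∷ 54 ∷ 4 ∷ 4 ∷ 55 ∷ 54 ∷ 1 ∷ 54 ∷ 55 ∷ []) ∷
  (17 ∷ 55 ∷ 49 ∷ 10 ∷ 54 ∷ 14 ∷ 4 ∷ 1 ∷ 2 ∷ 4 ∷ 3 ∷ 2 ∷ 37 ∷ 4 ∷ 54 ∷ 4 ∷ 4 ∷ 3 ∷ 0 ∷ 49 ∷ 3 ∷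
   54 ∷ 49 ∷ 55 ∷ 1 ∷ 54 ∷ 0 ∷ 3 ∷ 3 ∷ 0 ∷ 3 ∷ 0 ∷ 0 ∷ 4 ∷ 3 ∷ 49 ∷ 3 ∷ 4 ∷ []) ∷
  (3 ∷ 49 ∷ 54 ∷ 0 ∷ 41 ∷ 2 ∷ 7 ∷ 2 ∷ 0 ∷ 7 ∷ 4 ∷ 0 ∷ 31 ∷ 7 ∷ 55 ∷ 7 ∷ 7 ∷ 4 ∷ 1 ∷ 54 ∷ 4 ∷ 55
   ∷ 54 ∷ 49 ∷ 2 ∷ 55 ∷ 1 ∷ 4 ∷ 4 ∷ 1 ∷ 4 ∷ 1 ∷ 1 ∷ 7 ∷ 4 ∷ 54 ∷ 4 ∷ 7 ∷ []) ∷
  (49 ∷ 40 ∷ 12 ∷ 18 ∷ 9 ∷ 7 ∷ 55 ∷ 7 ∷ 3 ∷ 55 ∷ 54 ∷ 3 ∷ 4 ∷ 55 ∷ 2 ∷ 58 ∷ 55 ∷ 54 ∷ 4 ∷ 1 ∷ 54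
   ∷ 2 ∷ 1 ∷ 0 ∷ 7 ∷ 2 ∷ 4 ∷ 54 ∷ 54 ∷ 4 ∷ 54 ∷ 4 ∷ 4 ∷ 55 ∷ 54 ∷ 1 ∷ 54 ∷ 55 ∷ []) ∷
  (51 ∷ 9 ∷ 0 ∷ 16 ∷ 1 ∷ 4 ∷ 54 ∷ 4 ∷ 7 ∷ 54 ∷ 49 ∷ 7 ∷ 3 ∷ 54 ∷ 1 ∷ 54 ∷ 54 ∷ 49 ∷ 3 ∷ 0 ∷ 49 ∷
   1 ∷ 0 ∷ 2 ∷ 4 ∷ 1 ∷ 3 ∷ 49 ∷ 49 ∷ 3 ∷ 49 ∷ 3 ∷ 3 ∷ 54 ∷ 49 ∷ 0 ∷ 49 ∷ 54 ∷ []) ∷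
  (55 ∷ 2 ∷ 0 ∷ 7 ∷ 1 ∷ 4 ∷ 54 ∷ 4 ∷ 7 ∷ 54 ∷ 49 ∷ 17 ∷ 3 ∷ 54 ∷ 1 ∷ 54 ∷ 54 ∷ 49 ∷ 3 ∷ 0 ∷ 49 ∷
   1 ∷ 0 ∷ 2 ∷ 4 ∷ 1 ∷ 3 ∷ 49 ∷ 49 ∷ 3 ∷ 49 ∷ 3 ∷ 3 ∷ 54 ∷ 49 ∷ 0 ∷ 49 ∷ 54 ∷ []) ∷
  (49 ∷ 0 ∷ 1 ∷ 3 ∷ 2 ∷ 7 ∷ 55 ∷ 7 ∷ 3 ∷ 55 ∷ 54 ∷ 3 ∷ 4 ∷ 55 ∷ 2 ∷ 55 ∷ 55 ∷ 54 ∷ 4 ∷ 1 ∷ 54 ∷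
   2 ∷ 1 ∷ 0 ∷ 7 ∷ 2 ∷ 4 ∷ 54 ∷ 54 ∷ 4 ∷ 54 ∷ 4 ∷ 4 ∷ 55 ∷ 54 ∷ 1 ∷ 54 ∷ 55 ∷ []) ∷
  (20 ∷ 49 ∷ 54 ∷ 0 ∷ 55 ∷ 2 ∷ 7 ∷ 2 ∷ 0 ∷ 7 ∷ 4 ∷ 0 ∷ 39 ∷ 7 ∷ 55 ∷ 7 ∷ 7 ∷ 4 ∷ 1 ∷ 54 ∷ 4 ∷ 55
   ∷ 54 ∷ 49 ∷ 2 ∷ 55 ∷ 1 ∷ 4 ∷ 4 ∷ 1 ∷ 4 ∷ 1 ∷ 1 ∷ 7 ∷ 4 ∷ 54 ∷ 4 ∷ 7 ∷ []) ∷
  (46 ∷ 1 ∷ 2 ∷ 8 ∷ 0 ∷ 3 ∷ 49 ∷ 3 ∷ 8 ∷ 49 ∷ 55 ∷ 8 ∷ 7 ∷ 49 ∷ 0 ∷ 49 ∷ 49 ∷ 55 ∷ 7 ∷ 2 ∷ 55 ∷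
   0 ∷ 2 ∷ 1 ∷ 3 ∷ 0 ∷ 7 ∷ 55 ∷ 55 ∷ 7 ∷ 55 ∷ 43 ∷ 7 ∷ 49 ∷ 55 ∷ 2 ∷ 55 ∷ 49 ∷ []) ∷
  (0 ∷ 20 ∷ 4 ∷ 49 ∷ 7 ∷ 55 ∷ 2 ∷ 55 ∷ 49 ∷ 2 ∷ 1 ∷ 49 ∷ 54 ∷ 2 ∷ 7 ∷ 2 ∷ 2 ∷ 1 ∷ 54 ∷ 4 ∷ 1 ∷ 7
   ∷ 4 ∷ 3 ∷ 55 ∷ 7 ∷ 54 ∷ 1 ∷ 1 ∷ 54 ∷ 1 ∷ 54 ∷ 54 ∷ 2 ∷ 1 ∷ 4 ∷ 1 ∷ 2 ∷ []) ∷
  (49 ∷ 0 ∷ 1 ∷ 20 ∷ 2 ∷ 7 ∷ 55 ∷ 7 ∷ 3 ∷ 55 ∷ 54 ∷ 3 ∷ 4 ∷ 55 ∷ 2 ∷ 55 ∷ 55 ∷ 54 ∷ 4 ∷ 1 ∷ 54 ∷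
   2 ∷ 1 ∷ 0 ∷ 7 ∷ 2 ∷ 4 ∷ 54 ∷ 54 ∷ 4 ∷ 54 ∷ 4 ∷ 4 ∷ 55 ∷ 54 ∷ 1 ∷ 54 ∷ 55 ∷ []) ∷
  (51 ∷ 2 ∷ 0 ∷ 48 ∷ 1 ∷ 4 ∷ 54 ∷ 4 ∷ 7 ∷ 54 ∷ 49 ∷ 16 ∷ 3 ∷ 54 ∷ 1 ∷ 54 ∷ 54 ∷ 49 ∷ 3 ∷ 0 ∷ 49
   ∷ 1 ∷ 0 ∷ 2 ∷ 4 ∷ 1 ∷ 3 ∷ 49 ∷ 49 ∷ 3 ∷ 49 ∷ 3 ∷ 3 ∷ 54 ∷ 49 ∷ 0 ∷ 49 ∷ 54 ∷ []) ∷
  (18 ∷ 49 ∷ 54 ∷ 37 ∷ 55 ∷ 10 ∷ 7 ∷ 2 ∷ 0 ∷ 7 ∷ 4 ∷ 0 ∷ 14 ∷ 7 ∷ 55 ∷ 7 ∷ 7 ∷ 4 ∷ 1 ∷ 54 ∷ 4 ∷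
   55 ∷ 54 ∷ 49 ∷ 2 ∷ 55 ∷ 1 ∷ 4 ∷ 4 ∷ 1 ∷ 4 ∷ 1 ∷ 1 ∷ 7 ∷ 4 ∷ 54 ∷ 4 ∷ 7 ∷ []) ∷
  (55 ∷ 2 ∷ 0 ∷ 16 ∷ 1 ∷ 26 ∷ 54 ∷ 4 ∷ 7 ∷ 54 ∷ 49 ∷ 17 ∷ 20 ∷ 54 ∷ 1 ∷ 54 ∷ 54 ∷ 49 ∷ 3 ∷ 0 ∷
   49 ∷ 1 ∷ 0 ∷ 2 ∷ 4 ∷ 1 ∷ 3 ∷ 49 ∷ 49 ∷ 3 ∷ 49 ∷ 3 ∷ 3 ∷ 54 ∷ 49 ∷ 0 ∷ 49 ∷ 54 ∷ []) ∷
  (19 ∷ 0 ∷ 1 ∷ 3 ∷ 2 ∷ 7 ∷ 55 ∷ 16 ∷ 3 ∷ 55 ∷ 54 ∷ 3 ∷ 4 ∷ 55 ∷ 2 ∷ 55 ∷ 55 ∷ 54 ∷ 4 ∷ 1 ∷ 54 ∷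
   2 ∷ 1 ∷ 0 ∷ 7 ∷ 2 ∷ 4 ∷ 54 ∷ 54 ∷ 4 ∷ 54 ∷ 4 ∷ 4 ∷ 55 ∷ 54 ∷ 1 ∷ 54 ∷ 55 ∷ []) ∷
  (27 ∷ 16 ∷ 3 ∷ 55 ∷ 4 ∷ 54 ∷ 1 ∷ 54 ∷ 55 ∷ 1 ∷ 0 ∷ 55 ∷ 49 ∷ 1 ∷ 4 ∷ 1 ∷ 1 ∷ 0 ∷ 49 ∷ 3 ∷ 0 ∷
   4 ∷ 3 ∷ 7 ∷ 54 ∷ 4 ∷ 49 ∷ 0 ∷ 0 ∷ 49 ∷ 0 ∷ 49 ∷ 49 ∷ 1 ∷ 0 ∷ 3 ∷ 0 ∷ 1 ∷ []) ∷
  (29 ∷ 50 ∷ 0 ∷ 17 ∷ 38 ∷ 4 ∷ 46 ∷ 4 ∷ 7 ∷ 54 ∷ 49 ∷ 7 ∷ 3 ∷ 54 ∷ 1 ∷ 54 ∷ 46 ∷ 49 ∷ 20 ∷ 0 ∷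
   49 ∷ 1 ∷ 0 ∷ 2 ∷ 4 ∷ 1 ∷ 3 ∷ 49 ∷ 49 ∷ 3 ∷ 49 ∷ 3 ∷ 3 ∷ 54 ∷ 49 ∷ 0 ∷ 49 ∷ 54 ∷ []) ∷
  (19 ∷ 0 ∷ 1 ∷ 3 ∷ 2 ∷ 7 ∷ 55 ∷ 16 ∷ 3 ∷ 55 ∷ 54 ∷ 3 ∷ 4 ∷ 55 ∷ 2 ∷ 55 ∷ 55 ∷ 54 ∷ 4 ∷ 1 ∷ 54 ∷
   2 ∷ 1 ∷ 0 ∷ 7 ∷ 2 ∷ 4 ∷ 54 ∷ 54 ∷ 4 ∷ 54 ∷ 4 ∷ 4 ∷ 55 ∷ 54 ∷ 1 ∷ 54 ∷ 55 ∷ []) ∷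
  (54 ∷ 12 ∷ 9 ∷ 4 ∷ 40 ∷ 3 ∷ 49 ∷ 3 ∷ 4 ∷ 49 ∷ 55 ∷ 4 ∷ 7 ∷ 49 ∷ 0 ∷ 49 ∷ 49 ∷ 55 ∷ 7 ∷ 2 ∷ 55
   ∷ 0 ∷ 2 ∷ 1 ∷ 3 ∷ 0 ∷ 7 ∷ 55 ∷ 55 ∷ 7 ∷ 55 ∷ 7 ∷ 7 ∷ 49 ∷ 55 ∷ 2 ∷ 55 ∷ 49 ∷ []) ∷
  (19 ∷ 0 ∷ 1 ∷ 3 ∷ 2 ∷ 7 ∷ 55 ∷ 7 ∷ 3 ∷ 55 ∷ 54 ∷ 3 ∷ 4 ∷ 55 ∷ 2 ∷ 55 ∷ 55 ∷ 54 ∷ 4 ∷ 1 ∷ 54 ∷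
   2 ∷ 1 ∷ 0 ∷ 7 ∷ 2 ∷ 4 ∷ 54 ∷ 54 ∷ 4 ∷ 54 ∷ 4 ∷ 4 ∷ 55 ∷ 54 ∷ 1 ∷ 54 ∷ 55 ∷ []) ∷
  (30 ∷ 54 ∷ 55 ∷ 14 ∷ 49 ∷ 37 ∷ 3 ∷ 0 ∷ 1 ∷ 20 ∷ 7 ∷ 1 ∷ 10 ∷ 3 ∷ 49 ∷ 3 ∷ 3 ∷ 7 ∷ 2 ∷ 55 ∷ 7 ∷
   49 ∷ 55 ∷ 54 ∷ 0 ∷ 49 ∷ 2 ∷ 7 ∷ 7 ∷ 2 ∷ 7 ∷ 2 ∷ 2 ∷ 3 ∷ 7 ∷ 55 ∷ 7 ∷ 3 ∷ []) ∷
  []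

hang₃ : List (List ℕ)
hang₃ =
  (1 ∷ 2 ∷ 4 ∷ 8 ∷ 0 ∷ 3 ∷ 29 ∷ 18 ∷ 4 ∷ 19 ∷ 22 ∷ 37 ∷ 12 ∷ 21 ∷ 2 ∷ 30 ∷ 30 ∷ 9 ∷ 26 ∷ 20 ∷ 11
   ∷ 7 ∷ 16 ∷ 28 ∷ 35 ∷ 33 ∷ 20 ∷ 15 ∷ 17 ∷ 7 ∷ []) ∷
  (3 ∷ 12 ∷ 5 ∷ 0 ∷ 1 ∷ 0 ∷ 36 ∷ 27 ∷ 5 ∷ 18 ∷ 18 ∷ 21 ∷ 10 ∷ 7 ∷ 12 ∷ 19 ∷ 19 ∷ 14 ∷ 10 ∷ 19 ∷
   0 ∷ 9 ∷ 4 ∷ 2 ∷ 29 ∷ 14 ∷ 19 ∷ 14 ∷ 2 ∷ 9 ∷ []) ∷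
  (12 ∷ 5 ∷ 3 ∷ 17 ∷ 2 ∷ 10 ∷ 13 ∷ 6 ∷ 3 ∷ 7 ∷ 7 ∷ 1 ∷ 6 ∷ 11 ∷ 5 ∷ 4 ∷ 4 ∷ 1 ∷ 9 ∷ 4 ∷ 10 ∷ 0 ∷
   1 ∷ 4 ∷ 24 ∷ 23 ∷ 4 ∷ 1 ∷ 4 ∷ 0 ∷ []) ∷
  (0 ∷ 10 ∷ 6 ∷ 1 ∷ 3 ∷ 1 ∷ 35 ∷ 19 ∷ 6 ∷ 27 ∷ 27 ∷ 7 ∷ 2 ∷ 9 ∷ 10 ∷ 18 ∷ 18 ∷ 7 ∷ 2 ∷ 18 ∷ 1 ∷
   14 ∷ 5 ∷ 12 ∷ 36 ∷ 7 ∷ 18 ∷ 7 ∷ 12 ∷ 14 ∷ []) ∷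
  (5 ∷ 3 ∷ 12 ∷ 13 ∷ 4 ∷ 6 ∷ 0 ∷ 0 ∷ 32 ∷ 3 ∷ 8 ∷ 2 ∷ 0 ∷ 26 ∷ 3 ∷ 1 ∷ 1 ∷ 2 ∷ 0 ∷ 23 ∷ 9 ∷ 28 ∷
   2 ∷ 23 ∷ 11 ∷ 2 ∷ 23 ∷ 35 ∷ 1 ∷ 36 ∷ []) ∷
  (6 ∷ 0 ∷ 10 ∷ 4 ∷ 5 ∷ 4 ∷ 23 ∷ 1 ∷ 10 ∷ 0 ∷ 0 ∷ 12 ∷ 1 ∷ 10 ∷ 0 ∷ 3 ∷ 3 ∷ 26 ∷ 1 ∷ 8 ∷ 4 ∷ 22
   ∷ 32 ∷ 8 ∷ 0 ∷ 18 ∷ 3 ∷ 29 ∷ 3 ∷ 2 ∷ []) ∷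
  (4 ∷ 1 ∷ 2 ∷ 7 ∷ 6 ∷ 5 ∷ 8 ∷ 8 ∷ 2 ∷ 1 ∷ 1 ∷ 28 ∷ 3 ∷ 19 ∷ 1 ∷ 0 ∷ 0 ∷ 20 ∷ 3 ∷ 0 ∷ 5 ∷ 29 ∷
   17 ∷ 0 ∷ 1 ∷ 17 ∷ 0 ∷ 36 ∷ 0 ∷ 18 ∷ []) ∷
  (9 ∷ 0 ∷ 17 ∷ 4 ∷ 7 ∷ 14 ∷ 1 ∷ 1 ∷ 17 ∷ 0 ∷ 0 ∷ 18 ∷ 1 ∷ 10 ∷ 0 ∷ 8 ∷ 8 ∷ 18 ∷ 1 ∷ 8 ∷ 4 ∷ 2 ∷
   18 ∷ 11 ∷ 0 ∷ 18 ∷ 8 ∷ 18 ∷ 11 ∷ 19 ∷ []) ∷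
  (0 ∷ 17 ∷ 13 ∷ 1 ∷ 8 ∷ 1 ∷ 2 ∷ 2 ∷ 6 ∷ 27 ∷ 10 ∷ 7 ∷ 2 ∷ 9 ∷ 17 ∷ 18 ∷ 18 ∷ 7 ∷ 2 ∷ 26 ∷ 1 ∷ 4
   ∷ 7 ∷ 26 ∷ 10 ∷ 7 ∷ 26 ∷ 5 ∷ 31 ∷ 4 ∷ []) ∷
  (14 ∷ 1 ∷ 2 ∷ 7 ∷ 9 ∷ 7 ∷ 3 ∷ 3 ∷ 2 ∷ 1 ∷ 23 ∷ 20 ∷ 3 ∷ 2 ∷ 1 ∷ 0 ∷ 0 ∷ 17 ∷ 3 ∷ 0 ∷ 7 ∷ 26 ∷
   17 ∷ 0 ∷ 1 ∷ 34 ∷ 0 ∷ 27 ∷ 0 ∷ 18 ∷ []) ∷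
  (2 ∷ 4 ∷ 1 ∷ 29 ∷ 10 ∷ 12 ∷ 7 ∷ 5 ∷ 1 ∷ 4 ∷ 4 ∷ 0 ∷ 5 ∷ 1 ∷ 4 ∷ 6 ∷ 6 ∷ 0 ∷ 24 ∷ 13 ∷ 26 ∷ 8 ∷
   0 ∷ 6 ∷ 4 ∷ 0 ∷ 6 ∷ 0 ∷ 6 ∷ 8 ∷ []) ∷
  (0 ∷ 10 ∷ 9 ∷ 1 ∷ 11 ∷ 1 ∷ 2 ∷ 2 ∷ 6 ∷ 10 ∷ 10 ∷ 5 ∷ 2 ∷ 37 ∷ 10 ∷ 12 ∷ 12 ∷ 5 ∷ 2 ∷ 26 ∷ 23 ∷
   25 ∷ 5 ∷ 26 ∷ 28 ∷ 5 ∷ 12 ∷ 7 ∷ 12 ∷ 25 ∷ []) ∷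
  (10 ∷ 6 ∷ 0 ∷ 2 ∷ 12 ∷ 2 ∷ 4 ∷ 4 ∷ 0 ∷ 6 ∷ 6 ∷ 3 ∷ 4 ∷ 0 ∷ 6 ∷ 5 ∷ 5 ∷ 3 ∷ 4 ∷ 5 ∷ 2 ∷ 1 ∷ 3 ∷
   5 ∷ 9 ∷ 3 ∷ 5 ∷ 3 ∷ 5 ∷ 23 ∷ []) ∷
  (25 ∷ 1 ∷ 2 ∷ 5 ∷ 13 ∷ 7 ∷ 8 ∷ 3 ∷ 2 ∷ 23 ∷ 1 ∷ 17 ∷ 3 ∷ 2 ∷ 1 ∷ 0 ∷ 0 ∷ 36 ∷ 8 ∷ 0 ∷ 7 ∷ 18 ∷
   36 ∷ 0 ∷ 1 ∷ 10 ∷ 0 ∷ 10 ∷ 0 ∷ 12 ∷ []) ∷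
  (7 ∷ 3 ∷ 18 ∷ 9 ∷ 14 ∷ 9 ∷ 0 ∷ 0 ∷ 18 ∷ 3 ∷ 3 ∷ 19 ∷ 0 ∷ 12 ∷ 3 ∷ 1 ∷ 1 ∷ 2 ∷ 0 ∷ 1 ∷ 6 ∷ 28 ∷
   2 ∷ 1 ∷ 3 ∷ 2 ∷ 1 ∷ 19 ∷ 1 ∷ 27 ∷ []) ∷
  (14 ∷ 1 ∷ 2 ∷ 7 ∷ 15 ∷ 7 ∷ 8 ∷ 3 ∷ 2 ∷ 1 ∷ 23 ∷ 17 ∷ 3 ∷ 2 ∷ 1 ∷ 0 ∷ 0 ∷ 10 ∷ 8 ∷ 0 ∷ 7 ∷ 26 ∷
   10 ∷ 0 ∷ 1 ∷ 34 ∷ 0 ∷ 30 ∷ 0 ∷ 18 ∷ []) ∷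
  (4 ∷ 1 ∷ 2 ∷ 7 ∷ 16 ∷ 5 ∷ 3 ∷ 3 ∷ 2 ∷ 1 ∷ 1 ∷ 17 ∷ 3 ∷ 2 ∷ 1 ∷ 0 ∷ 0 ∷ 20 ∷ 3 ∷ 0 ∷ 5 ∷ 18 ∷
   17 ∷ 0 ∷ 1 ∷ 17 ∷ 0 ∷ 17 ∷ 0 ∷ 18 ∷ []) ∷
  (2 ∷ 4 ∷ 1 ∷ 31 ∷ 17 ∷ 12 ∷ 7 ∷ 5 ∷ 1 ∷ 4 ∷ 4 ∷ 0 ∷ 5 ∷ 1 ∷ 4 ∷ 6 ∷ 6 ∷ 0 ∷ 5 ∷ 6 ∷ 26 ∷ 11 ∷
   0 ∷ 6 ∷ 4 ∷ 0 ∷ 13 ∷ 0 ∷ 16 ∷ 11 ∷ []) ∷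
  (27 ∷ 15 ∷ 0 ∷ 2 ∷ 18 ∷ 19 ∷ 4 ∷ 4 ∷ 0 ∷ 6 ∷ 6 ∷ 3 ∷ 4 ∷ 0 ∷ 13 ∷ 7 ∷ 7 ∷ 11 ∷ 4 ∷ 5 ∷ 2 ∷ 1 ∷
   3 ∷ 5 ∷ 6 ∷ 3 ∷ 5 ∷ 3 ∷ 7 ∷ 1 ∷ []) ∷
  (18 ∷ 7 ∷ 3 ∷ 20 ∷ 19 ∷ 27 ∷ 6 ∷ 13 ∷ 3 ∷ 7 ∷ 7 ∷ 1 ∷ 6 ∷ 3 ∷ 7 ∷ 4 ∷ 4 ∷ 1 ∷ 9 ∷ 4 ∷ 10 ∷ 0 ∷
   1 ∷ 4 ∷ 5 ∷ 1 ∷ 4 ∷ 1 ∷ 4 ∷ 0 ∷ []) ∷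
  (19 ∷ 4 ∷ 1 ∷ 18 ∷ 20 ∷ 18 ∷ 5 ∷ 5 ∷ 1 ∷ 4 ∷ 4 ∷ 0 ∷ 5 ∷ 1 ∷ 4 ∷ 13 ∷ 13 ∷ 0 ∷ 5 ∷ 6 ∷ 26 ∷ 8
   ∷ 0 ∷ 6 ∷ 4 ∷ 0 ∷ 6 ∷ 0 ∷ 6 ∷ 8 ∷ []) ∷
  (7 ∷ 11 ∷ 26 ∷ 9 ∷ 21 ∷ 9 ∷ 0 ∷ 0 ∷ 26 ∷ 8 ∷ 8 ∷ 2 ∷ 0 ∷ 26 ∷ 8 ∷ 1 ∷ 1 ∷ 2 ∷ 0 ∷ 1 ∷ 6 ∷ 10 ∷
   2 ∷ 1 ∷ 3 ∷ 2 ∷ 1 ∷ 2 ∷ 1 ∷ 10 ∷ []) ∷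
  (18 ∷ 7 ∷ 8 ∷ 10 ∷ 22 ∷ 27 ∷ 6 ∷ 16 ∷ 3 ∷ 7 ∷ 5 ∷ 1 ∷ 6 ∷ 3 ∷ 7 ∷ 4 ∷ 4 ∷ 1 ∷ 9 ∷ 4 ∷ 10 ∷ 0 ∷
   1 ∷ 4 ∷ 5 ∷ 1 ∷ 4 ∷ 1 ∷ 4 ∷ 0 ∷ []) ∷
  (3 ∷ 18 ∷ 7 ∷ 0 ∷ 23 ∷ 0 ∷ 10 ∷ 17 ∷ 7 ∷ 26 ∷ 18 ∷ 14 ∷ 20 ∷ 7 ∷ 18 ∷ 2 ∷ 2 ∷ 4 ∷ 10 ∷ 2 ∷ 0 ∷
   6 ∷ 4 ∷ 2 ∷ 12 ∷ 4 ∷ 2 ∷ 4 ∷ 2 ∷ 6 ∷ []) ∷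
  (9 ∷ 0 ∷ 36 ∷ 4 ∷ 24 ∷ 14 ∷ 1 ∷ 1 ∷ 20 ∷ 0 ∷ 0 ∷ 12 ∷ 23 ∷ 20 ∷ 0 ∷ 3 ∷ 3 ∷ 12 ∷ 1 ∷ 3 ∷ 4 ∷ 2
   ∷ 18 ∷ 3 ∷ 0 ∷ 18 ∷ 8 ∷ 18 ∷ 8 ∷ 19 ∷ []) ∷
  (7 ∷ 3 ∷ 26 ∷ 9 ∷ 25 ∷ 9 ∷ 0 ∷ 0 ∷ 26 ∷ 3 ∷ 3 ∷ 2 ∷ 0 ∷ 26 ∷ 3 ∷ 1 ∷ 1 ∷ 2 ∷ 0 ∷ 1 ∷ 6 ∷ 10 ∷
   2 ∷ 1 ∷ 3 ∷ 2 ∷ 1 ∷ 2 ∷ 1 ∷ 10 ∷ []) ∷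
  (10 ∷ 9 ∷ 0 ∷ 2 ∷ 26 ∷ 2 ∷ 4 ∷ 4 ∷ 0 ∷ 9 ∷ 9 ∷ 3 ∷ 4 ∷ 0 ∷ 6 ∷ 7 ∷ 7 ∷ 3 ∷ 4 ∷ 5 ∷ 2 ∷ 1 ∷ 3 ∷
   5 ∷ 37 ∷ 3 ∷ 5 ∷ 8 ∷ 7 ∷ 1 ∷ []) ∷
  (19 ∷ 4 ∷ 1 ∷ 18 ∷ 27 ∷ 18 ∷ 5 ∷ 7 ∷ 1 ∷ 4 ∷ 4 ∷ 0 ∷ 5 ∷ 1 ∷ 4 ∷ 13 ∷ 13 ∷ 0 ∷ 5 ∷ 6 ∷ 18 ∷ 8
   ∷ 0 ∷ 6 ∷ 4 ∷ 0 ∷ 16 ∷ 0 ∷ 6 ∷ 8 ∷ []) ∷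
  (2 ∷ 4 ∷ 1 ∷ 26 ∷ 28 ∷ 12 ∷ 7 ∷ 5 ∷ 1 ∷ 4 ∷ 4 ∷ 0 ∷ 5 ∷ 1 ∷ 4 ∷ 6 ∷ 6 ∷ 0 ∷ 5 ∷ 6 ∷ 12 ∷ 11 ∷
   0 ∷ 6 ∷ 4 ∷ 0 ∷ 6 ∷ 0 ∷ 6 ∷ 11 ∷ []) ∷
  (36 ∷ 13 ∷ 0 ∷ 2 ∷ 29 ∷ 35 ∷ 4 ∷ 4 ∷ 0 ∷ 6 ∷ 6 ∷ 3 ∷ 4 ∷ 0 ∷ 13 ∷ 5 ∷ 5 ∷ 3 ∷ 4 ∷ 5 ∷ 2 ∷ 1 ∷
   3 ∷ 7 ∷ 6 ∷ 3 ∷ 5 ∷ 8 ∷ 5 ∷ 1 ∷ []) ∷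
  (19 ∷ 4 ∷ 1 ∷ 18 ∷ 30 ∷ 18 ∷ 5 ∷ 7 ∷ 1 ∷ 4 ∷ 4 ∷ 0 ∷ 5 ∷ 1 ∷ 4 ∷ 13 ∷ 13 ∷ 0 ∷ 5 ∷ 6 ∷ 18 ∷ 8
   ∷ 0 ∷ 6 ∷ 4 ∷ 0 ∷ 16 ∷ 0 ∷ 6 ∷ 8 ∷ []) ∷
  (34 ∷ 6 ∷ 0 ∷ 2 ∷ 31 ∷ 2 ∷ 4 ∷ 21 ∷ 0 ∷ 13 ∷ 9 ∷ 8 ∷ 4 ∷ 0 ∷ 6 ∷ 5 ∷ 5 ∷ 3 ∷ 4 ∷ 7 ∷ 2 ∷ 1 ∷ 3
   ∷ 5 ∷ 37 ∷ 3 ∷ 7 ∷ 3 ∷ 5 ∷ 1 ∷ []) ∷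
  (27 ∷ 9 ∷ 0 ∷ 2 ∷ 32 ∷ 19 ∷ 4 ∷ 4 ∷ 0 ∷ 6 ∷ 6 ∷ 3 ∷ 4 ∷ 0 ∷ 13 ∷ 5 ∷ 5 ∷ 3 ∷ 4 ∷ 5 ∷ 19 ∷ 1 ∷
   3 ∷ 5 ∷ 6 ∷ 3 ∷ 5 ∷ 11 ∷ 5 ∷ 1 ∷ []) ∷
  (14 ∷ 1 ∷ 2 ∷ 7 ∷ 33 ∷ 7 ∷ 3 ∷ 3 ∷ 2 ∷ 23 ∷ 1 ∷ 20 ∷ 3 ∷ 2 ∷ 1 ∷ 0 ∷ 0 ∷ 34 ∷ 3 ∷ 0 ∷ 7 ∷ 18 ∷
   34 ∷ 0 ∷ 1 ∷ 17 ∷ 0 ∷ 10 ∷ 0 ∷ 18 ∷ []) ∷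
  (2 ∷ 4 ∷ 1 ∷ 29 ∷ 34 ∷ 12 ∷ 5 ∷ 5 ∷ 1 ∷ 4 ∷ 4 ∷ 0 ∷ 24 ∷ 1 ∷ 4 ∷ 6 ∷ 6 ∷ 0 ∷ 5 ∷ 13 ∷ 12 ∷ 8 ∷
   0 ∷ 6 ∷ 4 ∷ 0 ∷ 13 ∷ 0 ∷ 6 ∷ 8 ∷ []) ∷
  (29 ∷ 7 ∷ 8 ∷ 17 ∷ 35 ∷ 36 ∷ 6 ∷ 6 ∷ 8 ∷ 7 ∷ 7 ∷ 1 ∷ 9 ∷ 8 ∷ 7 ∷ 4 ∷ 4 ∷ 1 ∷ 6 ∷ 4 ∷ 17 ∷ 0 ∷
   1 ∷ 4 ∷ 7 ∷ 1 ∷ 4 ∷ 1 ∷ 4 ∷ 0 ∷ []) ∷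
  (35 ∷ 4 ∷ 1 ∷ 26 ∷ 36 ∷ 29 ∷ 7 ∷ 5 ∷ 1 ∷ 4 ∷ 4 ∷ 0 ∷ 24 ∷ 1 ∷ 4 ∷ 6 ∷ 6 ∷ 0 ∷ 5 ∷ 6 ∷ 12 ∷ 11
   ∷ 0 ∷ 6 ∷ 4 ∷ 0 ∷ 6 ∷ 0 ∷ 6 ∷ 8 ∷ []) ∷
  (21 ∷ 1 ∷ 2 ∷ 7 ∷ 37 ∷ 7 ∷ 3 ∷ 3 ∷ 2 ∷ 1 ∷ 1 ∷ 20 ∷ 3 ∷ 2 ∷ 1 ∷ 0 ∷ 0 ∷ 20 ∷ 3 ∷ 0 ∷ 5 ∷ 18 ∷
   17 ∷ 0 ∷ 1 ∷ 17 ∷ 0 ∷ 17 ∷ 0 ∷ 18 ∷ []) ∷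
  []

theorem1 : (k : ℕ) .{{_ : NonZero k}} → k ≡ 2 ⊎ k ≡ 3 →
    (H : Hypergraph) → IsHypertree H → IsCordial H k
-- The final `tt` inhabits `T` of the Boolean `check`: the closure of the family is verified by
-- evaluation.
theorem1 _ (inj₁ refl) = Cordiality.hypertree⇒cordial 2 diff₂ coord₂ coord₂-+ coord₂-0 coord₂-diff
  (Tabulated.closedFamily 2 diff₂ coord₂ trees₂ children₂ branches₂ only₂ join₂ also₂ hang₂ tt)
theorem1 _ (inj₂ refl) = Cordiality.hypertree⇒cordial 3 diff₃ coord₃ coord₃-+ coord₃-0 coord₃-diff
  (Tabulated.closedFamily 3 diff₃ coord₃ trees₃ children₃ branches₃ only₃ join₃ also₃ hang₃ tt)
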